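{- Let $\theta\in\,]0,1[$. There are only finitely many triples $(n,x,y)$ of integers with $n\ge 3$ and $\max\{|x|,|y|\}\ge 2$ such that $\Phi_n(x,y)\le 2^{\theta\varphi(n)}$; these triples can be effectively determined, and each of them satisfies $\max\{|x|,|y|\}=2$.
   Context: For $n\ge1$, $\phi_n(X)\in\mathbb Z[X]$ denotes the $n$-th cyclotomic polynomial, of degree $\varphi(n)$ (Euler's totient function). The cyclotomic binary form is $\Phi_n(X,Y)=Y^{\varphi(n)}\phi_n(X/Y)$.
   Formalization: The formal theorem takes θ to be a rational number p/q with 0 < p < q instead of an arbitrary real number in ]0,1[; the inequality Φ_n(x,y) ≤ 2^{θφ(n)} is then expressed exactly by taking q-th powers. -}

module Defs where

open import Data.Nat as ℕ using (ℕ; zero; suc; _∸_; _⊔_)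
open import Data.Nat.Divisibility using (_∣?_)
open import Data.Nat.Coprimality using (coprime?)
open import Data.Integer as ℤ using (ℤ; +_; -_; _+_; _*_; _-_; _^_; _≤_)
open import Data.List using (List; []; _∷_; _++_; length; reverse; map; filter; upTo; foldl)
open import Data.Sum using (_⊎_)
open import Relation.Nullary.Decidable using (does)
open import Data.Bool using (if_then_else_)

-- Polynomials over ℤ as coefficient lists, lowest degree first.
Poly : Set
Poly = List ℤ

infixl 6 _+ₚ_ _-ₚ_
_+ₚ_ : Poly → Poly → Poly
[] +ₚ q = q
(a ∷ p) +ₚ [] = a ∷ p
(a ∷ p) +ₚ (b ∷ q) = (a + b) ∷ (p +ₚ q)

_-ₚ_ : Poly → Poly → Poly
p -ₚ q = p +ₚ map -_ q

scaleₚ : ℤ → Poly → Poly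
scaleₚ c = map (c *_)

infixl 7 _*ₚ_
_*ₚ_ : Poly → Poly → Poly
[] *ₚ q = []
(a ∷ p) *ₚ q = scaleₚ a q +ₚ (+ 0 ∷ (p *ₚ q))

xPowMinus1 : ℕ → Poly
xPowMinus1 m = - + 1 ∷ go m
  where
  go : ℕ → Poly
  go zero = []
  go (suc zero) = + 1 ∷ []
  go (suc (suc k)) = + 0 ∷ go (suc k)

-- Long division of f by a monic polynomial g (exact quotient when g ∣ f).
-- Works on highest-degree-first lists: rf = reverse f, rg = tail of reverse g
-- (the leading coefficient 1 of g removed).
private
  divGo : ℕ → List ℤ → List ℤ → List ℤ
  divGo zero _ _ = []
  divGo (suc t) [] rg = []
  divGo (suc t) (c ∷ rest) rg = c ∷ divGo t (rest -ₚ scaleₚ c rg) rg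

  tailL : List ℤ → List ℤ
  tailL [] = []
  tailL (_ ∷ xs) = xs

divMonic : Poly → Poly → Poly
divMonic f g = reverse (divGo (suc (length f) ∸ length g) (reverse f) (tailL (reverse g)))

-- product of φ_d over d ∣ m, where prev = [φ_1, …, φ_k]
divisorProd : ℕ → List Poly → Poly
divisorProd m prev = go 1 prev
  where
  go : ℕ → List Poly → Poly
  go d [] = + 1 ∷ []
  go d (p ∷ ps) = if does (d ∣? m) then p *ₚ go (suc d) ps else go (suc d) ps

-- [φ_1, …, φ_n], defined recursively by  X^m - 1 = ∏_{d ∣ m} φ_d(X).
cycUpTo : ℕ → List Poly
cycUpTo zero = []
cycUpTo (suc n) = cycUpTo n ++ (divMonic (xPowMinus1 (suc n)) (divisorProd (suc n) (cycUpTo n)) ∷ [])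

-- the n-th cyclotomic polynomial φ_n(X) (coefficient list, lowest degree first); meaningful for n ≥ 1
cyclotomic : ℕ → Poly
cyclotomic n = foldl (λ _ p → p) [] (cycUpTo n)

totient : ℕ → ℕ
totient n = length (filter (λ k → coprime? k n) (map suc (upTo n)))

-- Cyclotomic binary form Φ_n(x,y) = y^{φ(n)} φ_n(x/y) = Σ_i a_i x^i y^{φ(n)-i}
Φ : ℕ → ℤ → ℤ → ℤ
Φ n x y = go 0 (cyclotomic n)
  where
  go : ℕ → Poly → ℤ
  go i [] = + 0
  go i (a ∷ as) = a * (x ^ i) * (y ^ (totient n ∸ i)) + go (suc i) as

-- "a ≤ 2^{(p/q)·e}" for the real number 2^{(p/q)e}, q ≥ 1:
-- either a ≤ 0, or a > 0 and then equivalently a^q ≤ 2^{p e}.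
≤2^[_/_]·_ : ℕ → ℕ → ℕ → ℤ → Set
(≤2^[ p / q ]· e) a = (a ≤ + 0) ⊎ (a ^ q ≤ + (2 ℕ.^ (p ℕ.* e)))

maxAbs : ℤ → ℤ → ℕ
maxAbs x y = ℤ.∣ x ∣ ⊔ ℤ.∣ y ∣

{-# OPTIONS --safe #-}
module Submission where

open import Defs
open import Data.Nat using (ℕ; zero; suc; pred; _+_; _*_; _^_; _∸_; _⊔_; _≤_; _<_; z≤n; s≤s; NonZero; >-nonZero; >-nonZero⁻¹; ≢-nonZero⁻¹; nonTrivial⇒n>1)
import Data.Nat.Properties as ℕₚ
open import Data.Nat.Induction using (<-rec)
open import Data.Nat.Divisibility using (_∣_; _∤_; _∣?_; divides; quotient; ∣-refl; ∣-trans; ∣-antisym; ∣⇒≤; >⇒∤; 1∣_; _∣0; m∣m*n; n∣m*n; ∣m⇒∣m*n; ∣n⇒∣m*n; *-pres-∣; *-monoʳ-∣; *-cancelˡ-∣; ∣m∣n⇒∣m+n; ∣m+n∣m⇒∣n; m∣n⇒n≡quotient*m)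
open import Data.Nat.GCD using (gcd; gcd[m,n]∣m; gcd[m,n]∣n; gcd-greatest; gcd-GCD; c*gcd[m,n]≡gcd[cm,cn]; module Bézout)
open import Data.Nat.LCM using (lcm; m∣lcm[m,n]; n∣lcm[m,n]; lcm-least; gcd*lcm)
open import Data.Nat.Coprimality using (Coprime; coprime?; coprime-divisor)
open import Data.Nat.Primality using (Prime; prime⇒nonZero; prime⇒nonTrivial; prime⇒irreducible; ¬prime[1]; prime[2]; ¬prime[0]; prime?; composite[4]; composite⇒¬prime; productOfPrimes≥1)
open import Data.Nat.Primality.Factorisation using (factorise; PrimeFactorisation)
open import Data.Nat.Solver using (module +-*-Solver)
open import Data.Bool using (true; false; if_then_else_)
open import Data.List using (List; []; _∷_; _++_; _∷ʳ_; length; reverse; map; filter; upTo; replicate; cartesianProduct)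
open import Data.Integer as ℤ using (ℤ; +_; -_; ∣_∣)
import Data.Integer.Properties as ℤₚ
open import Data.Integer.Solver using () renaming (module +-*-Solver to ℤSolver)
import Data.List.Properties as Listₚ
open import Data.Nat.ListAction using (product)
open import Data.List.Relation.Unary.All using (All; []; _∷_)
import Data.List.Relation.Unary.All.Properties as Allₚ
open import Data.List.Relation.Unary.Any using (here; there)
open import Data.List.Membership.Propositional using (_∈_)
open import Data.List.Membership.Propositional.Properties using (∈-upTo⁺; ∈-cartesianProduct⁺; ∈-filter⁺; ∈-filter⁻)
open import Data.Product using (Σ; _×_; _,_; proj₁; proj₂)
open import Data.Sum using (_⊎_; inj₁; inj₂; [_,_]′)
open import Data.Empty using (⊥; ⊥-elim)
open import Function using (_∘_; id)
open import Function.Bundles using (_⇔_; mk⇔)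
open import Relation.Nullary using (Dec; yes; no; does; ¬_; contradiction)
open import Relation.Nullary.Decidable using (dec-true; dec-false; toWitness; _×-dec_; _⊎-dec_)
open import Relation.Binary.PropositionalEquality using (_≡_; refl; sym; trans; cong; cong₂; subst; subst₂; module ≡-Reasoning)
open import Relation.Binary.Definitions using (tri<; tri≈; tri>)

-- For b ≥ 2 the numbers bⁿ − 1 form a strong divisibility sequence, so the lcm of the bᵈ − 1 over proper
-- divisors d of n equals the product of the φ_d(b); hence that product divides bⁿ − 1, the division
-- defining φ_n leaves no remainder, and X^n − 1 = ∏_{d ∣ n} φ_d. Splitting the divisors of p m gives, for
-- p prime,  Φ_{pm}(x,y) = Φ_m(xᵖ,yᵖ)  if p ∣ m  and  Φ_{pm}(x,y) Φ_m(x,y) = Φ_m(xᵖ,yᵖ)  if p ∤ m.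
--
-- Write M = max(|x|,|y|). By induction on the prime factors of n ≥ 3,
--   (2M/3)^φ(n) ≤ Φ_n(x,y) ≤ (2M)^φ(n),
-- starting from n = 4, p, 2p with p an odd prime and peeling off repeated primes and primes p ≥ 5.
-- So Φ_n(x,y) ≥ 2^φ(n) when M ≥ 3. When M = 2 and |x| ≠ |y|, one argument is at least twice the other
-- and the same induction, started at n = 1, gives Φ_n(x,y) ≥ 2^{φ(n) − k} with k = 2^ω(n); as
-- n k⁴ ≤ 96 φ(n)⁴, the inequality Φ_n(x,y) ≤ 2^{θ φ(n)} with θ = a/q < 1 forces n ≤ 96 q⁴.

-- Products over 1, …, n and over divisors

-- The recursive definition takes long-division quotients without asserting that the remainders
-- vanish. Instead of complex roots, values at integers b ≥ 2 settle this: strong divisibility gives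
-- the divisibility number by number, and a remainder of degree below that of the divisor, yet
-- divisible by it at every large b, is zero. The bounds are two-sided because the case p ∤ m
-- divides by Φ_m, so that a lower bound for the quotient consumes an upper bound for the divisor.
-- The ratio 2/3 is dictated by M = 3, where 2M/3 = 2. Each such division costs 3^φ(m), and
-- (3/2)^((p - 1)φ(m)) repays this for p ≥ 5 but not for p = 3, as 3 lies between (3/2)² and (3/2)⁴.
-- Hence 2 and 3 are peeled only when they divide the cofactor. At M = 2 that bound is only
-- (4/3)^φ(n), too weak near 2^φ(n), and the loss 2^k replaces it. To compare k with φ(n), note that
-- (p - 1)^s / (2^s p) is below 1 for every p if s = 1, whereas s = 4 leaves only p = 2 and p = 3
-- below 1.

∏ : ℕ → (ℕ → ℕ) → ℕ
∏ zero    f = 1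
∏ (suc n) f = ∏ n f * f (suc n)

infix 5 [_]_else-1
[_]_else-1 : ∀ {A : Set} → Dec A → ℕ → ℕ
[ d ] v else-1 = if does d then v else 1

onDivisors : ℕ → (ℕ → ℕ) → ℕ → ℕ
onDivisors n f d = [ d ∣? n ] f d else-1

∏∣ : ℕ → (ℕ → ℕ) → ℕ
∏∣ n f = ∏ n (onDivisors n f)

module _ {A : Set} where

  else-1-yes : (d : Dec A) {v : ℕ} → A → [ d ] v else-1 ≡ v
  else-1-yes d a rewrite dec-true d a = refl

  else-1-no : (d : Dec A) {v : ℕ} → ¬ A → [ d ] v else-1 ≡ 1
  else-1-no d ¬a rewrite dec-false d ¬a = refl

  else-1-const : (d : Dec A) → [ d ] 1 else-1 ≡ 1
  else-1-const (yes _) = refl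
  else-1-const (no _)  = refl

  else-1-* : (d : Dec A) {u v : ℕ} → [ d ] u else-1 * [ d ] v else-1 ≡ [ d ] u * v else-1
  else-1-* (yes _) = refl
  else-1-* (no _)  = refl

  else-1-^ : (d : Dec A) {u : ℕ} (k : ℕ) → [ d ] u ^ k else-1 ≡ ([ d ] u else-1) ^ k
  else-1-^ (yes _) k = refl
  else-1-^ (no _)  k = sym (ℕₚ.^-zeroˡ k)

  else-1-split : (d : Dec A) {u : ℕ} → u ≡ [ d ] u else-1 * (if does d then 1 else u)
  else-1-split (yes _) = sym (ℕₚ.*-identityʳ _)
  else-1-split (no _)  = sym (ℕₚ.+-identityʳ _)

else-1-cong-⇔ : {A B : Set} (d : Dec A) (e : Dec B) {v : ℕ} → (A → B) → (B → A) → [ d ] v else-1 ≡ [ e ] v else-1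
else-1-cong-⇔ (yes a) e f g = sym (else-1-yes e (f a))
else-1-cong-⇔ (no ¬a) e f g = sym (else-1-no e (¬a ∘ g))

∏-cong : ∀ n {f g} → (∀ d → 1 ≤ d → d ≤ n → f d ≡ g d) → ∏ n f ≡ ∏ n g
∏-cong zero    h = refl
∏-cong (suc n) h = cong₂ _*_ (∏-cong n (λ d 1≤d d≤n → h d 1≤d (ℕₚ.m≤n⇒m≤1+n d≤n))) (h (suc n) (s≤s z≤n) ℕₚ.≤-refl)

∏-* : ∀ n f g → ∏ n (λ d → f d * g d) ≡ ∏ n f * ∏ n g
∏-* zero    f g = refl
∏-* (suc n) f g rewrite ∏-* n f g = ℕₚ.[m*n]*[o*p]≡[m*o]*[n*p] (∏ n f) (∏ n g) (f (suc n)) (g (suc n))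

∏-^ : ∀ n f k → ∏ n (λ d → f d ^ k) ≡ ∏ n f ^ k
∏-^ n f zero    = ones n
  where
  ones : ∀ n → ∏ n (λ _ → 1) ≡ 1
  ones zero = refl
  ones (suc n) rewrite ones n = refl
∏-^ n f (suc k) = trans (∏-* n f (λ d → f d ^ k)) (cong (∏ n f *_) (∏-^ n f k))

∏-extend : ∀ m k f → (∀ d → m < d → f d ≡ 1) → ∏ (m + k) f ≡ ∏ m f
∏-extend m zero    f h = cong (λ n → ∏ n f) (ℕₚ.+-identityʳ m)
∏-extend m (suc k) f h rewrite ℕₚ.+-suc m k | h (suc (m + k)) (s≤s (ℕₚ.m≤m+n m k)) =
  trans (ℕₚ.*-identityʳ _) (∏-extend m k f h)

∏-+ : ∀ m k f → ∏ (m + k) f ≡ ∏ m f * ∏ k (λ d → f (m + d))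
∏-+ m zero    f = trans (cong (λ n → ∏ n f) (ℕₚ.+-identityʳ m)) (sym (ℕₚ.*-identityʳ _))
∏-+ m (suc k) f rewrite ℕₚ.+-suc m k | ∏-+ m k f = ℕₚ.*-assoc (∏ m f) _ _

∏-period : ∀ m f → (∀ d → f (m + d) ≡ f d) → ∀ k → ∏ (k * m) f ≡ ∏ m f ^ k
∏-period m f h zero    = refl
∏-period m f h (suc k) = trans (∏-+ m (k * m) f)
  (cong (∏ m f *_) (trans (∏-cong (k * m) (λ d _ _ → h d)) (∏-period m f h k)))

∏-nonZero : ∀ n f → (∀ d → 1 ≤ d → NonZero (f d)) → NonZero (∏ n f)
∏-nonZero zero    f h = _
∏-nonZero (suc n) f h = ℕₚ.m*n≢0 _ _ {{∏-nonZero n f h}} {{h (suc n) (s≤s z≤n)}}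

-- In each block of k + 1 consecutive indices only the last is a multiple of k + 1; induction on m
-- adds one block.
∏-multiples : ∀ k m (f : ℕ → ℕ) → ∏ (m * suc k) (λ e → [ suc k ∣? e ] f e else-1) ≡ ∏ m (λ d → f (suc k * d))
∏-multiples k zero    f = refl
∏-multiples k (suc m) f = begin
  ∏ (suc k + m * suc k) g              ≡⟨ cong (λ n → ∏ n g) (trans (ℕₚ.+-comm (suc k) (m * suc k)) (ℕₚ.+-suc (m * suc k) k)) ⟩
  ∏ (m * suc k + k) g * g (suc (m * suc k + k)) ≡⟨ cong₂ _*_ (∏-+ (m * suc k) k g) last ⟩
  ∏ (m * suc k) g * ∏ k (λ d → g (m * suc k + d)) * f (suc k * suc m) ≡⟨ cong (λ z → ∏ (m * suc k) g * z * f (suc k * suc m)) middle ⟩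
  ∏ (m * suc k) g * 1 * f (suc k * suc m) ≡⟨ cong (_* f (suc k * suc m)) (trans (ℕₚ.*-identityʳ _) (∏-multiples k m f)) ⟩
  ∏ m (λ d → f (suc k * d)) * f (suc k * suc m) ∎
  where
  open ≡-Reasoning
  g : ℕ → ℕ
  g e = [ suc k ∣? e ] f e else-1
  top : suc (m * suc k + k) ≡ suc k * suc m
  top = trans (sym (ℕₚ.+-suc (m * suc k) k)) (trans (ℕₚ.+-comm (m * suc k) (suc k)) (ℕₚ.*-comm (suc m) (suc k)))
  last : g (suc (m * suc k + k)) ≡ f (suc k * suc m)
  last = trans (cong g top) (else-1-yes (suc k ∣? (suc k * suc m)) (m∣m*n (suc m)))
  middle : ∏ k (λ d → g (m * suc k + d)) ≡ 1
  middle = trans (∏-cong k {g = λ _ → 1} (λ d 1≤d d≤k → else-1-no (suc k ∣? (m * suc k + d))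
      (λ div → >⇒∤ {{>-nonZero 1≤d}} (s≤s d≤k) (∣m+n∣m⇒∣n div (n∣m*n m)))))
      -- The power 0: a product of factors `1 ^ 0` is 1.
      (∏-^ k (λ _ → 1) 0)

onDivisors-* : ∀ n f g d → onDivisors n f d * onDivisors n g d ≡ onDivisors n (λ d → f d * g d) d
onDivisors-* n f g d = else-1-* (d ∣? n)

onDivisors-cong : ∀ n (f g : ℕ → ℕ) d → (d ∣ n → f d ≡ g d) → onDivisors n f d ≡ onDivisors n g d
onDivisors-cong n f g d h with d ∣? n
... | yes d∣n = h d∣n
... | no _    = refl

∏∣-last : ∀ n f → ∏∣ (suc n) f ≡ ∏ n (onDivisors (suc n) f) * f (suc n)
∏∣-last n f = cong (∏ n (onDivisors (suc n) f) *_) (else-1-yes (suc n ∣? suc n) ∣-refl)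

onDivisors-nonZero : ∀ n {f} → (∀ d → 1 ≤ d → NonZero (f d)) → ∀ d → 1 ≤ d → NonZero (onDivisors n f d)
onDivisors-nonZero n h d 1≤d with d ∣? n
... | yes _ = h d 1≤d
... | no _  = _

-- Möbius inversion by strong induction: the factors at proper divisors already agree, and their
-- nonzero product cancels, leaving the factor at m.
∏∣-injective : ∀ f g → (∀ d → 1 ≤ d → NonZero (g d)) → (∀ m → ∏∣ (suc m) f ≡ ∏∣ (suc m) g) →
               ∀ m → 1 ≤ m → f m ≡ g m
∏∣-injective f g g≢0 eq = <-rec (λ m → 1 ≤ m → f m ≡ g m) step
  where
  step : ∀ m → (∀ {d} → d < m → 1 ≤ d → f d ≡ g d) → 1 ≤ m → f m ≡ g m
  step (suc m) ih _ = ℕₚ.*-cancelˡ-≡ _ _ (∏ m (onDivisors (suc m) g))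
      {{∏-nonZero m _ (onDivisors-nonZero (suc m) g≢0)}}
      (begin
        ∏ m (onDivisors (suc m) g) * f (suc m) ≡⟨ cong (_* f (suc m)) (∏-cong m (λ d 1≤d d≤m → onDivisors-cong (suc m) g f d (λ _ → sym (ih (s≤s d≤m) 1≤d)))) ⟩
        ∏ m (onDivisors (suc m) f) * f (suc m) ≡⟨ ∏∣-last m f ⟨
        ∏∣ (suc m) f                           ≡⟨ eq m ⟩
        ∏∣ (suc m) g                           ≡⟨ ∏∣-last m g ⟩
        ∏ m (onDivisors (suc m) g) * g (suc m) ∎)
    where open ≡-Reasoning

unless : ∀ {A : Set} → Dec A → ℕ → ℕ
unless d v = if does d then 1 else v

unless-else-1 : {A B C : Set} (d : Dec A) (e : Dec B) (e′ : Dec C) {v : ℕ} → (¬ A → B → C) → (¬ A → C → B) →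
                unless d ([ e ] v else-1) ≡ [ e′ ] unless d v else-1
unless-else-1 (yes _)  e e′ f g = sym (else-1-const e′)
unless-else-1 (no ¬a) e e′ f g = else-1-cong-⇔ e e′ (f ¬a) (g ¬a)

prime-∤-coprime : ∀ {p e} → Prime p → p ∤ e → Coprime e p
prime-∤-coprime pr p∤e (d∣e , d∣p) with prime⇒irreducible pr d∣p
... | inj₁ d≡1  = d≡1
... | inj₂ refl = contradiction d∣e p∤e

-- The divisors of p m are the p d with d ∣ m, and the d ∣ m with p ∤ d.
∏∣-prime-* : ∀ {p} → Prime p → ∀ m f → 1 ≤ m →
             ∏∣ (p * m) f ≡ ∏∣ m (λ d → f (p * d) * unless (p ∣? d) (f d))
∏∣-prime-* {p@(suc k)} pr m f 1≤m = begin
  ∏ (p * m) h                             ≡⟨ ∏-cong (p * m) (λ e _ _ → else-1-split (p ∣? e)) ⟩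
  ∏ (p * m) (λ e → h₁ e * h₂ e)           ≡⟨ ∏-* (p * m) h₁ h₂ ⟩
  ∏ (p * m) h₁ * ∏ (p * m) h₂             ≡⟨ cong₂ _*_ multiples others ⟩
  ∏ m (onDivisors m (λ d → f (p * d))) * ∏ m (onDivisors m (λ d → unless (p ∣? d) (f d))) ≡⟨ ∏-* m _ _ ⟨
  ∏ m (λ d → onDivisors m (λ d → f (p * d)) d * onDivisors m (λ d → unless (p ∣? d) (f d)) d)
    ≡⟨ ∏-cong m (λ d _ _ → onDivisors-* m (λ d → f (p * d)) (λ d → unless (p ∣? d) (f d)) d) ⟩
  ∏∣ m (λ d → f (p * d) * unless (p ∣? d) (f d)) ∎
  where
  open ≡-Reasoning
  h h₁ h₂ : ℕ → ℕ
  h = onDivisors (p * m) f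
  h₁ e = [ p ∣? e ] h e else-1
  h₂ e = unless (p ∣? e) (h e)
  multiples : ∏ (p * m) h₁ ≡ ∏ m (onDivisors m (λ d → f (p * d)))
  multiples = trans (cong (λ n → ∏ n h₁) (ℕₚ.*-comm p m)) (trans (∏-multiples k m h)
    (∏-cong m (λ d _ _ → else-1-cong-⇔ ((p * d) ∣? (p * m)) (d ∣? m) (*-cancelˡ-∣ p) (*-monoʳ-∣ p))))
  same : ∀ e → h₂ e ≡ onDivisors m (λ d → unless (p ∣? d) (f d)) e
  same e = unless-else-1 (p ∣? e) (e ∣? (p * m)) (e ∣? m)
    (λ p∤e → coprime-divisor (prime-∤-coprime pr p∤e)) (λ _ → ∣n⇒∣m*n p)
  others : ∏ (p * m) h₂ ≡ ∏ m (onDivisors m (λ d → unless (p ∣? d) (f d)))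
  others = trans (∏-cong (p * m) (λ e _ _ → same e)) (∏-extend m (k * m) (onDivisors m (λ d → unless (p ∣? d) (f d)))
    (λ d m<d → else-1-no (d ∣? m) (>⇒∤ {{>-nonZero 1≤m}} m<d)))

-- Euler's totient

prime-induction : (P : ℕ → Set) → P 1 → (∀ p m → Prime p → 1 ≤ m → P m → P (p * m)) → ∀ n → 1 ≤ n → P n
prime-induction P P1 step n 1≤n = subst P (sym (PrimeFactorisation.isFactorisation fac))
    (go (PrimeFactorisation.factors fac) (PrimeFactorisation.factorsPrime fac))
  where
  fac : PrimeFactorisation n
  fac = factorise n {{>-nonZero 1≤n}}
  go : ∀ ps → All Prime ps → P (product ps)
  go []       []         = P1
  go (p ∷ ps) (pr ∷ prs) = step p (product ps) pr (productOfPrimes≥1 prs) (go ps prs)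

2^-injective : ∀ {m n} → 2 ^ m ≡ 2 ^ n → m ≡ n
2^-injective {m} {n} eq with ℕₚ.<-cmp m n
... | tri< m<n _ _ = contradiction eq (ℕₚ.<⇒≢ (ℕₚ.^-monoʳ-< 2 ℕₚ.≤-refl m<n))
... | tri≈ _ m≡n _ = m≡n
... | tri> _ _ n<m = contradiction (sym eq) (ℕₚ.<⇒≢ (ℕₚ.^-monoʳ-< 2 ℕₚ.≤-refl n<m))

-- As an exponent of 2 a count becomes a product, so the lemmas on `∏` serve the totient and the
-- degrees as well as the cyclotomic values.
2^count≡∏ : ∀ {P : ℕ → Set} (P? : ∀ k → Dec (P k)) n →
            2 ^ length (filter P? (map suc (upTo n))) ≡ ∏ n (λ k → [ P? k ] 2 else-1)
2^count≡∏ P? zero    = refl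
2^count≡∏ P? (suc n) = begin
  2 ^ length (filter P? (map suc (upTo (suc n))))
    ≡⟨ cong (λ l → 2 ^ length (filter P? (map suc l))) (sym (Listₚ.upTo-∷ʳ n)) ⟩
  2 ^ length (filter P? (map suc (upTo n ++ n ∷ [])))
    ≡⟨ cong (λ l → 2 ^ length (filter P? l)) (Listₚ.map-++ suc (upTo n) _) ⟩
  2 ^ length (filter P? (map suc (upTo n) ++ suc n ∷ []))
    ≡⟨ cong (λ l → 2 ^ length l) (Listₚ.filter-++ P? (map suc (upTo n)) _) ⟩
  2 ^ length (filter P? (map suc (upTo n)) ++ filter P? (suc n ∷ []))
    ≡⟨ cong (2 ^_) (Listₚ.length-++ (filter P? (map suc (upTo n)))) ⟩
  2 ^ (length (filter P? (map suc (upTo n))) + length (filter P? (suc n ∷ [])))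
    ≡⟨ ℕₚ.^-distribˡ-+-* 2 (length (filter P? (map suc (upTo n)))) _ ⟩
  2 ^ length (filter P? (map suc (upTo n))) * 2 ^ length (filter P? (suc n ∷ []))
    ≡⟨ cong₂ _*_ (2^count≡∏ P? n) last ⟩
  ∏ n (λ k → [ P? k ] 2 else-1) * [ P? (suc n) ] 2 else-1 ∎
  where
  open ≡-Reasoning
  last : 2 ^ length (filter P? (suc n ∷ [])) ≡ [ P? (suc n) ] 2 else-1
  last with P? (suc n)
  ... | yes _ = refl
  ... | no _  = refl

coprimeWeight : ℕ → ℕ → ℕ
coprimeWeight n k = [ coprime? k n ] 2 else-1

2^totient≡∏ : ∀ n → 2 ^ totient n ≡ ∏ n (coprimeWeight n)
2^totient≡∏ n = 2^count≡∏ (λ k → coprime? k n) n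

coprime-*⇒ : ∀ {k} p {m} → Coprime k (p * m) → Coprime k m
coprime-*⇒ p co (i∣k , i∣m) = co (i∣k , ∣n⇒∣m*n p i∣m)

coprime-*⇐ : ∀ {k p m} → Prime p → p ∤ k → Coprime k m → Coprime k (p * m)
coprime-*⇐ {k} {p} {m} pr p∤k co {i} (i∣k , i∣pm) = co (i∣k , coprime-divisor i-p i∣pm)
  where
  i-p : Coprime i p
  i-p (d∣i , d∣p) = prime-∤-coprime pr p∤k (∣-trans d∣i i∣k , d∣p)

coprimeWeight-period : ∀ m d → coprimeWeight m (m + d) ≡ coprimeWeight m d
coprimeWeight-period m d = else-1-cong-⇔ (coprime? (m + d) m) (coprime? d m)
  (λ co (i∣d , i∣m) → co (∣m∣n⇒∣m+n i∣m i∣d , i∣m))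
  (λ co (i∣m+d , i∣m) → co (∣m+n∣m⇒∣n i∣m+d i∣m , i∣m))

coprimeWeight-*ˡ : ∀ {p m} → Prime p → p ∤ m → ∀ d → coprimeWeight m (p * d) ≡ coprimeWeight m d
coprimeWeight-*ˡ {p} {m} pr p∤m d = else-1-cong-⇔ (coprime? (p * d) m) (coprime? d m)
  (λ co (i∣d , i∣m) → co (∣n⇒∣m*n p i∣d , i∣m))
  (λ co (i∣pd , i∣m) → co (coprime-divisor (λ (j∣i , j∣p) → prime-∤-coprime pr p∤m (∣-trans j∣i i∣m , j∣p)) i∣pd , i∣m))

unless-∧ : {A B C : Set} (a : Dec A) (b : Dec B) (c : Dec C) {v : ℕ} → (C → ¬ A) → (C → B) → (¬ A → B → C) →
           unless a ([ b ] v else-1) ≡ [ c ] v else-1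
unless-∧ (yes a) b c f g h = sym (else-1-no c (λ x → f x a))
unless-∧ (no ¬a) b c f g h = else-1-cong-⇔ b c (h ¬a) g

coprime⇒∤ : ∀ {p k m} → Prime p → Coprime k (p * m) → p ∤ k
coprime⇒∤ {p} {m = m} pr co p∣k = ¬prime[1] (subst Prime (co (p∣k , m∣m*n m)) pr)

-- Among 1, ..., p m the numbers coprime to m fill p periods with φ(m) in each. If p ∣ m, they are
-- the numbers coprime to p m. Otherwise they include also the multiples p d with d ≤ m coprime to
-- m, which account for another φ(m).
2^totient-prime-* : ∀ {p} → Prime p → ∀ m → 2 ^ totient (p * m) * unless (p ∣? m) (2 ^ totient m) ≡ (2 ^ totient m) ^ p
2^totient-prime-* {p@(suc k)} pr m = trans (cases (p ∣? m)) (begin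
  ∏ (p * m) (coprimeWeight m)     ≡⟨ ∏-period m (coprimeWeight m) (coprimeWeight-period m) p ⟩
  ∏ m (coprimeWeight m) ^ p       ≡⟨ cong (_^ p) (2^totient≡∏ m) ⟨
  (2 ^ totient m) ^ p             ∎)
  where
  open ≡-Reasoning
  multiples : p ∤ m → ∏ (p * m) (λ e → [ p ∣? e ] coprimeWeight m e else-1) ≡ 2 ^ totient m
  multiples p∤m = begin
    ∏ (p * m) g                        ≡⟨ cong (λ n → ∏ n g) (ℕₚ.*-comm p m) ⟩
    ∏ (m * p) g                        ≡⟨ ∏-multiples k m (coprimeWeight m) ⟩
    ∏ m (λ d → coprimeWeight m (p * d)) ≡⟨ ∏-cong m (λ d _ _ → coprimeWeight-*ˡ pr p∤m d) ⟩
    ∏ m (coprimeWeight m)              ≡⟨ 2^totient≡∏ m ⟨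
    2 ^ totient m                      ∎
    where
    g : ℕ → ℕ
    g e = [ p ∣? e ] coprimeWeight m e else-1
  others : ∏ (p * m) (λ e → unless (p ∣? e) (coprimeWeight m e)) ≡ 2 ^ totient (p * m)
  others = trans (∏-cong (p * m) (λ e _ _ → unless-∧ (p ∣? e) (coprime? e m) (coprime? e (p * m))
      (coprime⇒∤ pr) (coprime-*⇒ p) (coprime-*⇐ pr)))
    (sym (2^totient≡∏ (p * m)))
  cases : (d : Dec (p ∣ m)) → 2 ^ totient (p * m) * unless d (2 ^ totient m) ≡ ∏ (p * m) (coprimeWeight m)
  cases (yes p∣m) = trans (ℕₚ.*-identityʳ _) (trans (2^totient≡∏ (p * m))
    (∏-cong (p * m) (λ e _ _ → else-1-cong-⇔ (coprime? e (p * m)) (coprime? e m) (coprime-*⇒ p)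
      (λ co → coprime-*⇐ pr (λ p∣e → ¬prime[1] (subst Prime (co (p∣e , p∣m)) pr)) co))))
  cases (no p∤m) = begin
    2 ^ totient (p * m) * 2 ^ totient m ≡⟨ ℕₚ.*-comm (2 ^ totient (p * m)) _ ⟩
    2 ^ totient m * 2 ^ totient (p * m) ≡⟨ cong₂ _*_ (sym (multiples p∤m)) (sym others) ⟩
    _                                   ≡⟨ ∏-* (p * m) (λ e → [ p ∣? e ] coprimeWeight m e else-1) _ ⟨
    _                                   ≡⟨ ∏-cong (p * m) (λ e _ _ → else-1-split (p ∣? e)) ⟨
    ∏ (p * m) (coprimeWeight m)         ∎

2^*≡^ : ∀ e p → (2 ^ e) ^ p ≡ 2 ^ (p * e)
2^*≡^ e p = trans (ℕₚ.^-*-assoc 2 e p) (cong (2 ^_) (ℕₚ.*-comm e p))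

totient-prime-∣ : ∀ {p m} → Prime p → p ∣ m → totient (p * m) ≡ p * totient m
totient-prime-∣ {p} {m} pr p∣m = 2^-injective (begin
  2 ^ totient (p * m)                                   ≡⟨ ℕₚ.*-identityʳ _ ⟨
  2 ^ totient (p * m) * 1                               ≡⟨ cong (λ b → 2 ^ totient (p * m) * (if b then 1 else 2 ^ totient m)) (dec-true (p ∣? m) p∣m) ⟨
  2 ^ totient (p * m) * unless (p ∣? m) (2 ^ totient m) ≡⟨ 2^totient-prime-* pr m ⟩
  (2 ^ totient m) ^ p                                   ≡⟨ 2^*≡^ (totient m) p ⟩
  2 ^ (p * totient m)                                   ∎)
  where open ≡-Reasoning

totient-prime-∤ : ∀ {p m} → Prime p → p ∤ m → totient (p * m) + totient m ≡ p * totient m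
totient-prime-∤ {p} {m} pr p∤m = 2^-injective (begin
  2 ^ (totient (p * m) + totient m)                     ≡⟨ ℕₚ.^-distribˡ-+-* 2 (totient (p * m)) (totient m) ⟩
  2 ^ totient (p * m) * 2 ^ totient m                   ≡⟨ cong (λ b → 2 ^ totient (p * m) * (if b then 1 else 2 ^ totient m)) (dec-false (p ∣? m) p∤m) ⟨
  2 ^ totient (p * m) * unless (p ∣? m) (2 ^ totient m) ≡⟨ 2^totient-prime-* pr m ⟩
  (2 ^ totient m) ^ p                                   ≡⟨ 2^*≡^ (totient m) p ⟩
  2 ^ (p * totient m)                                   ∎)
  where open ≡-Reasoning

-- Gauss' identity ∑_{d ∣ n} φ(d) = n, exponentiated.
∏∣-2^totient : ∀ n → 1 ≤ n → ∏∣ n (λ d → 2 ^ totient d) ≡ 2 ^ n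
∏∣-2^totient = prime-induction (λ n → ∏∣ n φ₂ ≡ 2 ^ n) refl step
  where
  open ≡-Reasoning
  φ₂ : ℕ → ℕ
  φ₂ d = 2 ^ totient d
  step : ∀ p m → Prime p → 1 ≤ m → ∏∣ m φ₂ ≡ 2 ^ m → ∏∣ (p * m) φ₂ ≡ 2 ^ (p * m)
  step p m pr 1≤m ih = begin
    ∏∣ (p * m) φ₂                                     ≡⟨ ∏∣-prime-* pr m φ₂ 1≤m ⟩
    ∏∣ m (λ d → φ₂ (p * d) * unless (p ∣? d) (φ₂ d))  ≡⟨ ∏-cong m (λ d _ _ → onDivisors-cong m (λ d → φ₂ (p * d) * unless (p ∣? d) (φ₂ d)) (λ d → φ₂ d ^ p) d (λ _ → 2^totient-prime-* pr d)) ⟩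
    ∏∣ m (λ d → φ₂ d ^ p)                             ≡⟨ ∏-cong m (λ d _ _ → else-1-^ (d ∣? m) p) ⟩
    ∏ m (λ d → onDivisors m φ₂ d ^ p)                 ≡⟨ ∏-^ m (onDivisors m φ₂) p ⟩
    ∏∣ m φ₂ ^ p                                       ≡⟨ cong (_^ p) ih ⟩
    (2 ^ m) ^ p                                       ≡⟨ 2^*≡^ m p ⟩
    2 ^ (p * m)                                       ∎

totient-pos : ∀ n → 1 ≤ n → 1 ≤ totient n
totient-pos = prime-induction (λ n → 1 ≤ totient n) ℕₚ.≤-refl step
  where
  step : ∀ p m → Prime p → 1 ≤ m → 1 ≤ totient m → 1 ≤ totient (p * m)
  step p m pr 1≤m 1≤φ with p ∣? m
  ... | yes p∣m = subst (1 ≤_) (sym (totient-prime-∣ pr p∣m))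
          (ℕₚ.*-mono-≤ (ℕₚ.<⇒≤ (nonTrivial⇒n>1 p {{prime⇒nonTrivial pr}})) 1≤φ)
  ... | no p∤m = ℕₚ.+-cancelʳ-≤ (totient m) 1 _ (subst (1 + totient m ≤_) (sym (totient-prime-∤ pr p∤m))
          (ℕₚ.≤-trans (ℕₚ.+-monoˡ-≤ (totient m) 1≤φ)
            (subst (_≤ p * totient m) (cong (_+_ (totient m)) (ℕₚ.+-identityʳ _)) (ℕₚ.*-monoˡ-≤ (totient m) (nonTrivial⇒n>1 p {{prime⇒nonTrivial pr}})))))

-- The strong divisibility sequence bⁿ − 1

-- Built on bⁿ⁺¹ - 1 = (b - 1) + b (bⁿ - 1), which avoids truncated subtraction of powers.
powMinus1 : ℕ → ℕ → ℕ
powMinus1 b zero    = 0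
powMinus1 b (suc n) = pred b + b * powMinus1 b n

suc-powMinus1 : ∀ b .{{_ : NonZero b}} n → suc (powMinus1 b n) ≡ b ^ n
suc-powMinus1 b       zero    = refl
suc-powMinus1 b@(suc c) (suc n) = begin
  b + b * powMinus1 b n   ≡⟨ ℕₚ.*-suc b _ ⟨
  b * suc (powMinus1 b n) ≡⟨ cong (b *_) (suc-powMinus1 b n) ⟩
  b * b ^ n               ∎
  where open ≡-Reasoning

powMinus1-+ : ∀ b m n → powMinus1 b (m + n) ≡ powMinus1 b m + b ^ m * powMinus1 b n
powMinus1-+ b zero    n = sym (ℕₚ.+-identityʳ _)
powMinus1-+ b (suc m) n rewrite powMinus1-+ b m n =
  solve 5 (λ c b x y z → c :+ b :* (x :+ y :* z) := c :+ b :* x :+ b :* y :* z) refl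
    (pred b) b (powMinus1 b m) (b ^ m) (powMinus1 b n)
  where open +-*-Solver

powMinus1-∣ : ∀ b {d n} → d ∣ n → powMinus1 b d ∣ powMinus1 b n
powMinus1-∣ b {d} (divides q refl) = go q
  where
  go : ∀ q → powMinus1 b d ∣ powMinus1 b (q * d)
  go zero    = _ ∣0
  go (suc q) = subst (powMinus1 b d ∣_) (sym (powMinus1-+ b d (q * d)))
    (∣m∣n⇒∣m+n ∣-refl (∣n⇒∣m*n (b ^ d) (go q)))

-- Bézout gives, up to exchanging m and n, x m = d + y n with d the gcd. In b^(x m) - 1 = (b^d - 1)
-- + b^d (b^(y n) - 1) the left side and the last term are divisible by g, so no power of b has to
-- be cancelled.
powMinus1-gcd : ∀ b {g m n} → g ∣ powMinus1 b m → g ∣ powMinus1 b n → g ∣ powMinus1 b (gcd m n)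
powMinus1-gcd b {g} {m} {n} g∣m g∣n with Bézout.identity (gcd-GCD m n)
... | Bézout.+- x y eq = ∣m+n∣m⇒∣n
  (subst (g ∣_) (trans (cong (powMinus1 b) (sym eq)) (trans (powMinus1-+ b (gcd m n) (y * n)) (ℕₚ.+-comm (powMinus1 b (gcd m n)) _)))
    (∣-trans g∣m (powMinus1-∣ b (n∣m*n x))))
  (∣n⇒∣m*n (b ^ gcd m n) (∣-trans g∣n (powMinus1-∣ b (n∣m*n y))))
... | Bézout.-+ x y eq = ∣m+n∣m⇒∣n
  (subst (g ∣_) (trans (cong (powMinus1 b) (sym eq)) (trans (powMinus1-+ b (gcd m n) (x * m)) (ℕₚ.+-comm (powMinus1 b (gcd m n)) _)))
    (∣-trans g∣n (powMinus1-∣ b (n∣m*n y))))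
  (∣n⇒∣m*n (b ^ gcd m n) (∣-trans g∣m (powMinus1-∣ b (n∣m*n x))))

powMinus1-nonZero : ∀ {b n} → 1 < b → 1 ≤ n → NonZero (powMinus1 b n)
powMinus1-nonZero {suc (suc b)} {suc n} _ _ = _
powMinus1-nonZero {suc zero} (s≤s ()) _

∣-nonZero : ∀ {m n} → m ∣ n → NonZero n → NonZero m
∣-nonZero {zero}  (divides q refl) n≢0 = contradiction (ℕₚ.*-zeroʳ q) (≢-nonZero⁻¹ (q * 0) {{n≢0}})
∣-nonZero {suc m} _                _   = _

-- Cancelling gcd(u,v,g), this is  g·gcd(u,v,g) ∣ gcd(u,g)·gcd(v,g),  a divisibility of generators.
∣lcm⇒∣lcm-gcd : ∀ {g u v} → NonZero g → g ∣ lcm u v → g ∣ lcm (gcd u g) (gcd v g)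
∣lcm⇒∣lcm-gcd {g} {u} {v} g≢0 g∣l = *-cancelˡ-∣ w {{∣-nonZero (∣-trans w∣gu (gcd[m,n]∣n u g)) g≢0}}
    (subst₂ _∣_ (ℕₚ.*-comm g w) (sym (gcd*lcm gu gv)) gw∣)
  where
  gu gv w : ℕ
  gu = gcd u g
  gv = gcd v g
  w  = gcd gu gv
  w∣gu : w ∣ gu
  w∣gu = gcd[m,n]∣m gu gv
  w∣v : w ∣ v
  w∣v = ∣-trans (gcd[m,n]∣n gu gv) (gcd[m,n]∣m v g)
  w∣gcd : w ∣ gcd u v
  w∣gcd = gcd-greatest (∣-trans w∣gu (gcd[m,n]∣m u g)) w∣v
  gw∣vu : g * w ∣ v * u
  gw∣vu = subst (g * w ∣_) (trans (ℕₚ.*-comm (lcm u v) (gcd u v)) (trans (gcd*lcm u v) (ℕₚ.*-comm u v)))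
            (*-pres-∣ g∣l w∣gcd)
  gw∣vg : g * w ∣ v * g
  gw∣vg = subst (g * w ∣_) (ℕₚ.*-comm g v) (*-monoʳ-∣ g w∣v)
  gw∣guv : g * w ∣ gu * v
  gw∣guv = subst (g * w ∣_) (trans (sym (c*gcd[m,n]≡gcd[cm,cn] v u g)) (ℕₚ.*-comm v gu)) (gcd-greatest gw∣vu gw∣vg)
  gw∣gug : g * w ∣ gu * g
  gw∣gug = subst (g * w ∣_) (ℕₚ.*-comm g gu) (*-monoʳ-∣ g w∣gu)
  gw∣ : g * w ∣ gu * gv
  gw∣ = subst (g * w ∣_) (sym (c*gcd[m,n]≡gcd[cm,cn] gu v g)) (gcd-greatest gw∣guv gw∣gug)

module _ (b : ℕ) where

  lcmUpTo : ℕ → ℕ → ℕ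
  lcmUpTo n zero    = 1
  lcmUpTo n (suc k) = lcm (lcmUpTo n k) (onDivisors n (powMinus1 b) (suc k))

  lcmUpTo-least : ∀ n k {x} → (∀ {d} → 1 ≤ d → d ≤ k → d ∣ n → powMinus1 b d ∣ x) → lcmUpTo n k ∣ x
  lcmUpTo-least n zero        h = 1∣ _
  lcmUpTo-least n (suc k) {x} h = lcm-least
      (lcmUpTo-least n k (λ 1≤d d≤k → h 1≤d (ℕₚ.m≤n⇒m≤1+n d≤k))) (last (suc k ∣? n))
    where
    last : (d : Dec (suc k ∣ n)) → [ d ] powMinus1 b (suc k) else-1 ∣ x
    last (yes d∣n) = h (s≤s z≤n) ℕₚ.≤-refl d∣n
    last (no _)    = 1∣ x

  ∣lcmUpTo : ∀ n k {d} → 1 ≤ d → d ≤ k → d ∣ n → powMinus1 b d ∣ lcmUpTo n k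
  ∣lcmUpTo n zero    {zero} () _ _
  ∣lcmUpTo n (suc k) {d} 1≤d d≤k d∣n with ℕₚ.m≤n⇒m<n∨m≡n d≤k
  ... | inj₁ (s≤s d≤k′) = ∣-trans (∣lcmUpTo n k 1≤d d≤k′ d∣n) (m∣lcm[m,n] (lcmUpTo n k) _)
  ... | inj₂ refl = subst (_∣ lcmUpTo n (suc k)) (else-1-yes (suc k ∣? n) d∣n) (n∣lcm[m,n] (lcmUpTo n k) _)

  lcmUpTo-∣ : ∀ n k → lcmUpTo n k ∣ powMinus1 b n
  lcmUpTo-∣ n k = lcmUpTo-least n k (λ _ _ → powMinus1-∣ b)

  -- A common divisor of bⁱ − 1 and b^{k+1} − 1 with i ≤ k divides b^{gcd(i,k+1)} − 1.
  lcmUpTo-gcd : ∀ n j k {g} → NonZero g → j ≤ k → g ∣ lcmUpTo n j → g ∣ powMinus1 b (suc k) → g ∣ lcmUpTo (suc k) k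
  lcmUpTo-gcd n zero    k     _   _   g∣1 _  = ∣-trans g∣1 (1∣ _)
  lcmUpTo-gcd n (suc j) k {g} g≢0 j<k g∣l g∣k = ∣-trans (∣lcm⇒∣lcm-gcd {u = lcmUpTo n j} {v = onDivisors n (powMinus1 b) (suc j)} g≢0 g∣l)
      (lcm-least
        (lcmUpTo-gcd n j k (∣-nonZero (gcd[m,n]∣n ℓ g) g≢0) (ℕₚ.<⇒≤ j<k) (gcd[m,n]∣m ℓ g) (∣-trans (gcd[m,n]∣n ℓ g) g∣k))
        (last (suc j ∣? n)))
    where
    ℓ : ℕ
    ℓ = lcmUpTo n j
    last : (d : Dec (suc j ∣ n)) → gcd ([ d ] powMinus1 b (suc j) else-1) g ∣ lcmUpTo (suc k) k
    last (no _)  = ∣-trans (gcd[m,n]∣m 1 g) (1∣ _)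
    last (yes _) = ∣-trans
      (powMinus1-gcd b {m = suc j} {n = suc k} (gcd[m,n]∣m (powMinus1 b (suc j)) g) (∣-trans (gcd[m,n]∣n (powMinus1 b (suc j)) g) g∣k))
      (∣lcmUpTo (suc k) k (>-nonZero⁻¹ _ {{∣-nonZero (gcd[m,n]∣m (suc j) (suc k)) _}})
        (ℕₚ.≤-trans (∣⇒≤ (gcd[m,n]∣m (suc j) (suc k))) j<k) (gcd[m,n]∣n (suc j) (suc k)))

  -- cyc n is the value at b of the n-th cyclotomic polynomial.
  cyc : ℕ → ℕ
  cyc n = quotient (lcmUpTo-∣ n (pred n))

  lcmUpTo*cyc : ∀ k → lcmUpTo (suc k) k * cyc (suc k) ≡ powMinus1 b (suc k)
  lcmUpTo*cyc k = trans (ℕₚ.*-comm (lcmUpTo (suc k) k) _) (sym (m∣n⇒n≡quotient*m (lcmUpTo-∣ (suc k) k)))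

module _ {b : ℕ} (1<b : 1 < b) where

  -- If k + 1 divides n, the gcd of the lcm ℓ reached so far and bᵏ⁺¹ - 1 is ℓ′, the lcm over the
  -- proper divisors of k + 1 (`lcmUpTo-gcd`). As gcd times lcm is the product, the lcm grows by
  -- exactly (bᵏ⁺¹ - 1) / ℓ′.
  lcmUpTo≡∏ : ∀ n k → lcmUpTo b n k ≡ ∏ k (onDivisors n (cyc b))
  lcmUpTo≡∏ n zero    = refl
  lcmUpTo≡∏ n (suc k) = trans (last (suc k ∣? n)) (cong (_* onDivisors n (cyc b) (suc k)) (lcmUpTo≡∏ n k))
    where
    open ≡-Reasoning
    ℓ ℓ′ : ℕ
    ℓ  = lcmUpTo b n k
    ℓ′ = lcmUpTo b (suc k) k
    a≢0 : NonZero (powMinus1 b (suc k))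
    a≢0 = powMinus1-nonZero {n = suc k} 1<b (s≤s z≤n)
    gcd≡ : suc k ∣ n → gcd ℓ (powMinus1 b (suc k)) ≡ ℓ′
    gcd≡ d∣n = ∣-antisym
      (lcmUpTo-gcd b n k k (∣-nonZero (gcd[m,n]∣n ℓ _) a≢0) ℕₚ.≤-refl (gcd[m,n]∣m ℓ _) (gcd[m,n]∣n ℓ _))
      (gcd-greatest (lcmUpTo-least b (suc k) k (λ 1≤e e≤k e∣d → ∣lcmUpTo b n k 1≤e e≤k (∣-trans e∣d d∣n)))
        (lcmUpTo-∣ b (suc k) k))
    last : (d : Dec (suc k ∣ n)) → lcm ℓ ([ d ] powMinus1 b (suc k) else-1) ≡ ℓ * [ d ] cyc b (suc k) else-1
    last (no _)    = ∣-antisym (lcm-least {ℓ} {1} (m∣m*n 1) (1∣ _)) (subst (_∣ lcm ℓ 1) (sym (ℕₚ.*-identityʳ ℓ)) (m∣lcm[m,n] ℓ 1))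
    last (yes d∣n) = ℕₚ.*-cancelˡ-≡ _ _ ℓ′ {{∣-nonZero (lcmUpTo-∣ b (suc k) k) a≢0}} (begin
      ℓ′ * lcm ℓ (powMinus1 b (suc k))           ≡⟨ cong (_* lcm ℓ (powMinus1 b (suc k))) (gcd≡ d∣n) ⟨
      gcd ℓ (powMinus1 b (suc k)) * lcm ℓ (powMinus1 b (suc k)) ≡⟨ gcd*lcm ℓ (powMinus1 b (suc k)) ⟩
      ℓ * powMinus1 b (suc k)                    ≡⟨ cong (ℓ *_) (lcmUpTo*cyc b k) ⟨
      ℓ * (ℓ′ * cyc b (suc k))                   ≡⟨ ℕₚ.*-assoc ℓ ℓ′ _ ⟨
      ℓ * ℓ′ * cyc b (suc k)                     ≡⟨ cong (_* cyc b (suc k)) (ℕₚ.*-comm ℓ ℓ′) ⟩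
      ℓ′ * ℓ * cyc b (suc k)                     ≡⟨ ℕₚ.*-assoc ℓ′ ℓ _ ⟩
      ℓ′ * (ℓ * cyc b (suc k))                   ∎)

  properDivisors*cyc : ∀ k → ∏ k (onDivisors (suc k) (cyc b)) * cyc b (suc k) ≡ powMinus1 b (suc k)
  properDivisors*cyc k = trans (cong (_* cyc b (suc k)) (sym (lcmUpTo≡∏ (suc k) k))) (lcmUpTo*cyc b k)

  ∏∣-cyc : ∀ k → ∏∣ (suc k) (cyc b) ≡ powMinus1 b (suc k)
  ∏∣-cyc k = trans (∏∣-last k (cyc b)) (properDivisors*cyc k)

  cyc-nonZero : ∀ n → 1 ≤ n → NonZero (cyc b n)
  cyc-nonZero (suc k) _ = ∣-nonZero (divides (lcmUpTo b (suc k) k) (sym (lcmUpTo*cyc b k))) (powMinus1-nonZero {n = suc k} 1<b (s≤s z≤n))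

powMinus1-* : ∀ {b} → 1 < b → ∀ p m → powMinus1 b (p * m) ≡ powMinus1 (b ^ p) m
powMinus1-* {b} 1<b p m = ℕₚ.suc-injective (begin
  suc (powMinus1 b (p * m))     ≡⟨ suc-powMinus1 b (p * m) ⟩
  b ^ (p * m)                   ≡⟨ ℕₚ.^-*-assoc b p m ⟨
  (b ^ p) ^ m                   ≡⟨ suc-powMinus1 (b ^ p) m ⟨
  suc (powMinus1 (b ^ p) m)     ∎)
  where
  open ≡-Reasoning
  instance
    _ : NonZero b
    _ = >-nonZero (ℕₚ.<⇒≤ 1<b)
    _ : NonZero (b ^ p)
    _ = ℕₚ.m^n≢0 b p

1<^ : ∀ {b p} → 1 < b → 1 ≤ p → 1 < b ^ p
1<^ {b} {p} 1<b 1≤p = ℕₚ.≤-trans (subst (1 <_) (sym (ℕₚ.*-identityʳ b)) 1<b) (ℕₚ.^-monoʳ-≤ b {{>-nonZero (ℕₚ.<⇒≤ 1<b)}} 1≤p)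

prime≥2 : ∀ {p} → Prime p → 2 ≤ p
prime≥2 {p} pr = nonTrivial⇒n>1 p {{prime⇒nonTrivial pr}}

-- Over the divisors of m both sides multiply to b^(p m) - 1 = (bᵖ)ᵐ - 1: the left by splitting the
-- divisors of p m, the right by `∏∣-cyc` at the base bᵖ. Inversion then compares single factors.
cyc-prime-* : ∀ {b} → 1 < b → ∀ {p} → Prime p → ∀ m → 1 ≤ m →
              cyc b (p * m) * unless (p ∣? m) (cyc b m) ≡ cyc (b ^ p) m
cyc-prime-* {b} 1<b {p} pr = ∏∣-injective _ (cyc (b ^ p)) (cyc-nonZero 1<b^p) (λ m → begin
    ∏∣ (suc m) (λ d → cyc b (p * d) * unless (p ∣? d) (cyc b d)) ≡⟨ ∏∣-prime-* pr (suc m) (cyc b) (s≤s z≤n) ⟨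
    ∏∣ (p * suc m) (cyc b)          ≡⟨ whole (p * suc m) (ℕₚ.*-mono-≤ (ℕₚ.<⇒≤ (prime≥2 pr)) (s≤s (z≤n {m}))) ⟩
    powMinus1 b (p * suc m)         ≡⟨ powMinus1-* 1<b p (suc m) ⟩
    powMinus1 (b ^ p) (suc m)       ≡⟨ ∏∣-cyc 1<b^p m ⟨
    ∏∣ (suc m) (cyc (b ^ p))        ∎)
  where
  open ≡-Reasoning
  1<b^p : 1 < b ^ p
  1<b^p = 1<^ 1<b (ℕₚ.<⇒≤ (prime≥2 pr))
  whole : ∀ n → 1 ≤ n → ∏∣ n (cyc b) ≡ powMinus1 b n
  whole (suc k) _ = ∏∣-cyc 1<b k

-- Evaluation of polynomials

eval : Poly → ℤ → ℤ
eval []      x = + 0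
eval (a ∷ p) x = a ℤ.+ x ℤ.* eval p x

eval-+ₚ : ∀ p q x → eval (p +ₚ q) x ≡ eval p x ℤ.+ eval q x
eval-+ₚ []      q       x = sym (ℤₚ.+-identityˡ _)
eval-+ₚ (a ∷ p) []      x = sym (ℤₚ.+-identityʳ _)
eval-+ₚ (a ∷ p) (b ∷ q) x rewrite eval-+ₚ p q x =
  solve 5 (λ a b x u v → a :+ b :+ x :* (u :+ v) := a :+ x :* u :+ (b :+ x :* v)) refl a b x (eval p x) (eval q x)
  where open ℤSolver

eval-scaleₚ : ∀ c p x → eval (scaleₚ c p) x ≡ c ℤ.* eval p x
eval-scaleₚ c []      x = sym (ℤₚ.*-zeroʳ c)
eval-scaleₚ c (a ∷ p) x rewrite eval-scaleₚ c p x =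
  solve 4 (λ c a x u → c :* a :+ x :* (c :* u) := c :* (a :+ x :* u)) refl c a x (eval p x)
  where open ℤSolver

eval-*ₚ : ∀ p q x → eval (p *ₚ q) x ≡ eval p x ℤ.* eval q x
eval-*ₚ []      q x = refl
eval-*ₚ (a ∷ p) q x rewrite eval-+ₚ (scaleₚ a q) (+ 0 ∷ (p *ₚ q)) x | eval-scaleₚ a q x | eval-*ₚ p q x =
  solve 4 (λ a x u v → a :* v :+ (con (+ 0) :+ x :* (u :* v)) := (a :+ x :* u) :* v) refl a x (eval p x) (eval q x)
  where open ℤSolver

eval-++ : ∀ p q x → eval (p ++ q) x ≡ eval p x ℤ.+ x ℤ.^ length p ℤ.* eval q x
eval-++ []      q x = solve 1 (λ v → v := con (+ 0) :+ con (+ 1) :* v) refl (eval q x)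
  where open ℤSolver
eval-++ (a ∷ p) q x rewrite eval-++ p q x =
  solve 5 (λ a x u y v → a :+ x :* (u :+ y :* v) := a :+ x :* u :+ x :* y :* v) refl a x (eval p x) (x ℤ.^ length p) (eval q x)
  where open ℤSolver

eval-∷ʳ : ∀ p c x → eval (p ∷ʳ c) x ≡ eval p x ℤ.+ x ℤ.^ length p ℤ.* c
eval-∷ʳ p c x = trans (eval-++ p (c ∷ []) x)
  (solve 4 (λ u y c x → u :+ y :* (c :+ x :* con (+ 0)) := u :+ y :* c) refl (eval p x) (x ℤ.^ length p) c x)
  where open ℤSolver

-- Long division by a monic polynomial

-- divGo is private in Defs; generalising the goal over its arguments lets unification recover it.
mutual
  divSteps : ℕ → List ℤ → List ℤ → List ℤ
  divSteps = _

  divMonic≡divSteps : ∀ f g → divMonic f g ≡ reverse (divSteps (suc (length f) ∸ length g) (reverse f) (reverse g))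
  divMonic≡divSteps f g with suc (length f) ∸ length g | reverse {A = ℤ}
  ... | t | rev with rev f | rev g
  ... | F | G = refl

evalʳ : List ℤ → ℤ → ℤ
evalʳ p x = eval (reverse p) x

evalʳ-∷ : ∀ c p x → evalʳ (c ∷ p) x ≡ evalʳ p x ℤ.+ x ℤ.^ length p ℤ.* c
evalʳ-∷ c p x = trans (cong (λ l → eval l x) (Listₚ.unfold-reverse c p))
  (trans (eval-∷ʳ (reverse p) c x) (cong (λ n → evalʳ p x ℤ.+ x ℤ.^ n ℤ.* c) (Listₚ.length-reverse p)))

+ₚ-identityʳ : ∀ p → p +ₚ [] ≡ p
+ₚ-identityʳ []      = refl
+ₚ-identityʳ (a ∷ p) = refl

length-+ₚ : ∀ p q → length q ≤ length p → length (p +ₚ q) ≡ length p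
length-+ₚ []      []      _         = refl
length-+ₚ (a ∷ p) []      _         = refl
length-+ₚ (a ∷ p) (b ∷ q) (s≤s q≤p) = cong suc (length-+ₚ p q q≤p)

-- With the highest degree first, `+ₚ` aligns leading coefficients, so q is shifted up by the
-- difference t of the lengths. This is the shift in one step of long division.
evalʳ-+ₚ : ∀ t p q x → length p ≡ t + length q → evalʳ (p +ₚ q) x ≡ evalʳ p x ℤ.+ x ℤ.^ t ℤ.* evalʳ q x
evalʳ-+ₚ t p [] x eq rewrite +ₚ-identityʳ p =
  solve 2 (λ u y → u := u :+ y :* con (+ 0)) refl (evalʳ p x) (x ℤ.^ t)
  where open ℤSolver
evalʳ-+ₚ t [] (b ∷ q) x eq with () ← trans eq (ℕₚ.+-suc t (length q))
evalʳ-+ₚ t (a ∷ p) (b ∷ q) x eq = begin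
  evalʳ ((a ℤ.+ b) ∷ (p +ₚ q)) x
    ≡⟨ evalʳ-∷ (a ℤ.+ b) (p +ₚ q) x ⟩
  evalʳ (p +ₚ q) x ℤ.+ x ℤ.^ length (p +ₚ q) ℤ.* (a ℤ.+ b)
    ≡⟨ cong₂ (λ u y → u ℤ.+ x ℤ.^ y ℤ.* (a ℤ.+ b)) (evalʳ-+ₚ t p q x eq′)
         (trans (length-+ₚ p q (subst (length q ≤_) (sym eq′) (ℕₚ.m≤n+m _ t))) eq′) ⟩
  evalʳ p x ℤ.+ x ℤ.^ t ℤ.* evalʳ q x ℤ.+ x ℤ.^ (t + length q) ℤ.* (a ℤ.+ b)
    ≡⟨ cong (λ y → evalʳ p x ℤ.+ x ℤ.^ t ℤ.* evalʳ q x ℤ.+ y ℤ.* (a ℤ.+ b)) (ℤₚ.^-distribˡ-+-* x t (length q)) ⟩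
  evalʳ p x ℤ.+ x ℤ.^ t ℤ.* evalʳ q x ℤ.+ x ℤ.^ t ℤ.* x ℤ.^ length q ℤ.* (a ℤ.+ b)
    ≡⟨ solve 6 (λ u y v w a b → u :+ y :* v :+ y :* w :* (a :+ b) := (u :+ y :* w :* a) :+ y :* (v :+ w :* b))
         refl (evalʳ p x) (x ℤ.^ t) (evalʳ q x) (x ℤ.^ length q) a b ⟩
  (evalʳ p x ℤ.+ x ℤ.^ t ℤ.* x ℤ.^ length q ℤ.* a) ℤ.+ x ℤ.^ t ℤ.* (evalʳ q x ℤ.+ x ℤ.^ length q ℤ.* b)
    ≡⟨ cong₂ (λ u v → u ℤ.+ x ℤ.^ t ℤ.* v)
         (trans (cong (λ y → evalʳ p x ℤ.+ y ℤ.* a) (trans (sym (ℤₚ.^-distribˡ-+-* x t (length q))) (cong (x ℤ.^_) (sym eq′))))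
                (sym (evalʳ-∷ a p x)))
         (sym (evalʳ-∷ b q x)) ⟩
  evalʳ (a ∷ p) x ℤ.+ x ℤ.^ t ℤ.* evalʳ (b ∷ q) x ∎
  where
  open ≡-Reasoning
  open ℤSolver
  eq′ : length p ≡ t + length q
  eq′ = ℕₚ.suc-injective (trans eq (ℕₚ.+-suc t (length q)))

eval-neg : ∀ p x → eval (map -_ p) x ≡ - eval p x
eval-neg []      x = refl
eval-neg (a ∷ p) x rewrite eval-neg p x =
  solve 3 (λ a x u → (:- a) :+ x :* (:- u) := :- (a :+ x :* u)) refl a x (eval p x)
  where open ℤSolver

evalʳ-neg-scale : ∀ c p x → evalʳ (map -_ (scaleₚ c p)) x ≡ - (c ℤ.* evalʳ p x)
evalʳ-neg-scale c p x = begin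
  eval (reverse (map -_ (scaleₚ c p))) x ≡⟨ cong (λ l → eval l x) (Listₚ.reverse-map -_ (scaleₚ c p)) ⟨
  eval (map -_ (reverse (scaleₚ c p))) x ≡⟨ eval-neg (reverse (scaleₚ c p)) x ⟩
  - eval (reverse (scaleₚ c p)) x        ≡⟨ cong (λ l → - eval l x) (Listₚ.reverse-map (c ℤ.*_) p) ⟨
  - eval (scaleₚ c (reverse p)) x        ≡⟨ cong -_ (eval-scaleₚ c (reverse p) x) ⟩
  - (c ℤ.* evalʳ p x)                    ∎
  where open ≡-Reasoning

length-divSteps : ∀ t F rg → length F ≡ t + length rg → length (divSteps t F (+ 1 ∷ rg)) ≡ t
length-reduced : ∀ t c F rg → length F ≡ t + length rg → length (F -ₚ scaleₚ c rg) ≡ t + length rg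
length-reduced t c F rg eq = trans (length-+ₚ F (map -_ (scaleₚ c rg))
  (subst₂ _≤_ (sym (trans (Listₚ.length-map -_ (scaleₚ c rg)) (Listₚ.length-map (c ℤ.*_) rg))) (sym eq) (ℕₚ.m≤n+m _ t))) eq
length-divSteps zero    F       rg eq = refl
length-divSteps (suc t) (c ∷ F) rg eq =
  cong suc (length-divSteps t (F -ₚ scaleₚ c rg) rg (length-reduced t c F rg (ℕₚ.suc-injective eq)))

-- One step subtracts c xᵗ times the divisor, which removes the leading term, and puts c in front of
-- the quotient; at t = 0 what is left is the remainder. The leading 1 of `+ 1 ∷ rg` is dropped by
-- computation.
divSteps-spec : ∀ t F rg → length F ≡ t + length rg → Σ (List ℤ) λ R → length R ≡ length rg ×
  (∀ x → evalʳ F x ≡ evalʳ (+ 1 ∷ rg) x ℤ.* evalʳ (divSteps t F (+ 1 ∷ rg)) x ℤ.+ evalʳ R x)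
divSteps-spec zero    F       rg eq = F , eq , λ x →
  solve 2 (λ u v → v := u :* con (+ 0) :+ v) refl (evalʳ (+ 1 ∷ rg) x) (evalʳ F x)
  where open ℤSolver
divSteps-spec (suc t) (c ∷ F) rg eq with divSteps-spec t (F -ₚ scaleₚ c rg) rg (length-reduced t c F rg (ℕₚ.suc-injective eq))
... | R , lenR , spec = R , lenR , λ x → let
    open ≡-Reasoning
    open ℤSolver
    eq′ : length F ≡ t + length rg
    eq′ = ℕₚ.suc-injective eq
    F′ = F -ₚ scaleₚ c rg
    Q  = divSteps t F′ (+ 1 ∷ rg)
    r  = evalʳ rg x
    q  = evalʳ Q x
    ρ  = evalʳ R x
    xt = x ℤ.^ t
    xr = x ℤ.^ length rg
    lowered : evalʳ F′ x ≡ evalʳ F x ℤ.+ xt ℤ.* (- (c ℤ.* r))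
    lowered = trans (evalʳ-+ₚ t F (map -_ (scaleₚ c rg)) x
        (trans eq′ (cong (_+_ t) (sym (trans (Listₚ.length-map -_ (scaleₚ c rg)) (Listₚ.length-map (c ℤ.*_) rg))))))
      (cong (λ z → evalʳ F x ℤ.+ xt ℤ.* z) (evalʳ-neg-scale c rg x))
    monic : evalʳ (+ 1 ∷ rg) x ≡ r ℤ.+ xr ℤ.* + 1
    monic = evalʳ-∷ (+ 1) rg x
    back : evalʳ F x ≡ (r ℤ.+ xr ℤ.* + 1) ℤ.* q ℤ.+ ρ ℤ.+ xt ℤ.* (c ℤ.* r)
    back = begin
      evalʳ F x ≡⟨ solve 2 (λ f z → f := f :+ (:- z) :+ z) refl (evalʳ F x) (xt ℤ.* (c ℤ.* r)) ⟩
      evalʳ F x ℤ.+ (- (xt ℤ.* (c ℤ.* r))) ℤ.+ xt ℤ.* (c ℤ.* r) ≡⟨ cong (λ z → evalʳ F x ℤ.+ z ℤ.+ xt ℤ.* (c ℤ.* r)) (ℤₚ.neg-distribʳ-* xt (c ℤ.* r)) ⟩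
      evalʳ F x ℤ.+ xt ℤ.* (- (c ℤ.* r)) ℤ.+ xt ℤ.* (c ℤ.* r) ≡⟨ cong (ℤ._+ xt ℤ.* (c ℤ.* r)) (trans (sym lowered) (spec x)) ⟩
      evalʳ (+ 1 ∷ rg) x ℤ.* q ℤ.+ ρ ℤ.+ xt ℤ.* (c ℤ.* r) ≡⟨ cong (λ z → z ℤ.* q ℤ.+ ρ ℤ.+ xt ℤ.* (c ℤ.* r)) monic ⟩
      (r ℤ.+ xr ℤ.* + 1) ℤ.* q ℤ.+ ρ ℤ.+ xt ℤ.* (c ℤ.* r) ∎
  in begin
    evalʳ (c ∷ F) x ≡⟨ evalʳ-∷ c F x ⟩
    evalʳ F x ℤ.+ x ℤ.^ length F ℤ.* c ≡⟨ cong₂ (λ u y → u ℤ.+ y ℤ.* c) back (trans (cong (x ℤ.^_) eq′) (ℤₚ.^-distribˡ-+-* x t (length rg))) ⟩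
    (r ℤ.+ xr ℤ.* + 1) ℤ.* q ℤ.+ ρ ℤ.+ xt ℤ.* (c ℤ.* r) ℤ.+ xt ℤ.* xr ℤ.* c
      ≡⟨ solve 6 (λ r xr q ρ xt c → (r :+ xr :* con (+ 1)) :* q :+ ρ :+ xt :* (c :* r) :+ xt :* xr :* c
                := (r :+ xr :* con (+ 1)) :* (q :+ xt :* c) :+ ρ) refl r xr q ρ xt c ⟩
    (r ℤ.+ xr ℤ.* + 1) ℤ.* (q ℤ.+ xt ℤ.* c) ℤ.+ ρ
      ≡⟨ cong₂ (λ u v → u ℤ.* v ℤ.+ ρ) (sym monic)
           (trans (cong (λ n → q ℤ.+ x ℤ.^ n ℤ.* c) (sym (length-divSteps t F′ rg (length-reduced t c F rg eq′)))) (sym (evalʳ-∷ c Q x))) ⟩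
    evalʳ (+ 1 ∷ rg) x ℤ.* evalʳ (c ∷ Q) x ℤ.+ ρ ∎

-- A literal 1 at the end rules out trailing zeros, so the length is the degree plus one; `divMonic`
-- takes its number of steps from lengths.
Monic : Poly → ℕ → Set
Monic p d = Σ Poly λ u → p ≡ u ∷ʳ + 1 × length u ≡ d

length-∷ʳ : ∀ (u : Poly) c → length (u ∷ʳ c) ≡ suc (length u)
length-∷ʳ u c = trans (Listₚ.length-++ u) (ℕₚ.+-comm (length u) 1)

Monic⇒length : ∀ {p d} → Monic p d → length p ≡ suc d
Monic⇒length (u , refl , refl) = length-∷ʳ u (+ 1)

-- An identity of values, because lists represent polynomials only up to trailing zeros. With k the
-- degree of g, the length says that the remainder has smaller degree.
record Division (f g q : Poly) (k : ℕ) : Set where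
  field
    remainder        : Poly
    length-remainder : length remainder ≡ k
    division         : ∀ x → eval f x ≡ eval g x ℤ.* eval q x ℤ.+ eval remainder x

divMonic-spec : ∀ {f g} t k → Monic f (t + k) → Monic g k → Monic (divMonic f g) t × Division f g (divMonic f g) k
divMonic-spec {f} {g} t k (u , refl , lenu) (v , refl , refl) = subst (λ q → Monic q t × Division f g q k) (sym quotient≡)
    ((reverse Q , Listₚ.unfold-reverse (+ 1) Q , trans (Listₚ.length-reverse Q) lenQ)
    , record { remainder = reverse R
             ; length-remainder = trans (Listₚ.length-reverse R) (trans lenR (Listₚ.length-reverse v))
             ; division = λ x → begin
                 eval (u ∷ʳ + 1) x ≡⟨ cong (λ l → eval l x) (trans (sym (Listₚ.reverse-involutive (u ∷ʳ + 1))) (cong reverse (Listₚ.reverse-++ u (+ 1 ∷ [])))) ⟩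
                 evalʳ (+ 1 ∷ reverse u) x ≡⟨ spec x ⟩
                 evalʳ (+ 1 ∷ reverse v) x ℤ.* evalʳ (+ 1 ∷ Q) x ℤ.+ evalʳ R x
                   ≡⟨ cong (λ l → eval l x ℤ.* evalʳ (+ 1 ∷ Q) x ℤ.+ evalʳ R x) (trans (sym (cong reverse (Listₚ.reverse-++ v (+ 1 ∷ [])))) (Listₚ.reverse-involutive (v ∷ʳ + 1))) ⟩
                 eval (v ∷ʳ + 1) x ℤ.* evalʳ (+ 1 ∷ Q) x ℤ.+ evalʳ R x ∎ })
  where
  open ≡-Reasoning
  F′ Q : List ℤ
  F′ = reverse u -ₚ scaleₚ (+ 1) (reverse v)
  Q  = divSteps t F′ (+ 1 ∷ reverse v)
  lenF : length (reverse u) ≡ t + length (reverse v)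
  lenF = trans (Listₚ.length-reverse u) (trans lenu (cong (_+_ t) (sym (Listₚ.length-reverse v))))
  lenQ : length Q ≡ t
  lenQ = length-divSteps t F′ (reverse v) (length-reduced t (+ 1) (reverse u) (reverse v) lenF)
  main = divSteps-spec (suc t) (+ 1 ∷ reverse u) (reverse v) (cong suc lenF)
  R = proj₁ main
  lenR = proj₁ (proj₂ main)
  spec = proj₂ (proj₂ main)
  steps : suc (length (u ∷ʳ + 1)) ∸ length (v ∷ʳ + 1) ≡ suc t
  steps = begin
    suc (length (u ∷ʳ + 1)) ∸ length (v ∷ʳ + 1) ≡⟨ cong₂ (λ m n → suc m ∸ n) (length-∷ʳ u (+ 1)) (length-∷ʳ v (+ 1)) ⟩
    suc (length u) ∸ length v                   ≡⟨ cong (λ n → suc n ∸ length v) lenu ⟩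
    suc t + length v ∸ length v                 ≡⟨ ℕₚ.m+n∸n≡m (suc t) (length v) ⟩
    suc t                                       ∎
  quotient≡ : divMonic (u ∷ʳ + 1) (v ∷ʳ + 1) ≡ reverse (+ 1 ∷ Q)
  quotient≡ = begin
    divMonic (u ∷ʳ + 1) (v ∷ʳ + 1) ≡⟨ divMonic≡divSteps (u ∷ʳ + 1) (v ∷ʳ + 1) ⟩
    reverse (divSteps (suc (length (u ∷ʳ + 1)) ∸ length (v ∷ʳ + 1)) (reverse (u ∷ʳ + 1)) (reverse (v ∷ʳ + 1)))
      ≡⟨ cong (λ n → reverse (divSteps n (reverse (u ∷ʳ + 1)) (reverse (v ∷ʳ + 1)))) steps ⟩
    reverse (divSteps (suc t) (reverse (u ∷ʳ + 1)) (reverse (v ∷ʳ + 1)))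
      ≡⟨ cong₂ (λ F G → reverse (divSteps (suc t) F G)) (Listₚ.reverse-++ u (+ 1 ∷ [])) (Listₚ.reverse-++ v (+ 1 ∷ [])) ⟩
    reverse (+ 1 ∷ Q) ∎

monic-1 : Monic (+ 1 ∷ []) 0
monic-1 = [] , refl , refl

+ₚ-∷ʳ : ∀ s w → length s ≤ length w → s +ₚ (w ∷ʳ + 1) ≡ (s +ₚ w) ∷ʳ + 1 × length (s +ₚ w) ≡ length w
+ₚ-∷ʳ []      w       _         = refl , refl
+ₚ-∷ʳ (a ∷ s) (b ∷ w) (s≤s s≤w) with +ₚ-∷ʳ s w s≤w
... | eq , len = cong ((a ℤ.+ b) ∷_) eq , cong suc len

[1]*ₚ : ∀ q → 1 ≤ length q → (+ 1 ∷ []) *ₚ q ≡ q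
[1]*ₚ (b ∷ q) _ = cong₂ _∷_ (trans (ℤₚ.+-identityʳ _) (ℤₚ.*-identityˡ b))
  (trans (+ₚ-identityʳ (scaleₚ (+ 1) q)) (trans (Listₚ.map-cong ℤₚ.*-identityˡ q) (Listₚ.map-id q)))

monic-*ₚ : ∀ {p q d e} → Monic p d → Monic q e → Monic (p *ₚ q) (d + e)
monic-*ₚ {q = q} {e = e} (u , refl , refl) mq = go u
  where
  go : ∀ u → Monic ((u ∷ʳ + 1) *ₚ q) (length u + e)
  go []      = subst (λ r → Monic r e) (sym ([1]*ₚ q (subst (1 ≤_) (sym (Monic⇒length mq)) (s≤s z≤n)))) mq
  go (a ∷ u) with go u
  ... | w , eq , len = scaleₚ a q +ₚ (+ 0 ∷ w)
      , trans (cong (λ r → scaleₚ a q +ₚ (+ 0 ∷ r)) eq) (proj₁ top)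
      , trans (proj₂ top) (cong suc len)
    where
    top = +ₚ-∷ʳ (scaleₚ a q) (+ 0 ∷ w) (subst₂ _≤_
      (sym (trans (Listₚ.length-map (a ℤ.*_) q) (Monic⇒length mq))) (cong suc (sym len)) (s≤s (ℕₚ.m≤n+m e (length u))))

-- Growth of polynomials and vanishing

coeffSum : Poly → ℕ
coeffSum []      = 0
coeffSum (a ∷ p) = ∣ a ∣ + coeffSum p

-- The extra factor b puts the length in place of the degree, so the empty list fits the same
-- formula.
*∣eval∣≤ : ∀ b .{{_ : NonZero b}} p → b * ∣ eval p (+ b) ∣ ≤ coeffSum p * b ^ length p
*∣eval∣≤ b []      = ℕₚ.≤-reflexive (ℕₚ.*-zeroʳ b)
*∣eval∣≤ b (a ∷ p) = begin
  b * ∣ a ℤ.+ + b ℤ.* e ∣             ≤⟨ ℕₚ.*-monoʳ-≤ b (ℤₚ.∣i+j∣≤∣i∣+∣j∣ a (+ b ℤ.* e)) ⟩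
  b * (∣ a ∣ + ∣ + b ℤ.* e ∣)         ≡⟨ cong (λ z → b * (∣ a ∣ + z)) (ℤₚ.abs-* (+ b) e) ⟩
  b * (∣ a ∣ + b * ∣ e ∣)             ≤⟨ ℕₚ.*-monoʳ-≤ b (ℕₚ.+-mono-≤ (ℕₚ.m≤m*n ∣ a ∣ (b ^ length p) {{ℕₚ.m^n≢0 b (length p)}}) (*∣eval∣≤ b p)) ⟩
  b * (∣ a ∣ * b ^ length p + coeffSum p * b ^ length p)
    ≡⟨ solve 4 (λ b a c y → b :* (a :* y :+ c :* y) := (a :+ c) :* (b :* y)) refl b ∣ a ∣ (coeffSum p) (b ^ length p) ⟩
  (∣ a ∣ + coeffSum p) * (b * b ^ length p) ∎
  where
  open ℕₚ.≤-Reasoning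
  open +-*-Solver
  e : ℤ
  e = eval p (+ b)

UnboundedZeros : (ℤ → ℤ) → Set
UnboundedZeros f = ∀ N → Σ ℤ λ z → N < ∣ z ∣ × f z ≡ + 0

-- A zero z of a + x p(x) with |z| > |a| divides a, so a = 0.
unboundedZeros⇒0 : ∀ p → UnboundedZeros (eval p) → ∀ x → eval p x ≡ + 0
unboundedZeros⇒0 []      zeros x = refl
unboundedZeros⇒0 (a ∷ p) zeros x = trans (cong₂ (λ c e → c ℤ.+ x ℤ.* e) a≡0 (unboundedZeros⇒0 p zeros′ x))
    (trans (ℤₚ.+-identityˡ _) (ℤₚ.*-zeroʳ x))
  where
  a≡0 : a ≡ + 0
  a≡0 with zeros ∣ a ∣
  ... | z , ∣a∣<∣z∣ , root = ℤₚ.∣i∣≡0⇒i≡0 (abs≡0 ∣ a ∣ ∣a∣<∣z∣ (subst (∣ z ∣ ∣_) ∣ze∣≡∣a∣ (m∣m*n ∣ eval p z ∣)))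
    where
    ∣ze∣≡∣a∣ : ∣ z ∣ * ∣ eval p z ∣ ≡ ∣ a ∣
    ∣ze∣≡∣a∣ = trans (sym (ℤₚ.abs-* z (eval p z))) (trans (cong ∣_∣ (trans
      (solve 2 (λ a w → w := :- a :+ (a :+ w)) refl a (z ℤ.* eval p z)) (trans (cong (λ w → - a ℤ.+ w) root) (ℤₚ.+-identityʳ (- a)))))
      (ℤₚ.∣-i∣≡∣i∣ a))
      where open ℤSolver
    abs≡0 : ∀ n → n < ∣ z ∣ → ∣ z ∣ ∣ n → n ≡ 0
    abs≡0 zero    _   _   = refl
    abs≡0 (suc n) n<z z∣n = contradiction z∣n (>⇒∤ n<z)
  zeros′ : UnboundedZeros (eval p)
  zeros′ N with zeros N
  ... | z , N<∣z∣ , root = z , N<∣z∣ ,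
    [ (λ z≡0 → contradiction (ℕₚ.≤-trans N<∣z∣ (ℕₚ.≤-reflexive (cong ∣_∣ z≡0))) (λ ())) , id ]′
      (ℤₚ.i*j≡0⇒i≡0∨j≡0 z (trans (sym (ℤₚ.+-identityˡ _)) (trans (cong (ℤ._+ z ℤ.* eval p z) (sym a≡0)) root)))

-- For large b the smaller degree forces |r(b)| < |g(b)|, and g(b) divides r(b), so r(b) = 0. Thus r
-- has unboundedly large zeros.
remainder≡0 : ∀ {g k} → Monic g k → ∀ r → length r ≡ k →
              (∀ b → 1 < b → Σ ℤ λ z → eval r (+ b) ≡ eval g (+ b) ℤ.* z) → ∀ x → eval r x ≡ + 0
remainder≡0 {g} (u , refl , refl) r lenr div = unboundedZeros⇒0 r zeros
  where
  zeros : UnboundedZeros (eval r)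
  zeros N = + b , ℕₚ.m≤m+n (suc N) _ , ℤₚ.∣i∣≡0⇒i≡0 small
    where
    open ℕₚ.≤-Reasoning
    b y : ℕ
    -- Beyond N, and beyond the sum of both coefficient sums: this is what |r(b)| < |g(b)| takes
    -- once both are compared with b to the degree of g.
    b = suc N + suc (coeffSum r + coeffSum u)
    y = b ^ length u
    1<b : 1 < b
    1<b = s≤s (ℕₚ.≤-trans (s≤s z≤n) (ℕₚ.m≤n+m _ N))
    G≤ : b * y ≤ b * ∣ eval g (+ b) ∣ + coeffSum u * y
    G≤ = begin
      b * y                                                ≡⟨ cong (b *_) (abs-pow (length u)) ⟨
      b * ∣ (+ b) ℤ.^ length u ∣                             ≡⟨ cong (λ z → b * ∣ z ∣) lead ⟩
      b * ∣ eval g (+ b) ℤ.+ - eval u (+ b) ∣              ≤⟨ ℕₚ.*-monoʳ-≤ b (ℤₚ.∣i+j∣≤∣i∣+∣j∣ (eval g (+ b)) _) ⟩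
      b * (∣ eval g (+ b) ∣ + ∣ - eval u (+ b) ∣)          ≡⟨ cong (λ z → b * (∣ eval g (+ b) ∣ + z)) (ℤₚ.∣-i∣≡∣i∣ (eval u (+ b))) ⟩
      b * (∣ eval g (+ b) ∣ + ∣ eval u (+ b) ∣)            ≡⟨ ℕₚ.*-distribˡ-+ b ∣ eval g (+ b) ∣ ∣ eval u (+ b) ∣ ⟩
      b * ∣ eval g (+ b) ∣ + b * ∣ eval u (+ b) ∣          ≤⟨ ℕₚ.+-monoʳ-≤ _ (*∣eval∣≤ b u) ⟩
      b * ∣ eval g (+ b) ∣ + coeffSum u * y                ∎
      where
      abs-pow : ∀ n → ∣ (+ b) ℤ.^ n ∣ ≡ b ^ n
      abs-pow zero    = refl
      abs-pow (suc n) = trans (ℤₚ.abs-* (+ b) ((+ b) ℤ.^ n)) (cong (b *_) (abs-pow n))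
      lead : (+ b) ℤ.^ length u ≡ eval g (+ b) ℤ.+ - eval u (+ b)
      lead = trans (solve 2 (λ e w → w := e :+ w :* con (+ 1) :+ :- e) refl (eval u (+ b)) ((+ b) ℤ.^ length u))
        (cong (ℤ._+ - eval u (+ b)) (sym (eval-∷ʳ u (+ 1) (+ b))))
        where open ℤSolver
    R≤ : b * ∣ eval r (+ b) ∣ ≤ coeffSum r * y
    R≤ = subst (λ n → b * ∣ eval r (+ b) ∣ ≤ coeffSum r * b ^ n) lenr (*∣eval∣≤ b r)
    impossible : ¬ (∣ eval g (+ b) ∣ ≤ ∣ eval r (+ b) ∣)
    impossible g≤r = ℕₚ.<-irrefl refl (begin-strict
      b * y                                        ≤⟨ G≤ ⟩
      b * ∣ eval g (+ b) ∣ + coeffSum u * y        ≤⟨ ℕₚ.+-monoˡ-≤ _ (ℕₚ.≤-trans (ℕₚ.*-monoʳ-≤ b g≤r) R≤) ⟩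
      coeffSum r * y + coeffSum u * y              ≡⟨ ℕₚ.*-distribʳ-+ y (coeffSum r) (coeffSum u) ⟨
      (coeffSum r + coeffSum u) * y                <⟨ ℕₚ.*-monoˡ-< y {{ℕₚ.m^n≢0 b (length u)}} (s≤s (ℕₚ.≤-trans (ℕₚ.n≤1+n _) (ℕₚ.m≤n+m _ N))) ⟩
      b * y                                        ∎)
    small : ∣ eval r (+ b) ∣ ≡ 0
    small = cases (div b 1<b)
      where
      cases : Σ ℤ (λ z → eval r (+ b) ≡ eval g (+ b) ℤ.* z) → ∣ eval r (+ b) ∣ ≡ 0
      cases (z , eq) = byQuotient ∣ z ∣ (trans (cong ∣_∣ eq) (ℤₚ.abs-* (eval g (+ b)) z))
        where
        byQuotient : ∀ q → ∣ eval r (+ b) ∣ ≡ ∣ eval g (+ b) ∣ * q → ∣ eval r (+ b) ∣ ≡ 0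
        byQuotient zero    eq = trans eq (ℕₚ.*-zeroʳ ∣ eval g (+ b) ∣)
        byQuotient (suc q) eq = contradiction
          (ℕₚ.≤-trans (ℕₚ.m≤m*n ∣ eval g (+ b) ∣ (suc q)) (ℕₚ.≤-reflexive (sym eq))) impossible

-- The recursively defined cyclotomic polynomials

-- The loop of divisorProd is local to Defs; it is recovered by unification, and its extra parameter
-- (the initial list) is irrelevant to conversion since it is never inspected.
mutual
  divisorProdLoop′ : ℕ → Poly → ℕ → List Poly → Poly
  divisorProdLoop′ = _

  divisorProd-∷ : ∀ m p ps → divisorProd m (p ∷ ps) ≡
    (if does (1 ∣? m) then p *ₚ divisorProdLoop′ m p 2 ps else divisorProdLoop′ m p 2 ps)
  divisorProd-∷ m p ps with does (1 ∣? m) | 2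
  ... | b | i = refl

divisorProdFrom : ℕ → ℕ → List Poly → Poly
divisorProdFrom m = divisorProdLoop′ m []

IsMonic : Poly → Set
IsMonic p = Σ ℕ (Monic p)

monic-divisorProdFrom : ∀ m i ps → All IsMonic ps → IsMonic (divisorProdFrom m i ps)
monic-divisorProdFrom m i []       []         = 0 , monic-1
monic-divisorProdFrom m i (p ∷ ps) (mp ∷ mps) with does (i ∣? m)
... | true  = _ , monic-*ₚ (proj₂ mp) (proj₂ (monic-divisorProdFrom m (suc i) ps mps))
... | false = monic-divisorProdFrom m (suc i) ps mps

-- Two quantities are followed through the same loop: the value at a point and `2^degree`. The
-- latter, read off the length of the list, is shown multiplicative on monic polynomials.
record MonicMultiplicative (ν : Poly → ℤ) : Set where
  field
    ν-1 : ν (+ 1 ∷ []) ≡ + 1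
    ν-* : ∀ p q → IsMonic p → IsMonic q → ν (p *ₚ q) ≡ ν p ℤ.* ν q

module _ {ν : Poly → ℤ} (mult : MonicMultiplicative ν) where
  open MonicMultiplicative mult

  -- `cycUpTo` grows at its end while the loop consumes its list from the front; the appended
  -- polynomial is met at index i + length ps.
  ν-divisorProdFrom-∷ʳ : ∀ m i ps q → All IsMonic ps → IsMonic q →
    ν (divisorProdFrom m i (ps ∷ʳ q)) ≡ ν (divisorProdFrom m i ps) ℤ.* (if does ((i + length ps) ∣? m) then ν q else + 1)
  ν-divisorProdFrom-∷ʳ m i [] q [] mq rewrite ℕₚ.+-identityʳ i with does (i ∣? m)
  ... | true  = trans (ν-* q _ mq (0 , monic-1)) (ℤₚ.*-comm (ν q) _)
  ... | false = sym (ℤₚ.*-identityʳ _)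
  ν-divisorProdFrom-∷ʳ m i (p ∷ ps) q (mp ∷ mps) mq rewrite ℕₚ.+-suc i (length ps)
    with does (i ∣? m)
  ... | false = ν-divisorProdFrom-∷ʳ m (suc i) ps q mps mq
  ... | true  = begin
      ν (p *ₚ divisorProdFrom m (suc i) (ps ∷ʳ q))
        ≡⟨ ν-* p _ mp (monic-divisorProdFrom m (suc i) (ps ∷ʳ q) (Allₚ.∷ʳ⁺ mps mq)) ⟩
      ν p ℤ.* ν (divisorProdFrom m (suc i) (ps ∷ʳ q))
        ≡⟨ cong (ν p ℤ.*_) (ν-divisorProdFrom-∷ʳ m (suc i) ps q mps mq) ⟩
      ν p ℤ.* (ν (divisorProdFrom m (suc i) ps) ℤ.* last)
        ≡⟨ ℤₚ.*-assoc (ν p) _ last ⟨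
      ν p ℤ.* ν (divisorProdFrom m (suc i) ps) ℤ.* last
        ≡⟨ cong (ℤ._* last) (ν-* p _ mp (monic-divisorProdFrom m (suc i) ps mps)) ⟨
      ν (p *ₚ divisorProdFrom m (suc i) ps) ℤ.* last ∎
    where
    open ≡-Reasoning
    last : ℤ
    last = if does ((suc i + length ps) ∣? m) then ν q else + 1

length-cycUpTo : ∀ n → length (cycUpTo n) ≡ n
length-cycUpTo zero    = refl
length-cycUpTo (suc n) = trans (Listₚ.length-++ (cycUpTo n)) (trans (ℕₚ.+-comm _ 1) (cong suc (length-cycUpTo n)))

cyclotomic-suc : ∀ n → cyclotomic (suc n) ≡ divMonic (xPowMinus1 (suc n)) (divisorProd (suc n) (cycUpTo n))
cyclotomic-suc n = Listₚ.foldl-∷ʳ (λ _ p → p) [] _ (cycUpTo n)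

cycUpTo-suc : ∀ n → cycUpTo (suc n) ≡ cycUpTo n ∷ʳ cyclotomic (suc n)
cycUpTo-suc n = cong (cycUpTo n ∷ʳ_) (sym (cyclotomic-suc n))

All-cycUpTo : ∀ {P : Poly → Set} n → (∀ d → 1 ≤ d → d ≤ n → P (cyclotomic d)) → All P (cycUpTo n)
All-cycUpTo zero    h = []
All-cycUpTo {P} (suc n) h = subst (All P) (sym (cycUpTo-suc n))
  (Allₚ.∷ʳ⁺ (All-cycUpTo n (λ d 1≤d d≤n → h d 1≤d (ℕₚ.m≤n⇒m≤1+n d≤n))) (h (suc n) (s≤s z≤n) ℕₚ.≤-refl))

+if : ∀ {A : Set} (d : Dec A) {z v} → z ≡ + v → (if does d then z else + 1) ≡ + [ d ] v else-1
+if (yes _) eq = eq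
+if (no _)  eq = refl

ν-divisorProd : ∀ {ν} → MonicMultiplicative ν → ∀ m k (f : ℕ → ℕ) →
  (∀ d → 1 ≤ d → d ≤ k → IsMonic (cyclotomic d)) → (∀ d → 1 ≤ d → d ≤ k → ν (cyclotomic d) ≡ + f d) →
  ν (divisorProd m (cycUpTo k)) ≡ + ∏ k (onDivisors m f)
ν-divisorProd mult m zero    f mon val = MonicMultiplicative.ν-1 mult
ν-divisorProd {ν} mult m (suc k) f mon val = begin
  ν (divisorProd m (cycUpTo (suc k)))
    ≡⟨ cong (λ ps → ν (divisorProd m ps)) (cycUpTo-suc k) ⟩
  ν (divisorProdFrom m 1 (cycUpTo k ∷ʳ cyclotomic (suc k)))
    ≡⟨ ν-divisorProdFrom-∷ʳ mult m 1 (cycUpTo k) _ (All-cycUpTo k (λ d 1≤d d≤k → mon d 1≤d (ℕₚ.m≤n⇒m≤1+n d≤k))) (mon (suc k) (s≤s z≤n) ℕₚ.≤-refl) ⟩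
  ν (divisorProdFrom m 1 (cycUpTo k)) ℤ.* (if does ((1 + length (cycUpTo k)) ∣? m) then ν (cyclotomic (suc k)) else + 1)
    ≡⟨ cong₂ ℤ._*_ (ν-divisorProd mult m k f (λ d 1≤d d≤k → mon d 1≤d (ℕₚ.m≤n⇒m≤1+n d≤k)) (λ d 1≤d d≤k → val d 1≤d (ℕₚ.m≤n⇒m≤1+n d≤k)))
         (trans (cong (λ l → if does ((1 + l) ∣? m) then ν (cyclotomic (suc k)) else + 1) (length-cycUpTo k))
                (+if (suc k ∣? m) (val (suc k) (s≤s z≤n) ℕₚ.≤-refl))) ⟩
  + ∏ k (onDivisors m f) ℤ.* + onDivisors m f (suc k)
    ≡⟨ ℤₚ.pos-* (∏ k (onDivisors m f)) _ ⟨
  + ∏ (suc k) (onDivisors m f) ∎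
  where open ≡-Reasoning

eval-multiplicative : ∀ x → MonicMultiplicative (λ p → eval p x)
eval-multiplicative x = record
  { ν-1 = cong (λ z → + 1 ℤ.+ z) (ℤₚ.*-zeroʳ x)
  ; ν-* = λ p q _ _ → eval-*ₚ p q x }

2^degree : Poly → ℤ
2^degree p = + 2 ^ pred (length p)

2^degree-monic : ∀ {p d} → Monic p d → 2^degree p ≡ + 2 ^ d
2^degree-monic mp = cong (λ l → + 2 ^ pred l) (Monic⇒length mp)

2^degree-multiplicative : MonicMultiplicative 2^degree
2^degree-multiplicative = record
  { ν-1 = refl
  ; ν-* = λ p q (d , mp) (e , mq) → begin
      2^degree (p *ₚ q)              ≡⟨ 2^degree-monic (monic-*ₚ mp mq) ⟩
      + 2 ^ (d + e)                  ≡⟨ cong +_ (ℕₚ.^-distribˡ-+-* 2 d e) ⟩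
      + (2 ^ d * 2 ^ e)              ≡⟨ ℤₚ.pos-* (2 ^ d) (2 ^ e) ⟩
      + 2 ^ d ℤ.* + 2 ^ e            ≡⟨ cong₂ ℤ._*_ (2^degree-monic mp) (2^degree-monic mq) ⟨
      2^degree p ℤ.* 2^degree q      ∎ }
  where open ≡-Reasoning

-- Reaches the loop local to `xPowMinus1`: its value is the tail of the whole list, so the induction
-- hypothesis can be transported to it.
xPowMinus1-tail : List ℤ → List ℤ
xPowMinus1-tail []      = []
xPowMinus1-tail (_ ∷ p) = p

xPowMinus1≡ : ∀ k → xPowMinus1 (suc k) ≡ - + 1 ∷ (replicate k (+ 0) ∷ʳ + 1)
xPowMinus1≡ zero    = refl
xPowMinus1≡ (suc k) = cong (λ p → - + 1 ∷ + 0 ∷ xPowMinus1-tail p) (xPowMinus1≡ k)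

monic-xPowMinus1 : ∀ k → Monic (xPowMinus1 (suc k)) (suc k)
monic-xPowMinus1 k = - + 1 ∷ replicate k (+ 0) , xPowMinus1≡ k , cong suc (Listₚ.length-replicate k)

eval-zeros : ∀ k x → eval (replicate k (+ 0)) x ≡ + 0
eval-zeros zero    x = refl
eval-zeros (suc k) x rewrite eval-zeros k x = trans (ℤₚ.+-identityˡ _) (ℤₚ.*-zeroʳ x)

pos-^ : ∀ b n → (+ b) ℤ.^ n ≡ + (b ^ n)
pos-^ b zero    = refl
pos-^ b (suc n) = trans (cong (+ b ℤ.*_) (pos-^ b n)) (sym (ℤₚ.pos-* b (b ^ n)))

eval-xPowMinus1 : ∀ b .{{_ : NonZero b}} k → eval (xPowMinus1 (suc k)) (+ b) ≡ + powMinus1 b (suc k)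
eval-xPowMinus1 b k = begin
  eval (xPowMinus1 (suc k)) (+ b)                            ≡⟨ cong (λ p → eval p (+ b)) (xPowMinus1≡ k) ⟩
  - + 1 ℤ.+ + b ℤ.* eval (replicate k (+ 0) ∷ʳ + 1) (+ b)    ≡⟨ cong (λ z → - + 1 ℤ.+ + b ℤ.* z) inner ⟩
  - + 1 ℤ.+ + b ℤ.* + (b ^ k)                                ≡⟨ cong (λ z → - + 1 ℤ.+ z) (sym (ℤₚ.pos-* b (b ^ k))) ⟩
  - + 1 ℤ.+ + (b ^ suc k)                                    ≡⟨ cong (λ z → - + 1 ℤ.+ + z) (suc-powMinus1 b (suc k)) ⟨
  - + 1 ℤ.+ + suc (powMinus1 b (suc k))                      ≡⟨⟩
  + powMinus1 b (suc k)                                      ∎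
  where
  open ≡-Reasoning
  inner : eval (replicate k (+ 0) ∷ʳ + 1) (+ b) ≡ + (b ^ k)
  inner = trans (eval-∷ʳ (replicate k (+ 0)) (+ 1) (+ b))
    (trans (cong₂ (λ u n → u ℤ.+ (+ b) ℤ.^ n ℤ.* + 1) (eval-zeros k (+ b)) (Listₚ.length-replicate k))
      (trans (ℤₚ.+-identityˡ _) (trans (ℤₚ.*-identityʳ _) (pos-^ b k))))

record CyclotomicAt (n : ℕ) : Set where
  field
    monic : Monic (cyclotomic n) (totient n)
    value : ∀ b → 1 < b → eval (cyclotomic n) (+ b) ≡ + cyc b n

open CyclotomicAt

-- Degree and values are proved together: monic smaller polynomials make the division meaningful,
-- and their values identify its quotient.
cyclotomicAt : ∀ n → 1 ≤ n → CyclotomicAt n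
cyclotomicAt = <-rec (λ n → 1 ≤ n → CyclotomicAt n) step
  where
  open ≡-Reasoning
  step : ∀ n → (∀ {d} → d < n → 1 ≤ d → CyclotomicAt d) → 1 ≤ n → CyclotomicAt n
  step (suc k) ih _ = record
      { monic = subst (λ p → Monic p (totient (suc k))) (sym (cyclotomic-suc k)) (proj₁ spec)
      ; value = λ b 1<b → trans (cong (λ p → eval p (+ b)) (cyclotomic-suc k)) (quotient-value b 1<b) }
    where
    f g q : Poly
    f = xPowMinus1 (suc k)
    g = divisorProd (suc k) (cycUpTo k)
    q = divMonic f g
    below : ∀ d → 1 ≤ d → d ≤ k → CyclotomicAt d
    below d 1≤d d≤k = ih (s≤s d≤k) 1≤d
    mon : ∀ d → 1 ≤ d → d ≤ k → IsMonic (cyclotomic d)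
    mon d 1≤d d≤k = totient d , monic (below d 1≤d d≤k)
    g-monic : IsMonic g
    g-monic = monic-divisorProdFrom (suc k) 1 (cycUpTo k) (All-cycUpTo k mon)
    e : ℕ
    e = proj₁ g-monic
    -- Gauss' identity read through `2^degree`; it makes φ(n) the degree of the quotient.
    degrees : totient (suc k) + e ≡ suc k
    degrees = 2^-injective (begin
      2 ^ (totient (suc k) + e)        ≡⟨ cong (2 ^_) (ℕₚ.+-comm (totient (suc k)) e) ⟩
      2 ^ (e + totient (suc k))        ≡⟨ ℕₚ.^-distribˡ-+-* 2 e (totient (suc k)) ⟩
      2 ^ e * 2 ^ totient (suc k)      ≡⟨ cong (_* 2 ^ totient (suc k)) (ℤₚ.+-injective (trans (sym (2^degree-monic (proj₂ g-monic)))
             (ν-divisorProd 2^degree-multiplicative (suc k) k (λ d → 2 ^ totient d) mon (λ d 1≤d d≤k → 2^degree-monic (monic (below d 1≤d d≤k)))))) ⟩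
      ∏ k (onDivisors (suc k) (λ d → 2 ^ totient d)) * 2 ^ totient (suc k) ≡⟨ ∏∣-last k (λ d → 2 ^ totient d) ⟨
      ∏∣ (suc k) (λ d → 2 ^ totient d) ≡⟨ ∏∣-2^totient (suc k) (s≤s z≤n) ⟩
      2 ^ suc k                        ∎)
    spec : Monic q (totient (suc k)) × Division f g q e
    spec = divMonic-spec (totient (suc k)) e (subst (Monic f) (sym degrees) (monic-xPowMinus1 k)) (proj₂ g-monic)
    open Division (proj₂ spec)
    G : ℕ → ℕ
    G b = ∏ k (onDivisors (suc k) (cyc b))
    g-value : ∀ b → 1 < b → eval g (+ b) ≡ + G b
    g-value b 1<b = ν-divisorProd (eval-multiplicative (+ b)) (suc k) k (cyc b) mon (λ d 1≤d d≤k → value (below d 1≤d d≤k) b 1<b)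
    f-value : ∀ b → 1 < b → eval f (+ b) ≡ eval g (+ b) ℤ.* + cyc b (suc k)
    f-value b 1<b = begin
      eval f (+ b)                     ≡⟨ eval-xPowMinus1 b {{>-nonZero (ℕₚ.<⇒≤ 1<b)}} k ⟩
      + powMinus1 b (suc k)            ≡⟨ cong +_ (properDivisors*cyc 1<b k) ⟨
      + (G b * cyc b (suc k))          ≡⟨ ℤₚ.pos-* (G b) _ ⟩
      + G b ℤ.* + cyc b (suc k)        ≡⟨ cong (ℤ._* + cyc b (suc k)) (g-value b 1<b) ⟨
      eval g (+ b) ℤ.* + cyc b (suc k) ∎
    rem≡0 : ∀ x → eval remainder x ≡ + 0
    -- As f(b) is g(b) times the expected quotient value, the remainder is g(b) times the expected
    -- minus the actual value.
    rem≡0 = remainder≡0 (proj₂ g-monic) remainder length-remainder (λ b 1<b → + cyc b (suc k) ℤ.- eval q (+ b) , (begin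
      eval remainder (+ b) ≡⟨ solve 2 (λ r w → r := (w :+ r) :- w) refl (eval remainder (+ b)) (eval g (+ b) ℤ.* eval q (+ b)) ⟩
      (eval g (+ b) ℤ.* eval q (+ b) ℤ.+ eval remainder (+ b)) ℤ.- eval g (+ b) ℤ.* eval q (+ b)
        ≡⟨ cong (ℤ._- eval g (+ b) ℤ.* eval q (+ b)) (trans (sym (division (+ b))) (f-value b 1<b)) ⟩
      eval g (+ b) ℤ.* + cyc b (suc k) ℤ.- eval g (+ b) ℤ.* eval q (+ b)
        ≡⟨ solve 3 (λ g c q → g :* c :- g :* q := g :* (c :- q)) refl (eval g (+ b)) (+ cyc b (suc k)) (eval q (+ b)) ⟩
      eval g (+ b) ℤ.* (+ cyc b (suc k) ℤ.- eval q (+ b)) ∎))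
      where open ℤSolver
    quotient-value : ∀ b → 1 < b → eval q (+ b) ≡ + cyc b (suc k)
    quotient-value b 1<b = ℤₚ.*-cancelˡ-≡ (+ G b) _ _ {{∏-nonZero k _ (onDivisors-nonZero (suc k) (cyc-nonZero 1<b))}} (begin
      + G b ℤ.* eval q (+ b)                               ≡⟨ cong (ℤ._* eval q (+ b)) (g-value b 1<b) ⟨
      eval g (+ b) ℤ.* eval q (+ b)                        ≡⟨ ℤₚ.+-identityʳ _ ⟨
      eval g (+ b) ℤ.* eval q (+ b) ℤ.+ + 0                ≡⟨ cong (λ z → eval g (+ b) ℤ.* eval q (+ b) ℤ.+ z) (rem≡0 (+ b)) ⟨
      eval g (+ b) ℤ.* eval q (+ b) ℤ.+ eval remainder (+ b) ≡⟨ division (+ b) ⟨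
      eval f (+ b)                                         ≡⟨ f-value b 1<b ⟩
      eval g (+ b) ℤ.* + cyc b (suc k)                     ≡⟨ cong (ℤ._* + cyc b (suc k)) (g-value b 1<b) ⟩
      + G b ℤ.* + cyc b (suc k)                            ∎)

-- Binary forms

PolyFun : (ℤ → ℤ) → Set
PolyFun f = Σ Poly λ p → ∀ x → f x ≡ eval p x

polyFun-const : ∀ c → PolyFun (λ _ → c)
polyFun-const c = c ∷ [] , λ x → sym (trans (cong (λ z → c ℤ.+ z) (ℤₚ.*-zeroʳ x)) (ℤₚ.+-identityʳ c))

polyFun-id : PolyFun (λ x → x)
polyFun-id = + 0 ∷ + 1 ∷ [] , λ x → solve 1 (λ x → x := con (+ 0) :+ x :* (con (+ 1) :+ x :* con (+ 0))) refl x
  where open ℤSolver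

polyFun-+ : ∀ {f g} → PolyFun f → PolyFun g → PolyFun (λ x → f x ℤ.+ g x)
polyFun-+ (p , f≡) (q , g≡) = p +ₚ q , λ x → trans (cong₂ ℤ._+_ (f≡ x) (g≡ x)) (sym (eval-+ₚ p q x))

polyFun-* : ∀ {f g} → PolyFun f → PolyFun g → PolyFun (λ x → f x ℤ.* g x)
polyFun-* (p , f≡) (q , g≡) = p *ₚ q , λ x → trans (cong₂ ℤ._*_ (f≡ x) (g≡ x)) (sym (eval-*ₚ p q x))

polyFun-^ : ∀ {f} → PolyFun f → ∀ n → PolyFun (λ x → f x ℤ.^ n)
polyFun-^ pf zero    = polyFun-const (+ 1)
polyFun-^ pf (suc n) = polyFun-* pf (polyFun-^ pf n)

polyFun-∘ : ∀ {f g} → PolyFun f → PolyFun g → PolyFun (λ x → f (g x))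
polyFun-∘ {f} {g} (p , f≡) pg = proj₁ (go p) , λ x → trans (f≡ (g x)) (proj₂ (go p) x)
  where
  go : ∀ p → PolyFun (λ x → eval p (g x))
  go []      = polyFun-const (+ 0)
  go (a ∷ p) = polyFun-+ (polyFun-const a) (polyFun-* pg (go p))

polyFun-unique : ∀ {f g} → PolyFun f → PolyFun g → (∀ N → Σ ℤ λ z → N < ∣ z ∣ × f z ≡ g z) → ∀ x → f x ≡ g x
polyFun-unique {f} {g} (p , f≡) (q , g≡) agree x =
    ℤₚ.i-j≡0⇒i≡j (f x) (g x) (trans (difference x) (unboundedZeros⇒0 (p -ₚ q) zeros x))
  where
  difference : ∀ x → f x ℤ.- g x ≡ eval (p -ₚ q) x
  difference x = trans (cong₂ ℤ._-_ (f≡ x) (g≡ x))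
    (sym (trans (eval-+ₚ p (map -_ q) x) (cong (λ z → eval p x ℤ.+ z) (eval-neg q x))))
  zeros : UnboundedZeros (eval (p -ₚ q))
  zeros N with agree N
  ... | z , N<z , eq = z , N<z , trans (sym (difference z)) (ℤₚ.i≡j⇒i-j≡0 eq)

-- Homogeneity and polynomiality in each variable separately suffice for `form-unique`, and they
-- pass to products, to (xᵖ, yᵖ) and to -y without any handling of coefficients in two variables.
record Form (F : ℤ → ℤ → ℤ) (d : ℕ) : Set where
  field
    homogeneous : ∀ k x y → F (k ℤ.* x) (k ℤ.* y) ≡ k ℤ.^ d ℤ.* F x y
    polyˡ       : ∀ y → PolyFun (λ x → F x y)
    polyʳ       : ∀ x → PolyFun (F x)

open Form

-- For fixed y ≠ 0, F(y t, y) = y^d F(t, 1) gives agreement at unboundedly large first arguments,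
-- hence at all x. For fixed x, agreement at all y ≠ 0 then extends to y = 0.
form-unique : ∀ {F G d} → Form F d → Form G d → (∀ t → 1 < t → F (+ t) (+ 1) ≡ G (+ t) (+ 1)) → ∀ x y → F x y ≡ G x y
form-unique {F} {G} {d} formF formG eq x = polyFun-unique (polyʳ formF x) (polyʳ formG x)
    (λ N → + suc N , ℕₚ.≤-refl , off-axis (+ suc N) x)
  where
  open ≡-Reasoning
  off-axis : ∀ y .{{_ : ℤ.NonZero y}} x → F x y ≡ G x y
  off-axis y = polyFun-unique (polyˡ formF y) (polyˡ formG y) λ N → y ℤ.* + (2 + N) ,
    subst (N <_) (sym (ℤₚ.abs-* y (+ (2 + N)))) (ℕₚ.≤-trans (ℕₚ.n≤1+n (suc N)) (ℕₚ.m≤n*m (2 + N) ∣ y ∣)) ,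
    (begin
      F (y ℤ.* + (2 + N)) y             ≡⟨ cong (F (y ℤ.* + (2 + N))) (ℤₚ.*-identityʳ y) ⟨
      F (y ℤ.* + (2 + N)) (y ℤ.* + 1)   ≡⟨ homogeneous formF y (+ (2 + N)) (+ 1) ⟩
      y ℤ.^ d ℤ.* F (+ (2 + N)) (+ 1)   ≡⟨ cong (y ℤ.^ d ℤ.*_) (eq (2 + N) (s≤s (s≤s z≤n))) ⟩
      y ℤ.^ d ℤ.* G (+ (2 + N)) (+ 1)   ≡⟨ homogeneous formG y (+ (2 + N)) (+ 1) ⟨
      G (y ℤ.* + (2 + N)) (y ℤ.* + 1)   ≡⟨ cong (G (y ℤ.* + (2 + N))) (ℤₚ.*-identityʳ y) ⟩
      G (y ℤ.* + (2 + N)) y             ∎)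

ℤ^-distribʳ-* : ∀ x y n → (x ℤ.* y) ℤ.^ n ≡ x ℤ.^ n ℤ.* y ℤ.^ n
ℤ^-distribʳ-* x y zero    = refl
ℤ^-distribʳ-* x y (suc n) rewrite ℤ^-distribʳ-* x y n =
  solve 4 (λ x y u v → x :* y :* (u :* v) := x :* u :* (y :* v)) refl x y (x ℤ.^ n) (y ℤ.^ n)
  where open ℤSolver

form-* : ∀ {F G d e} → Form F d → Form G e → Form (λ x y → F x y ℤ.* G x y) (d + e)
form-* {F} {G} {d} {e} formF formG = record
  { homogeneous = λ k x y → trans (cong₂ ℤ._*_ (homogeneous formF k x y) (homogeneous formG k x y))
      (trans (solve 4 (λ a b c d → a :* b :* (c :* d) := a :* c :* (b :* d)) refl (k ℤ.^ d) (F x y) (k ℤ.^ e) (G x y))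
        (cong (ℤ._* (F x y ℤ.* G x y)) (sym (ℤₚ.^-distribˡ-+-* k d e))))
  ; polyˡ = λ y → polyFun-* (polyˡ formF y) (polyˡ formG y)
  ; polyʳ = λ x → polyFun-* (polyʳ formF x) (polyʳ formG x) }
  where open ℤSolver

form-pow : ∀ {F d} p → Form F d → Form (λ x y → F (x ℤ.^ p) (y ℤ.^ p)) (p * d)
form-pow {F} {d} p formF = record
  { homogeneous = λ k x y → trans (cong₂ F (ℤ^-distribʳ-* k x p) (ℤ^-distribʳ-* k y p))
      (trans (homogeneous formF (k ℤ.^ p) (x ℤ.^ p) (y ℤ.^ p)) (cong (ℤ._* F (x ℤ.^ p) (y ℤ.^ p)) (ℤₚ.^-*-assoc k p d)))
  ; polyˡ = λ y → polyFun-∘ (polyˡ formF (y ℤ.^ p)) (polyFun-^ polyFun-id p)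
  ; polyʳ = λ x → polyFun-∘ (polyʳ formF (x ℤ.^ p)) (polyFun-^ polyFun-id p) }

form-negʳ : ∀ {F d} → Form F d → Form (λ x y → F x (- y)) d
form-negʳ {F} formF = record
  { homogeneous = λ k x y → trans (cong (F (k ℤ.* x)) (ℤₚ.neg-distribʳ-* k y)) (homogeneous formF k x (- y))
  ; polyˡ = λ y → polyˡ formF (- y)
  ; polyʳ = λ x → polyFun-∘ (polyʳ formF x) (+ 0 ∷ - + 1 ∷ [] ,
      solve 1 (λ y → :- y := con (+ 0) :+ y :* (con (- + 1) :+ y :* con (+ 0))) refl) }
  where open ℤSolver

-- The loop inside `Φ` with a free exponent e for the totient; `ΦLoop` recovers the original by
-- unification.
formFrom : ℕ → ℤ → ℤ → ℕ → Poly → ℤ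
formFrom e x y i []       = + 0
formFrom e x y i (a ∷ as) = a ℤ.* x ℤ.^ i ℤ.* y ℤ.^ (e ∸ i) ℤ.+ formFrom e x y (suc i) as

mutual
  ΦLoop : ℕ → ℤ → ℤ → ℕ → Poly → ℤ
  ΦLoop = _

  Φ≡ΦLoop : ∀ n x y → Φ n x y ≡ ΦLoop n x y 0 (cyclotomic n)
  Φ≡ΦLoop n x y with cyclotomic n | 0
  ... | f | i = refl

Φ≡formFrom : ∀ n x y → Φ n x y ≡ formFrom (totient n) x y 0 (cyclotomic n)
Φ≡formFrom n x y = trans (Φ≡ΦLoop n x y) (go 0 (cyclotomic n))
  where
  go : ∀ i as → ΦLoop n x y i as ≡ formFrom (totient n) x y i as
  go i []       = refl
  go i (a ∷ as) = cong (λ z → a ℤ.* x ℤ.^ i ℤ.* y ℤ.^ (totient n ∸ i) ℤ.+ z) (go (suc i) as)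

formFrom-1 : ∀ e t i as → formFrom e t (+ 1) i as ≡ t ℤ.^ i ℤ.* eval as t
formFrom-1 e t i []       = sym (ℤₚ.*-zeroʳ (t ℤ.^ i))
formFrom-1 e t i (a ∷ as) rewrite formFrom-1 e t (suc i) as | ℤₚ.^-zeroˡ (e ∸ i) =
  solve 4 (λ a y t v → a :* y :* con (+ 1) :+ t :* y :* v := y :* (a :+ t :* v)) refl a (t ℤ.^ i) t (eval as t)
  where open ℤSolver

-- The bound on the length keeps i ≤ e at every coefficient met, so the truncated e ∸ i is the true
-- complementary exponent.
formFrom-homogeneous : ∀ e k x y i as → length as + i ≤ suc e →
  formFrom e (k ℤ.* x) (k ℤ.* y) i as ≡ k ℤ.^ e ℤ.* formFrom e x y i as
formFrom-homogeneous e k x y i []       _ = sym (ℤₚ.*-zeroʳ (k ℤ.^ e))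
formFrom-homogeneous e k x y i (a ∷ as) (s≤s len)
  rewrite formFrom-homogeneous e k x y (suc i) as (subst (_≤ suc e) (sym (ℕₚ.+-suc (length as) i)) (s≤s len))
        | ℤ^-distribʳ-* k x i | ℤ^-distribʳ-* k y (e ∸ i) = begin
  a ℤ.* (k ℤ.^ i ℤ.* x ℤ.^ i) ℤ.* (k ℤ.^ (e ∸ i) ℤ.* y ℤ.^ (e ∸ i)) ℤ.+ k ℤ.^ e ℤ.* rest
    ≡⟨ solve 7 (λ a u x v y w r → a :* (u :* x) :* (v :* y) :+ w :* r := u :* v :* (a :* x :* y) :+ w :* r)
         refl a (k ℤ.^ i) (x ℤ.^ i) (k ℤ.^ (e ∸ i)) (y ℤ.^ (e ∸ i)) (k ℤ.^ e) rest ⟩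
  k ℤ.^ i ℤ.* k ℤ.^ (e ∸ i) ℤ.* (a ℤ.* x ℤ.^ i ℤ.* y ℤ.^ (e ∸ i)) ℤ.+ k ℤ.^ e ℤ.* rest
    ≡⟨ cong (λ z → z ℤ.* (a ℤ.* x ℤ.^ i ℤ.* y ℤ.^ (e ∸ i)) ℤ.+ k ℤ.^ e ℤ.* rest)
         (trans (sym (ℤₚ.^-distribˡ-+-* k i (e ∸ i))) (cong (k ℤ.^_) (ℕₚ.m+[n∸m]≡n (ℕₚ.≤-trans (ℕₚ.m≤n+m i (length as)) len)))) ⟩
  k ℤ.^ e ℤ.* (a ℤ.* x ℤ.^ i ℤ.* y ℤ.^ (e ∸ i)) ℤ.+ k ℤ.^ e ℤ.* rest
    ≡⟨ ℤₚ.*-distribˡ-+ (k ℤ.^ e) _ rest ⟨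
  k ℤ.^ e ℤ.* (a ℤ.* x ℤ.^ i ℤ.* y ℤ.^ (e ∸ i) ℤ.+ rest) ∎
  where
  open ≡-Reasoning
  open ℤSolver
  rest : ℤ
  rest = formFrom e x y (suc i) as

formFrom-polyˡ : ∀ e y i as → PolyFun (λ x → formFrom e x y i as)
formFrom-polyˡ e y i []       = polyFun-const (+ 0)
formFrom-polyˡ e y i (a ∷ as) = polyFun-+
  (polyFun-* (polyFun-* (polyFun-const a) (polyFun-^ polyFun-id i)) (polyFun-const (y ℤ.^ (e ∸ i)))) (formFrom-polyˡ e y (suc i) as)

formFrom-polyʳ : ∀ e x i as → PolyFun (λ y → formFrom e x y i as)
formFrom-polyʳ e x i []       = polyFun-const (+ 0)
formFrom-polyʳ e x i (a ∷ as) = polyFun-+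
  (polyFun-* (polyFun-const (a ℤ.* x ℤ.^ i)) (polyFun-^ polyFun-id (e ∸ i))) (formFrom-polyʳ e x (suc i) as)

polyFun-cong : ∀ {f g} → (∀ x → f x ≡ g x) → PolyFun g → PolyFun f
polyFun-cong eq (p , g≡) = p , λ x → trans (eq x) (g≡ x)

form-cong : ∀ {F G d} → (∀ x y → F x y ≡ G x y) → Form G d → Form F d
form-cong {d = d} eq formG = record
  { homogeneous = λ k x y → trans (eq _ _) (trans (homogeneous formG k x y) (cong (k ℤ.^ d ℤ.*_) (sym (eq x y))))
  ; polyˡ = λ y → polyFun-cong (λ x → eq x y) (polyˡ formG y)
  ; polyʳ = λ x → polyFun-cong (eq x) (polyʳ formG x) }

Φ-form : ∀ n → 1 ≤ n → Form (Φ n) (totient n)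
Φ-form n 1≤n = form-cong (Φ≡formFrom n) record
  { homogeneous = λ k x y → formFrom-homogeneous (totient n) k x y 0 (cyclotomic n)
      (ℕₚ.≤-reflexive (trans (ℕₚ.+-identityʳ _) (Monic⇒length (CyclotomicAt.monic (cyclotomicAt n 1≤n)))))
  ; polyˡ = λ y → formFrom-polyˡ (totient n) y 0 (cyclotomic n)
  ; polyʳ = λ x → formFrom-polyʳ (totient n) x 0 (cyclotomic n) }

Φ-value : ∀ n → 1 ≤ n → ∀ t → 1 < t → Φ n (+ t) (+ 1) ≡ + cyc t n
Φ-value n 1≤n t 1<t = trans (Φ≡formFrom n (+ t) (+ 1)) (trans (formFrom-1 (totient n) (+ t) 0 (cyclotomic n))
  (trans (ℤₚ.*-identityˡ _) (CyclotomicAt.value (cyclotomicAt n 1≤n) t 1<t)))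

Φ-value-^ : ∀ n p → 1 ≤ n → 1 ≤ p → ∀ t → 1 < t → Φ n ((+ t) ℤ.^ p) ((+ 1) ℤ.^ p) ≡ + cyc (t ^ p) n
Φ-value-^ n p 1≤n 1≤p t 1<t = trans (cong₂ (Φ n) (pos-^ t p) (ℤₚ.^-zeroˡ p)) (Φ-value n 1≤n (t ^ p) (1<^ 1<t 1≤p))

module _ {p m : ℕ} (pr : Prime p) (1≤m : 1 ≤ m) where

  private
    1≤p : 1 ≤ p
    1≤p = ℕₚ.<⇒≤ (prime≥2 pr)

    1≤pm : 1 ≤ p * m
    1≤pm = ℕₚ.*-mono-≤ 1≤p 1≤m

  -- Both sides are forms of degree p φ(m), so `form-unique` reduces the identity to `cyc-prime-*`
  -- at the points (t, 1). The case p ∤ m goes the same way.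
  Φ-prime-∣ : p ∣ m → ∀ x y → Φ (p * m) x y ≡ Φ m (x ℤ.^ p) (y ℤ.^ p)
  Φ-prime-∣ p∣m = form-unique (subst (Form (Φ (p * m))) (totient-prime-∣ pr p∣m) (Φ-form (p * m) 1≤pm))
    (form-pow p (Φ-form m 1≤m)) λ t 1<t → begin
      Φ (p * m) (+ t) (+ 1)                             ≡⟨ Φ-value (p * m) 1≤pm t 1<t ⟩
      + cyc t (p * m)                                   ≡⟨ cong +_ (ℕₚ.*-identityʳ _) ⟨
      + (cyc t (p * m) * 1)                             ≡⟨ cong (λ b → + (cyc t (p * m) * (if b then 1 else cyc t m))) (dec-true (p ∣? m) p∣m) ⟨
      + (cyc t (p * m) * unless (p ∣? m) (cyc t m))     ≡⟨ cong +_ (cyc-prime-* 1<t pr m 1≤m) ⟩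
      + cyc (t ^ p) m                                   ≡⟨ Φ-value-^ m p 1≤m 1≤p t 1<t ⟨
      Φ m ((+ t) ℤ.^ p) ((+ 1) ℤ.^ p)                   ∎
    where open ≡-Reasoning

  Φ-prime-∤ : p ∤ m → ∀ x y → Φ (p * m) x y ℤ.* Φ m x y ≡ Φ m (x ℤ.^ p) (y ℤ.^ p)
  Φ-prime-∤ p∤m = form-unique
    (subst (Form (λ x y → Φ (p * m) x y ℤ.* Φ m x y)) (totient-prime-∤ pr p∤m) (form-* (Φ-form (p * m) 1≤pm) (Φ-form m 1≤m)))
    (form-pow p (Φ-form m 1≤m)) λ t 1<t → begin
      Φ (p * m) (+ t) (+ 1) ℤ.* Φ m (+ t) (+ 1)         ≡⟨ cong₂ ℤ._*_ (Φ-value (p * m) 1≤pm t 1<t) (Φ-value m 1≤m t 1<t) ⟩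
      + cyc t (p * m) ℤ.* + cyc t m                     ≡⟨ ℤₚ.pos-* (cyc t (p * m)) (cyc t m) ⟨
      + (cyc t (p * m) * cyc t m)                       ≡⟨ cong (λ b → + (cyc t (p * m) * (if b then 1 else cyc t m))) (dec-false (p ∣? m) p∤m) ⟨
      + (cyc t (p * m) * unless (p ∣? m) (cyc t m))     ≡⟨ cong +_ (cyc-prime-* 1<t pr m 1≤m) ⟩
      + cyc (t ^ p) m                                   ≡⟨ Φ-value-^ m p 1≤m 1≤p t 1<t ⟨
      Φ m ((+ t) ℤ.^ p) ((+ 1) ℤ.^ p)                   ∎
    where open ≡-Reasoning

-- The forms of index 1, 2, p and 2p; geometric sums

Φ₁ : ∀ x y → Φ 1 x y ≡ x ℤ.- y
Φ₁ x y = solve 2 (λ x y → con (- + 1) :* con (+ 1) :* (y :* con (+ 1)) :+ (con (+ 1) :* (x :* con (+ 1)) :* con (+ 1) :+ con (+ 0)) := x :- y) refl x y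
  where open ℤSolver

Φ₂ : ∀ x y → Φ 2 x y ≡ x ℤ.+ y
Φ₂ x y = solve 2 (λ x y → con (+ 1) :* con (+ 1) :* (y :* con (+ 1)) :+ (con (+ 1) :* (x :* con (+ 1)) :* con (+ 1) :+ con (+ 0)) := x :+ y) refl x y
  where open ℤSolver

-- xᵏ⁻¹ + xᵏ⁻² y + ⋯ + yᵏ⁻¹
geometric : ℕ → ℤ → ℤ → ℤ
geometric zero    x y = + 0
geometric (suc k) x y = x ℤ.* geometric k x y ℤ.+ y ℤ.^ k

geometric-telescope : ∀ k x y → geometric k x y ℤ.* (x ℤ.- y) ≡ x ℤ.^ k ℤ.- y ℤ.^ k
geometric-telescope zero    x y = refl
geometric-telescope (suc k) x y = begin
  (x ℤ.* geometric k x y ℤ.+ y ℤ.^ k) ℤ.* (x ℤ.- y)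
    ≡⟨ solve 4 (λ x y g z → (x :* g :+ z) :* (x :- y) := x :* (g :* (x :- y)) :+ z :* (x :- y)) refl x y (geometric k x y) (y ℤ.^ k) ⟩
  x ℤ.* (geometric k x y ℤ.* (x ℤ.- y)) ℤ.+ y ℤ.^ k ℤ.* (x ℤ.- y)
    ≡⟨ cong (λ w → x ℤ.* w ℤ.+ y ℤ.^ k ℤ.* (x ℤ.- y)) (geometric-telescope k x y) ⟩
  x ℤ.* (x ℤ.^ k ℤ.- y ℤ.^ k) ℤ.+ y ℤ.^ k ℤ.* (x ℤ.- y)
    ≡⟨ solve 4 (λ x y w z → x :* (w :- z) :+ z :* (x :- y) := x :* w :- y :* z) refl x y (x ℤ.^ k) (y ℤ.^ k) ⟩
  x ℤ.* x ℤ.^ k ℤ.- y ℤ.* y ℤ.^ k ∎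
  where
  open ≡-Reasoning
  open ℤSolver

geometric-form : ∀ k → Form (geometric (suc k)) k
geometric-form k = record { homogeneous = hom k ; polyˡ = pˡ (suc k) ; polyʳ = pʳ (suc k) }
  where
  open ℤSolver
  hom : ∀ k c x y → geometric (suc k) (c ℤ.* x) (c ℤ.* y) ≡ c ℤ.^ k ℤ.* geometric (suc k) x y
  hom zero    c x y = solve 2 (λ c x → c :* x :* con (+ 0) :+ con (+ 1) := con (+ 1) :* (x :* con (+ 0) :+ con (+ 1))) refl c x
  hom (suc k) c x y = trans (cong₂ (λ u v → c ℤ.* x ℤ.* u ℤ.+ v) (hom k c x y) (ℤ^-distribʳ-* c y (suc k)))
    (solve 5 (λ c x d g w → c :* x :* (d :* g) :+ c :* d :* w := c :* d :* (x :* g :+ w)) refl c x (c ℤ.^ k) (geometric (suc k) x y) (y ℤ.^ suc k))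
  pˡ : ∀ k y → PolyFun (λ x → geometric k x y)
  pˡ zero    y = polyFun-const (+ 0)
  pˡ (suc k) y = polyFun-+ (polyFun-* polyFun-id (pˡ k y)) (polyFun-const (y ℤ.^ k))
  pʳ : ∀ k x → PolyFun (geometric k x)
  pʳ zero    x = polyFun-const (+ 0)
  pʳ (suc k) x = polyFun-+ (polyFun-* (polyFun-const x) (pʳ k x)) (polyFun-^ polyFun-id k)

geometric-unique : ∀ {F k} → Form F k → (∀ x y → F x y ℤ.* (x ℤ.- y) ≡ x ℤ.^ suc k ℤ.- y ℤ.^ suc k) →
                   ∀ x y → F x y ≡ geometric (suc k) x y
geometric-unique {F} {k} formF eq = form-unique formF (geometric-form k)
  λ { (suc zero) (s≤s ()) ; (suc (suc t)) _ → ℤₚ.*-cancelʳ-≡ _ _ (+ suc t) (trans (eq (+ (2 + t)) (+ 1)) (sym (geometric-telescope (suc k) (+ (2 + t)) (+ 1)))) }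

prime-∤1 : ∀ {p} → Prime p → p ∤ 1
prime-∤1 pr p∣1 = contradiction (∣⇒≤ p∣1) (ℕₚ.<⇒≱ (prime≥2 pr))

prime-∤2 : ∀ {p} → 3 ≤ p → p ∤ 2
prime-∤2 3≤p p∣2 = contradiction (∣⇒≤ p∣2) (ℕₚ.<⇒≱ 3≤p)

totient-prime : ∀ {k} → Prime (suc k) → totient (suc k * 1) ≡ k
totient-prime {k} pr = ℕₚ.+-cancelʳ-≡ 1 _ _ (trans (totient-prime-∤ pr (prime-∤1 pr)) (trans (ℕₚ.*-identityʳ (suc k)) (ℕₚ.+-comm 1 k)))

totient-2prime : ∀ {k} → Prime (suc k) → 2 ≤ k → totient (suc k * 2) ≡ k
totient-2prime {k} pr 2≤k = ℕₚ.+-cancelʳ-≡ 1 _ _ (trans (totient-prime-∤ pr (prime-∤2 (s≤s 2≤k))) (trans (ℕₚ.*-identityʳ (suc k)) (ℕₚ.+-comm 1 k)))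

Φ-prime : ∀ {k} → Prime (suc k) → ∀ x y → Φ (suc k * 1) x y ≡ geometric (suc k) x y
Φ-prime {k} pr = geometric-unique (subst (Form (Φ (suc k * 1))) (totient-prime pr) (Φ-form (suc k * 1) (s≤s z≤n)))
  λ x y → trans (cong (Φ (suc k * 1) x y ℤ.*_) (sym (Φ₁ x y)))
    (trans (Φ-prime-∤ pr (s≤s z≤n) (prime-∤1 pr) x y) (Φ₁ (x ℤ.^ suc k) (y ℤ.^ suc k)))

neg-^-even : ∀ y j → (- y) ℤ.^ (j + j) ≡ y ℤ.^ (j + j)
neg-^-even y zero    = refl
neg-^-even y (suc j) rewrite ℕₚ.+-suc j j | neg-^-even y j =
  solve 2 (λ y w → (:- y) :* ((:- y) :* w) := y :* (y :* w)) refl y (y ℤ.^ (j + j))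
  where open ℤSolver

-- For odd p the substitution y ↦ -y turns x + y into x - y and xᵖ + yᵖ into xᵖ - yᵖ, the
-- telescoping identity of index p again.
Φ-2prime : ∀ {j} → 1 ≤ j → Prime (suc (j + j)) → ∀ x y → Φ (suc (j + j) * 2) x (- y) ≡ geometric (suc (j + j)) x y
Φ-2prime {j} 1≤j pr = geometric-unique
  (form-negʳ (subst (Form (Φ (suc k * 2))) (totient-2prime pr 2≤k) (Φ-form (suc k * 2) (s≤s z≤n))))
  λ x y → begin
    Φ (suc k * 2) x (- y) ℤ.* (x ℤ.- y)         ≡⟨ cong (Φ (suc k * 2) x (- y) ℤ.*_) (Φ₂ x (- y)) ⟨
    Φ (suc k * 2) x (- y) ℤ.* Φ 2 x (- y)       ≡⟨ Φ-prime-∤ pr (s≤s z≤n) (prime-∤2 (s≤s 2≤k)) x (- y) ⟩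
    Φ 2 (x ℤ.^ suc k) ((- y) ℤ.^ suc k)         ≡⟨ Φ₂ (x ℤ.^ suc k) _ ⟩
    x ℤ.^ suc k ℤ.+ (- y) ℤ.* (- y) ℤ.^ k       ≡⟨ cong (λ w → x ℤ.^ suc k ℤ.+ (- y) ℤ.* w) (neg-^-even y j) ⟩
    x ℤ.^ suc k ℤ.+ (- y) ℤ.* y ℤ.^ k           ≡⟨ cong (λ w → x ℤ.^ suc k ℤ.+ w) (ℤₚ.neg-distribˡ-* y (y ℤ.^ k)) ⟨
    x ℤ.^ suc k ℤ.- y ℤ.^ suc k                 ∎
  where
  open ≡-Reasoning
  k : ℕ
  k = j + j
  2≤k : 2 ≤ k
  2≤k = ℕₚ.+-mono-≤ 1≤j 1≤j

-- Bounds for the cyclotomic forms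

abs-^ : ∀ x n → ∣ x ℤ.^ n ∣ ≡ ∣ x ∣ ^ n
abs-^ x zero    = refl
abs-^ x (suc n) = trans (ℤₚ.abs-* x (x ℤ.^ n)) (cong (∣ x ∣ *_) (abs-^ x n))

maxAbs-^ : ∀ x y p → maxAbs (x ℤ.^ p) (y ℤ.^ p) ≡ maxAbs x y ^ p
maxAbs-^ x y p = trans (cong₂ _⊔_ (abs-^ x p) (abs-^ y p))
  (sym (ℕₚ.mono-≤-distrib-⊔ {f = _^ p} (ℕₚ.^-monoˡ-≤ p) ∣ x ∣ ∣ y ∣))

^-pos : ∀ {m} n → 1 ≤ m → 1 ≤ m ^ n
^-pos {m} n 1≤m = ℕₚ.m^n>0 m {{>-nonZero 1≤m}} n

maxAbs-^-pos : ∀ {x y} p → 1 ≤ maxAbs x y → 1 ≤ maxAbs (x ℤ.^ p) (y ℤ.^ p)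
maxAbs-^-pos {x} {y} p h = subst (1 ≤_) (sym (maxAbs-^ x y p)) (^-pos p h)

-- A is the quotient C / B, of expected size R. Its lower bound sets the lower bound of C against
-- the upper bound of B, and its upper bound does the reverse, so both carry the loss v w / u.
quotient-bounds : ∀ u v w M R A B {C} .{{_ : NonZero M}} → A * B ≡ C →
  u * M ≤ v * B → B ≤ w * M → u * (R * M) ≤ v * C → C ≤ w * (R * M) →
  u * R ≤ v * w * A × u * A ≤ v * w * R
quotient-bounds u v w M R A B refl loB upB loC upC =
  ℕₚ.*-cancelʳ-≤ _ _ M (begin
    u * R * M              ≡⟨ ℕₚ.*-assoc u R M ⟩
    u * (R * M)            ≤⟨ loC ⟩
    v * (A * B)            ≤⟨ ℕₚ.*-monoʳ-≤ v (ℕₚ.*-monoʳ-≤ A upB) ⟩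
    v * (A * (w * M))      ≡⟨ solve 4 (λ v w a m → v :* (a :* (w :* m)) := v :* w :* a :* m) refl v w A M ⟩
    v * w * A * M          ∎) ,
  ℕₚ.*-cancelʳ-≤ _ _ M (begin
    u * A * M              ≡⟨ solve 3 (λ u a m → u :* a :* m := a :* (u :* m)) refl u A M ⟩
    A * (u * M)            ≤⟨ ℕₚ.*-monoʳ-≤ A loB ⟩
    A * (v * B)            ≡⟨ solve 3 (λ a v b → a :* (v :* b) := v :* (a :* b)) refl A v B ⟩
    v * (A * B)            ≤⟨ ℕₚ.*-monoʳ-≤ v upC ⟩
    v * (w * (R * M))      ≡⟨ solve 4 (λ v w r m → v :* (w :* (r :* m)) := v :* w :* r :* m) refl v w R M ⟩
    v * w * R * M          ∎)
  where
  open ℕₚ.≤-Reasoning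
  open +-*-Solver

^-distribʳ-* : ∀ n x y → (x * y) ^ n ≡ x ^ n * y ^ n
^-distribʳ-* zero    x y = refl
^-distribʳ-* (suc n) x y = trans (cong (x * y *_) (^-distribʳ-* n x y)) (ℕₚ.[m*n]*[o*p]≡[m*o]*[n*p] x y (x ^ n) (y ^ n))

-- The bounds with the denominator 3^φ(n) cleared. A natural `val` records the sign, and for M ≥ 1
-- `lower` makes it positive.
record PositiveBounds (n : ℕ) (x y : ℤ) : Set where
  field
    val   : ℕ
    Φ≡val : Φ n x y ≡ + val
    lower : 2 ^ totient n * maxAbs x y ^ totient n ≤ 3 ^ totient n * val
    upper : val ≤ 2 ^ totient n * maxAbs x y ^ totient n

  val-pos : 1 ≤ maxAbs x y → 1 ≤ val
  val-pos 1≤M = ℕₚ.n≢0⇒n>0 λ val≡0 → ℕₚ.<-irrefl refl (begin-strict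
      0                                        <⟨ ℕₚ.*-mono-≤ (^-pos {2} (totient n) (s≤s z≤n)) (^-pos (totient n) 1≤M) ⟩
      2 ^ totient n * maxAbs x y ^ totient n   ≤⟨ lower ⟩
      3 ^ totient n * val                      ≡⟨ cong (3 ^ totient n *_) val≡0 ⟩
      3 ^ totient n * 0                        ≡⟨ ℕₚ.*-zeroʳ (3 ^ totient n) ⟩
      0                                        ∎)
    where open ℕₚ.≤-Reasoning

open PositiveBounds

PositivelyBounded : ℕ → Set
PositivelyBounded n = ∀ x y → 1 ≤ maxAbs x y → PositiveBounds n x y

-- The bounds for Φ_m at (xᵖ, yᵖ) have the right power of M, with 2/3 and 2 only to the power e;
-- raising these to p e weakens both bounds.
positiveBounds-∣ : ∀ {p m} → Prime p → 1 ≤ m → p ∣ m → PositivelyBounded m → PositivelyBounded (p * m)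
positiveBounds-∣ {p} {m} pr 1≤m p∣m pb x y 1≤M = record
    { val   = val b
    ; Φ≡val = trans (Φ-prime-∣ pr 1≤m p∣m x y) (Φ≡val b)
    ; lower = subst (λ E → 2 ^ E * M ^ E ≤ 3 ^ E * val b) (sym (totient-prime-∣ pr p∣m)) lo
    ; upper = subst (λ E → val b ≤ 2 ^ E * M ^ E) (sym (totient-prime-∣ pr p∣m)) up }
  where
  open ℕₚ.≤-Reasoning
  b = pb (x ℤ.^ p) (y ℤ.^ p) (maxAbs-^-pos {x} {y} p 1≤M)
  e M f : ℕ
  e = totient m
  M = maxAbs x y
  f = p * e ∸ e
  split : f + e ≡ p * e
  split = ℕₚ.m∸n+n≡m (ℕₚ.m≤n*m e p {{prime⇒nonZero pr}})
  M^ : maxAbs (x ℤ.^ p) (y ℤ.^ p) ^ e ≡ M ^ (p * e)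
  M^ = trans (cong (_^ e) (maxAbs-^ x y p)) (ℕₚ.^-*-assoc M p e)
  lo : 2 ^ (p * e) * M ^ (p * e) ≤ 3 ^ (p * e) * val b
  lo = begin
    2 ^ (p * e) * M ^ (p * e)         ≡⟨ cong (λ k → 2 ^ k * M ^ (p * e)) split ⟨
    2 ^ (f + e) * M ^ (p * e)         ≡⟨ cong (_* M ^ (p * e)) (ℕₚ.^-distribˡ-+-* 2 f e) ⟩
    2 ^ f * 2 ^ e * M ^ (p * e)       ≡⟨ ℕₚ.*-assoc (2 ^ f) (2 ^ e) _ ⟩
    2 ^ f * (2 ^ e * M ^ (p * e))     ≡⟨ cong (λ k → 2 ^ f * (2 ^ e * k)) M^ ⟨
    2 ^ f * (2 ^ e * maxAbs (x ℤ.^ p) (y ℤ.^ p) ^ e) ≤⟨ ℕₚ.*-mono-≤ (ℕₚ.^-monoˡ-≤ f (ℕₚ.n≤1+n 2)) (lower b) ⟩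
    3 ^ f * (3 ^ e * val b)             ≡⟨ ℕₚ.*-assoc (3 ^ f) (3 ^ e) _ ⟨
    3 ^ f * 3 ^ e * val b               ≡⟨ cong (_* val b) (ℕₚ.^-distribˡ-+-* 3 f e) ⟨
    3 ^ (f + e) * val b                 ≡⟨ cong (λ k → 3 ^ k * val b) split ⟩
    3 ^ (p * e) * val b                 ∎
  up : val b ≤ 2 ^ (p * e) * M ^ (p * e)
  up = begin
    val b                               ≤⟨ upper b ⟩
    2 ^ e * maxAbs (x ℤ.^ p) (y ℤ.^ p) ^ e ≡⟨ cong (2 ^ e *_) M^ ⟩
    2 ^ e * M ^ (p * e)               ≤⟨ ℕₚ.*-monoˡ-≤ (M ^ (p * e)) (ℕₚ.^-monoʳ-≤ 2 (ℕₚ.m≤n*m e p {{prime⇒nonZero pr}})) ⟩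
    2 ^ (p * e) * M ^ (p * e)         ∎

4*≤ : ∀ {p e E} → 5 ≤ p → E + e ≡ p * e → Σ ℕ λ f → E ≡ 4 * e + f
4*≤ {p} {e} {E} 5≤p eq = E ∸ 4 * e , sym (ℕₚ.m+[n∸m]≡n (ℕₚ.+-cancelʳ-≤ e (4 * e) E (begin
  4 * e + e ≡⟨ ℕₚ.+-comm (4 * e) e ⟩
  5 * e     ≤⟨ ℕₚ.*-monoˡ-≤ e 5≤p ⟩
  p * e     ≡⟨ eq ⟨
  E + e     ∎)))
  where open ℕₚ.≤-Reasoning

-- Rests on 16 · 3 ≤ 81, with E = 4 e + f coming from p ≥ 5. For p = 3 one has E = 2 e, and 4 · 3 ≤
-- 9 fails.
2^E*3^e≤3^E : ∀ e f → 2 ^ (4 * e + f) * 3 ^ e ≤ 3 ^ (4 * e + f)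
2^E*3^e≤3^E e f = begin
  2 ^ (4 * e + f) * 3 ^ e        ≡⟨ cong (_* 3 ^ e) (ℕₚ.^-distribˡ-+-* 2 (4 * e) f) ⟩
  2 ^ (4 * e) * 2 ^ f * 3 ^ e    ≡⟨ cong (λ z → z * 2 ^ f * 3 ^ e) (ℕₚ.^-*-assoc 2 4 e) ⟨
  16 ^ e * 2 ^ f * 3 ^ e         ≡⟨ solve 3 (λ a b c → a :* b :* c := a :* c :* b) refl (16 ^ e) (2 ^ f) (3 ^ e) ⟩
  16 ^ e * 3 ^ e * 2 ^ f         ≡⟨ cong (_* 2 ^ f) (^-distribʳ-* e 16 3) ⟨
  48 ^ e * 2 ^ f                 ≤⟨ ℕₚ.*-mono-≤ (ℕₚ.^-monoˡ-≤ e (ℕₚ.m≤m+n 48 33)) (ℕₚ.^-monoˡ-≤ f (ℕₚ.n≤1+n 2)) ⟩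
  81 ^ e * 3 ^ f                 ≡⟨ cong (_* 3 ^ f) (ℕₚ.^-*-assoc 3 4 e) ⟩
  3 ^ (4 * e) * 3 ^ f            ≡⟨ ℕₚ.^-distribˡ-+-* 3 (4 * e) f ⟨
  3 ^ (4 * e + f)                ∎
  where
  open ℕₚ.≤-Reasoning
  open +-*-Solver

3^e≤2^E : ∀ e f → 3 ^ e ≤ 2 ^ (4 * e + f)
3^e≤2^E e f = begin
  3 ^ e              ≤⟨ ℕₚ.^-monoˡ-≤ e (ℕₚ.m≤m+n 3 13) ⟩
  16 ^ e             ≡⟨ ℕₚ.^-*-assoc 2 4 e ⟩
  2 ^ (4 * e)        ≤⟨ ℕₚ.^-monoʳ-≤ 2 (ℕₚ.m≤m+n (4 * e) f) ⟩
  2 ^ (4 * e + f)    ∎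
  where open ℕₚ.≤-Reasoning

-- The sign follows on cancelling the positive `val b`. In `quotient-bounds` u = w = 2ᵉ cancel, so
-- the loss on either side is v = 3ᵉ, which the exponent φ(p m) ≥ 4 e absorbs.
positiveBounds-∤ : ∀ {p m} → Prime p → 5 ≤ p → 1 ≤ m → p ∤ m → PositivelyBounded m → PositivelyBounded (p * m)
positiveBounds-∤ {p} {m} pr 5≤p 1≤m p∤m pb x y 1≤M = record
    { val   = A
    ; Φ≡val = sym A≡
    ; lower = subst (λ E → 2 ^ E * M ^ E ≤ 3 ^ E * A) (sym E≡) lo
    ; upper = subst (λ E → A ≤ 2 ^ E * M ^ E) (sym E≡) up }
  where
  open ℕₚ.≤-Reasoning
  b = pb x y 1≤M
  c = pb (x ℤ.^ p) (y ℤ.^ p) (maxAbs-^-pos {x} {y} p 1≤M)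
  e E M A f : ℕ
  e = totient m
  E = totient (p * m)
  M = maxAbs x y
  A = ∣ Φ (p * m) x y ∣
  eq : E + e ≡ p * e
  eq = totient-prime-∤ pr p∤m
  f = proj₁ (4*≤ 5≤p eq)
  E≡ : E ≡ 4 * e + f
  E≡ = proj₂ (4*≤ 5≤p eq)
  prod : Φ (p * m) x y ℤ.* + val b ≡ + val c
  prod = trans (cong (Φ (p * m) x y ℤ.*_) (sym (Φ≡val b))) (trans (Φ-prime-∤ pr 1≤m p∤m x y) (Φ≡val c))
  A≡ : + A ≡ Φ (p * m) x y
  A≡ = ℤₚ.0≤i⇒+∣i∣≡i (ℤₚ.*-cancelʳ-≤-pos (+ 0) _ (+ val b) {{ℤ.positive (ℤ.+<+ (val-pos b 1≤M))}}
    (subst (ℤ._≤_ (+ 0)) (sym prod) (ℤ.+≤+ z≤n)))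
  A*B : A * val b ≡ val c
  A*B = trans (sym (ℤₚ.abs-* (Φ (p * m) x y) (+ val b))) (cong ∣_∣ prod)
  M^ : maxAbs (x ℤ.^ p) (y ℤ.^ p) ^ e ≡ M ^ E * M ^ e
  M^ = trans (cong (_^ e) (maxAbs-^ x y p)) (trans (ℕₚ.^-*-assoc M p e) (trans (cong (M ^_) (sym eq)) (ℕₚ.^-distribˡ-+-* M E e)))
  quot : 2 ^ e * M ^ E ≤ 3 ^ e * 2 ^ e * A × 2 ^ e * A ≤ 3 ^ e * 2 ^ e * M ^ E
  quot = quotient-bounds (2 ^ e) (3 ^ e) (2 ^ e) (M ^ e) (M ^ E) A (val b) {{>-nonZero (^-pos e 1≤M)}} A*B (lower b) (upper b)
    (subst (λ z → 2 ^ e * z ≤ 3 ^ e * val c) M^ (lower c)) (subst (λ z → val c ≤ 2 ^ e * z) M^ (upper c))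
  cancel : ∀ {X Y} → 2 ^ e * X ≤ 3 ^ e * 2 ^ e * Y → X ≤ 3 ^ e * Y
  cancel {X} {Y} h = ℕₚ.*-cancelˡ-≤ (2 ^ e) {{ℕₚ.m^n≢0 2 e}} (ℕₚ.≤-trans h (ℕₚ.≤-reflexive
    (solve 3 (λ a b c → a :* b :* c := b :* (a :* c)) refl (3 ^ e) (2 ^ e) Y)))
    where open +-*-Solver
  lo : 2 ^ (4 * e + f) * M ^ (4 * e + f) ≤ 3 ^ (4 * e + f) * A
  lo = begin
    2 ^ (4 * e + f) * M ^ (4 * e + f) ≡⟨ cong (λ k → 2 ^ (4 * e + f) * M ^ k) E≡ ⟨
    2 ^ (4 * e + f) * M ^ E           ≤⟨ ℕₚ.*-monoʳ-≤ (2 ^ (4 * e + f)) (cancel (proj₁ quot)) ⟩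
    2 ^ (4 * e + f) * (3 ^ e * A)     ≡⟨ ℕₚ.*-assoc (2 ^ (4 * e + f)) (3 ^ e) A ⟨
    2 ^ (4 * e + f) * 3 ^ e * A       ≤⟨ ℕₚ.*-monoˡ-≤ A (2^E*3^e≤3^E e f) ⟩
    3 ^ (4 * e + f) * A               ∎
  up : A ≤ 2 ^ (4 * e + f) * M ^ (4 * e + f)
  up = begin
    A                                 ≤⟨ cancel (proj₂ quot) ⟩
    3 ^ e * M ^ E                     ≤⟨ ℕₚ.*-monoˡ-≤ (M ^ E) (3^e≤2^E e f) ⟩
    2 ^ (4 * e + f) * M ^ E           ≡⟨ cong (λ k → 2 ^ (4 * e + f) * M ^ k) E≡ ⟩
    2 ^ (4 * e + f) * M ^ (4 * e + f) ∎

square-^ : ∀ y j → (y ℤ.* y) ℤ.^ j ≡ y ℤ.^ (j + j)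
square-^ y j = trans (ℤ^-distribʳ-* y y j) (sym (ℤₚ.^-distribˡ-+-* y j j))

geometric-even : ∀ j x y → geometric (j + j) x y ≡ (x ℤ.+ y) ℤ.* geometric j (x ℤ.* x) (y ℤ.* y)
geometric-even zero    x y = sym (ℤₚ.*-zeroʳ (x ℤ.+ y))
geometric-even (suc j) x y rewrite ℕₚ.+-suc j j | geometric-even j x y | square-^ y j =
  solve 4 (λ x y g w → x :* (x :* ((x :+ y) :* g) :+ w) :+ y :* w := (x :+ y) :* (x :* x :* g :+ w))
    refl x y (geometric j (x ℤ.* x) (y ℤ.* y)) (y ℤ.^ (j + j))
  where open ℤSolver

0≤square : ∀ x → + 0 ℤ.≤ x ℤ.* x
0≤square (+ n)      = subst (ℤ._≤_ (+ 0)) (ℤₚ.pos-* n n) (ℤ.+≤+ z≤n)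
0≤square ℤ.-[1+ n ] = ℤ.+≤+ z≤n

0≤* : ∀ {x y} → + 0 ℤ.≤ x → + 0 ℤ.≤ y → + 0 ℤ.≤ x ℤ.* y
0≤* {+ m} {+ n} _ _ = subst (ℤ._≤_ (+ 0)) (ℤₚ.pos-* m n) (ℤ.+≤+ z≤n)

0≤^ : ∀ {x} n → + 0 ℤ.≤ x → + 0 ℤ.≤ x ℤ.^ n
0≤^ zero    _   = ℤ.+≤+ z≤n
0≤^ (suc n) 0≤x = 0≤* 0≤x (0≤^ n 0≤x)

0≤geometric : ∀ k {x y} → + 0 ℤ.≤ x → + 0 ℤ.≤ y → + 0 ℤ.≤ geometric k x y
0≤geometric zero    _   _   = ℤ.+≤+ z≤n
0≤geometric (suc k) 0≤x 0≤y = ℤₚ.+-mono-≤ (0≤* 0≤x (0≤geometric k 0≤x 0≤y)) (0≤^ k 0≤y)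

even-^ : ∀ x j → x ℤ.^ (j + j) ≡ + (∣ x ∣ ^ (j + j))
even-^ x j = trans (sym (ℤₚ.0≤i⇒+∣i∣≡i (subst (ℤ._≤_ (+ 0)) (sym (ℤₚ.^-distribˡ-+-* x j j)) (0≤square (x ℤ.^ j))))) (cong +_ (abs-^ x (j + j)))

-- A positivity certificate: a square times a geometric sum in squares, plus two even powers. It
-- comes from 2 x = (x + y) + (x - y), telescoping the second part.
geometric-odd : ∀ j x y → + 2 ℤ.* geometric (suc (j + j)) x y ≡
  (x ℤ.+ y) ℤ.* (x ℤ.+ y) ℤ.* geometric j (x ℤ.* x) (y ℤ.* y) ℤ.+ (x ℤ.^ (j + j) ℤ.+ y ℤ.^ (j + j))
geometric-odd j x y = begin
  + 2 ℤ.* (x ℤ.* g ℤ.+ Y)                      ≡⟨ solve 4 (λ x y g Y → con (+ 2) :* (x :* g :+ Y) := (x :+ y) :* g :+ (g :* (x :- y) :+ Y :+ Y)) refl x y g Y ⟩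
  (x ℤ.+ y) ℤ.* g ℤ.+ (g ℤ.* (x ℤ.- y) ℤ.+ Y ℤ.+ Y) ≡⟨ cong (λ z → (x ℤ.+ y) ℤ.* g ℤ.+ (z ℤ.+ Y ℤ.+ Y)) (geometric-telescope (j + j) x y) ⟩
  (x ℤ.+ y) ℤ.* g ℤ.+ (X ℤ.- Y ℤ.+ Y ℤ.+ Y)    ≡⟨ cong (λ z → (x ℤ.+ y) ℤ.* z ℤ.+ (X ℤ.- Y ℤ.+ Y ℤ.+ Y)) (geometric-even j x y) ⟩
  (x ℤ.+ y) ℤ.* ((x ℤ.+ y) ℤ.* h) ℤ.+ (X ℤ.- Y ℤ.+ Y ℤ.+ Y) ≡⟨ solve 4 (λ s h X Y → s :* (s :* h) :+ (X :- Y :+ Y :+ Y) := s :* s :* h :+ (X :+ Y)) refl (x ℤ.+ y) h X Y ⟩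
  (x ℤ.+ y) ℤ.* (x ℤ.+ y) ℤ.* h ℤ.+ (X ℤ.+ Y)  ∎
  where
  open ≡-Reasoning
  open ℤSolver
  g h X Y : ℤ
  g = geometric (j + j) x y
  h = geometric j (x ℤ.* x) (y ℤ.* y)
  X = x ℤ.^ (j + j)
  Y = y ℤ.^ (j + j)

geometric-upper : ∀ k x y → ∣ geometric (suc k) x y ∣ ≤ suc k * maxAbs x y ^ k
geometric-upper zero    x y = ℕₚ.≤-reflexive (cong (λ z → ∣ z ℤ.+ + 1 ∣) (ℤₚ.*-zeroʳ x))
geometric-upper (suc k) x y = begin
  ∣ x ℤ.* g ℤ.+ y ℤ.^ suc k ∣            ≤⟨ ℤₚ.∣i+j∣≤∣i∣+∣j∣ (x ℤ.* g) (y ℤ.^ suc k) ⟩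
  ∣ x ℤ.* g ∣ + ∣ y ℤ.^ suc k ∣          ≡⟨ cong₂ _+_ (ℤₚ.abs-* x g) (abs-^ y (suc k)) ⟩
  ∣ x ∣ * ∣ g ∣ + ∣ y ∣ ^ suc k          ≤⟨ ℕₚ.+-mono-≤ (ℕₚ.*-mono-≤ (ℕₚ.m≤m⊔n ∣ x ∣ ∣ y ∣) (geometric-upper k x y)) (ℕₚ.^-monoˡ-≤ (suc k) (ℕₚ.m≤n⊔m ∣ x ∣ ∣ y ∣)) ⟩
  M * (suc k * M ^ k) + M * M ^ k        ≡⟨ solve 3 (λ m k z → m :* (k :* z) :+ m :* z := (con 1 :+ k) :* (m :* z)) refl M (suc k) (M ^ k) ⟩
  suc (suc k) * M ^ suc k                ∎
  where
  open ℕₚ.≤-Reasoning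
  open +-*-Solver
  M : ℕ
  M = maxAbs x y
  g : ℤ
  g = geometric (suc k) x y

-- Dropping the square term of `geometric-odd` leaves x^(2j) + y^(2j), which is at least its larger
-- summand.
geometric-lower : ∀ j x y → Σ ℕ λ N → geometric (suc (j + j)) x y ≡ + N × maxAbs x y ^ (j + j) ≤ 2 * N
geometric-lower j x y = N , sym N≡ , ℤₚ.drop‿+≤+ (begin
    + (maxAbs x y ^ k)                                ≡⟨ cong +_ (ℕₚ.mono-≤-distrib-⊔ {f = _^ k} (ℕₚ.^-monoˡ-≤ k) ∣ x ∣ ∣ y ∣) ⟩
    + (∣ x ∣ ^ k ⊔ ∣ y ∣ ^ k)                         ≤⟨ ℤ.+≤+ (ℕₚ.m⊔n≤m+n (∣ x ∣ ^ k) (∣ y ∣ ^ k)) ⟩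
    + (∣ x ∣ ^ k) ℤ.+ + (∣ y ∣ ^ k)                   ≡⟨ cong₂ ℤ._+_ (even-^ x j) (even-^ y j) ⟨
    x ℤ.^ k ℤ.+ y ℤ.^ k                               ≡⟨ ℤₚ.+-identityˡ _ ⟨
    + 0 ℤ.+ (x ℤ.^ k ℤ.+ y ℤ.^ k)                     ≤⟨ ℤₚ.+-monoˡ-≤ (x ℤ.^ k ℤ.+ y ℤ.^ k) 0≤T ⟩
    T ℤ.+ (x ℤ.^ k ℤ.+ y ℤ.^ k)                       ≡⟨ geometric-odd j x y ⟨
    + 2 ℤ.* geometric (suc k) x y                     ≡⟨ cong (+ 2 ℤ.*_) N≡ ⟨
    + 2 ℤ.* + N                                       ≡⟨ ℤₚ.pos-* 2 N ⟨
    + (2 * N)                                         ∎)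
  where
  open ℤₚ.≤-Reasoning
  k N : ℕ
  k = j + j
  N = ∣ geometric (suc k) x y ∣
  T : ℤ
  T = (x ℤ.+ y) ℤ.* (x ℤ.+ y) ℤ.* geometric j (x ℤ.* x) (y ℤ.* y)
  0≤T : + 0 ℤ.≤ T
  0≤T = 0≤* (0≤square (x ℤ.+ y)) (0≤geometric j (0≤square x) (0≤square y))
  0≤2g : + 0 ℤ.≤ + 2 ℤ.* geometric (suc k) x y
  0≤2g = subst (ℤ._≤_ (+ 0)) (sym (geometric-odd j x y)) (ℤₚ.+-mono-≤ 0≤T
    (ℤₚ.+-mono-≤ (subst (ℤ._≤_ (+ 0)) (sym (even-^ x j)) (ℤ.+≤+ z≤n)) (subst (ℤ._≤_ (+ 0)) (sym (even-^ y j)) (ℤ.+≤+ z≤n))))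
  N≡ : + N ≡ geometric (suc k) x y
  N≡ = ℤₚ.0≤i⇒+∣i∣≡i (ℤₚ.*-cancelˡ-≤-pos (+ 0) _ (+ 2) 0≤2g)

-- Lets (3/2)ᵏ absorb the factor 2 of `geometric-lower`, starting from 8 ≤ 9 at k = 2.
2*2^k≤3^k : ∀ i → 2 * 2 ^ (2 + i) ≤ 3 ^ (2 + i)
2*2^k≤3^k zero    = ℕₚ.n≤1+n 8
2*2^k≤3^k (suc i) = begin
  2 * (2 * 2 ^ (2 + i)) ≤⟨ ℕₚ.*-monoʳ-≤ 2 (2*2^k≤3^k i) ⟩
  2 * 3 ^ (2 + i)       ≤⟨ ℕₚ.*-monoˡ-≤ (3 ^ (2 + i)) (ℕₚ.n≤1+n 2) ⟩
  3 * 3 ^ (2 + i)       ∎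
  where open ℕₚ.≤-Reasoning

-- Serves both base families: z is y for index p and -y for index 2p.
geometric-bounds : ∀ {n j x y z} → 1 ≤ j → totient n ≡ j + j → maxAbs x z ≡ maxAbs x y →
                   Φ n x y ≡ geometric (suc (j + j)) x z → PositiveBounds n x y
geometric-bounds {n} {j} {x} {y} {z} 1≤j φ≡ max≡ Φ≡ with geometric-lower j x z | geometric-upper (j + j) x z
... | N , g≡ , lo | up = record
    { val   = N
    ; Φ≡val = trans Φ≡ g≡
    ; lower = subst₂ (λ E M → 2 ^ E * M ^ E ≤ 3 ^ E * N) (sym φ≡) max≡ (begin
        2 ^ k * M ^ k     ≤⟨ ℕₚ.*-monoʳ-≤ (2 ^ k) lo ⟩
        2 ^ k * (2 * N)   ≡⟨ solve 2 (λ a n → a :* (con 2 :* n) := con 2 :* a :* n) refl (2 ^ k) N ⟩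
        2 * 2 ^ k * N     ≤⟨ ℕₚ.*-monoˡ-≤ N (subst (λ i → 2 * 2 ^ i ≤ 3 ^ i) (ℕₚ.m+[n∸m]≡n (ℕₚ.+-mono-≤ 1≤j 1≤j)) (2*2^k≤3^k (k ∸ 2))) ⟩
        3 ^ k * N         ∎)
    ; upper = subst₂ (λ E M → N ≤ 2 ^ E * M ^ E) (sym φ≡) max≡ (begin
        N                 ≡⟨ cong ∣_∣ g≡ ⟨
        ∣ geometric (suc k) x z ∣ ≤⟨ up ⟩
        suc k * M ^ k     ≤⟨ ℕₚ.*-monoˡ-≤ (M ^ k) (suc≤2^ k) ⟩
        2 ^ k * M ^ k     ∎) }
  where
  open ℕₚ.≤-Reasoning
  open +-*-Solver
  k M : ℕ
  k = j + j
  M = maxAbs x z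
  suc≤2^ : ∀ k → suc k ≤ 2 ^ k
  suc≤2^ zero    = ℕₚ.≤-refl
  suc≤2^ (suc k) = begin
    1 + suc k         ≤⟨ ℕₚ.+-mono-≤ (^-pos {2} k (s≤s z≤n)) (suc≤2^ k) ⟩
    2 ^ k + 2 ^ k     ≡⟨ solve 1 (λ a → a :+ a := con 2 :* a) refl (2 ^ k) ⟩
    2 * 2 ^ k         ∎

parity : ∀ n → Σ ℕ λ j → n ≡ j + j ⊎ n ≡ suc (j + j)
parity zero    = 0 , inj₁ refl
parity (suc n) with parity n
... | j , inj₁ refl = j , inj₂ refl
... | j , inj₂ refl = suc j , inj₁ (cong suc (sym (ℕₚ.+-suc j j)))

odd-prime : ∀ {p} → Prime p → 3 ≤ p → Σ ℕ λ j → 1 ≤ j × p ≡ suc (j + j)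
odd-prime {p} pr 3≤p with parity p
... | zero  , inj₂ refl with s≤s () ← 3≤p
... | suc j , inj₂ eq = suc j , s≤s z≤n , eq
... | j     , inj₁ refl with prime⇒irreducible pr (divides j (trans (cong (_+_ j) (sym (ℕₚ.+-identityʳ j))) (ℕₚ.*-comm 2 j)))
...   | inj₁ ()
...   | inj₂ eq = contradiction eq (ℕₚ.<⇒≢ 3≤p)

positiveBounds-prime : ∀ {p} → Prime p → 3 ≤ p → PositivelyBounded (p * 1)
positiveBounds-prime pr 3≤p x y _ with odd-prime pr 3≤p
... | j , 1≤j , refl = geometric-bounds 1≤j (totient-prime pr) refl (Φ-prime pr x y)

positiveBounds-2prime : ∀ {p} → Prime p → 3 ≤ p → PositivelyBounded (p * 2)
positiveBounds-2prime pr 3≤p x y _ with odd-prime pr 3≤p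
... | j , 1≤j , refl = geometric-bounds {z = - y} 1≤j (totient-2prime pr (ℕₚ.+-mono-≤ 1≤j 1≤j)) (cong (∣ x ∣ ⊔_) (ℤₚ.∣-i∣≡∣i∣ y))
  (trans (cong (Φ (suc (j + j) * 2) x) (sym (ℤₚ.neg-involutive y))) (Φ-2prime 1≤j pr x (- y)))

positiveBounds-4 : PositivelyBounded 4
positiveBounds-4 x y _ = record
    { val   = N₄
    ; Φ≡val = trans (Φ-prime-∣ {2} {2} prime[2] (s≤s z≤n) ∣-refl x y) (trans (Φ₂ (x ℤ.^ 2) (y ℤ.^ 2)) (cong₂ ℤ._+_ (even-^ x 1) (even-^ y 1)))
    ; lower = ℕₚ.*-mono-≤ (ℕₚ.m≤m+n 4 5) (begin
        M ^ 2 ≡⟨ ℕₚ.mono-≤-distrib-⊔ {f = _^ 2} (ℕₚ.^-monoˡ-≤ 2) ∣ x ∣ ∣ y ∣ ⟩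
        ∣ x ∣ ^ 2 ⊔ ∣ y ∣ ^ 2 ≤⟨ ℕₚ.m⊔n≤m+n (∣ x ∣ ^ 2) (∣ y ∣ ^ 2) ⟩
        N₄ ∎)
    ; upper = begin
        ∣ x ∣ ^ 2 + ∣ y ∣ ^ 2 ≤⟨ ℕₚ.+-mono-≤ (ℕₚ.^-monoˡ-≤ 2 (ℕₚ.m≤m⊔n ∣ x ∣ ∣ y ∣)) (ℕₚ.^-monoˡ-≤ 2 (ℕₚ.m≤n⊔m ∣ x ∣ ∣ y ∣)) ⟩
        M ^ 2 + M ^ 2         ≡⟨ solve 1 (λ a → a :+ a := con 2 :* a) refl (M ^ 2) ⟩
        2 * M ^ 2             ≤⟨ ℕₚ.*-monoˡ-≤ (M ^ 2) (ℕₚ.m≤m+n 2 2) ⟩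
        4 * M ^ 2             ∎ }
  where
  open ℕₚ.≤-Reasoning
  open +-*-Solver
  M N₄ : ℕ
  M = maxAbs x y
  N₄ = ∣ x ∣ ^ 2 + ∣ y ∣ ^ 2

prime[3] : Prime 3
prime[3] = toWitness {a? = prime? 3} _

-- A prime p ≥ 5 may be peeled whether or not it is repeated, while 2 and 3 must be repeated;
-- without a large prime the exponents of 2 and 3 decide.
large-prime-or-smooth : ∀ n → 1 ≤ n → (Σ ℕ λ p → Prime p × 5 ≤ p × p ∣ n) ⊎ (Σ (ℕ × ℕ) λ (a , b) → n ≡ 2 ^ a * 3 ^ b)
large-prime-or-smooth = prime-induction (λ n → (Σ ℕ λ p → Prime p × 5 ≤ p × p ∣ n) ⊎ (Σ (ℕ × ℕ) λ (a , b) → n ≡ 2 ^ a * 3 ^ b))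
    (inj₂ ((0 , 0) , refl)) step
  where
  open +-*-Solver
  step : ∀ p m → Prime p → 1 ≤ m → (Σ ℕ λ p → Prime p × 5 ≤ p × p ∣ m) ⊎ (Σ (ℕ × ℕ) λ (a , b) → m ≡ 2 ^ a * 3 ^ b) →
         (Σ ℕ λ q → Prime q × 5 ≤ q × q ∣ p * m) ⊎ (Σ (ℕ × ℕ) λ (a , b) → p * m ≡ 2 ^ a * 3 ^ b)
  step p m pr _ (inj₁ (q , qr , 5≤q , q∣m)) = inj₁ (q , qr , 5≤q , ∣n⇒∣m*n p q∣m)
  step 0 m pr _ (inj₂ _) = contradiction pr ¬prime[0]
  step 1 m pr _ (inj₂ _) = contradiction pr ¬prime[1]
  step 2 m pr _ (inj₂ ((a , b) , refl)) = inj₂ ((suc a , b) , sym (ℕₚ.*-assoc 2 (2 ^ a) (3 ^ b)))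
  step 3 m pr _ (inj₂ ((a , b) , refl)) = inj₂ ((a , suc b) , solve 2 (λ x y → con 3 :* (x :* y) := x :* (con 3 :* y)) refl (2 ^ a) (3 ^ b))
  step 4 m pr _ (inj₂ _) = contradiction pr (composite⇒¬prime composite[4])
  step p@(suc (suc (suc (suc (suc _))))) m pr _ (inj₂ _) = inj₁ (p , pr , s≤s (s≤s (s≤s (s≤s (s≤s z≤n)))) , m∣m*n m)

-- The cofactor must stay at least 3, since x - y and x + y, of index 1 and 2, can vanish. So
-- peeling ends at p, 2p and 4, with 3 and 6 among them, which are bounded directly.
positiveBounds : ∀ n → 3 ≤ n → PositivelyBounded n
positiveBounds = <-rec (λ n → 3 ≤ n → PositivelyBounded n) step
  where
  peel : ∀ p m → Prime p → p ∣ m ⊎ 5 ≤ p → 3 ≤ m → (∀ {d} → d < p * m → 3 ≤ d → PositivelyBounded d) → PositivelyBounded (p * m)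
  peel p m pr hyp 3≤m ih = cases (p ∣? m)
    where
    1≤m : 1 ≤ m
    1≤m = ℕₚ.≤-trans (s≤s z≤n) 3≤m
    m<pm : m < p * m
    m<pm = subst (m <_) (ℕₚ.*-comm m p) (ℕₚ.m<m*n m p {{>-nonZero 1≤m}} (prime≥2 pr))
    cases : Dec (p ∣ m) → PositivelyBounded (p * m)
    cases (yes p∣m) = positiveBounds-∣ pr 1≤m p∣m (ih m<pm 3≤m)
    cases (no p∤m)  = positiveBounds-∤ pr ([ (λ p∣m → contradiction p∣m p∤m) , id ]′ hyp) 1≤m p∤m (ih m<pm 3≤m)
  multiple : ∀ p m → Prime p → 5 ≤ p → 3 ≤ p * m → (∀ {d} → d < p * m → 3 ≤ d → PositivelyBounded d) → PositivelyBounded (p * m)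
  multiple p 0 pr 5≤p 3≤n ih = contradiction (ℕₚ.≤-trans 3≤n (ℕₚ.≤-reflexive (ℕₚ.*-zeroʳ p))) (λ ())
  multiple p 1 pr 5≤p 3≤n ih = positiveBounds-prime pr (ℕₚ.≤-trans (ℕₚ.m≤m+n 3 2) 5≤p)
  multiple p 2 pr 5≤p 3≤n ih = positiveBounds-2prime pr (ℕₚ.≤-trans (ℕₚ.m≤m+n 3 2) 5≤p)
  multiple p m@(suc (suc (suc _))) pr 5≤p 3≤n ih = peel p m pr (inj₂ 5≤p) (s≤s (s≤s (s≤s z≤n))) ih
  doubled : ∀ m → 2 ≤ m → 2 ∣ m → (∀ {d} → d < 2 * m → 3 ≤ d → PositivelyBounded d) → PositivelyBounded (2 * m)
  doubled 0 () _ _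
  doubled 1 (s≤s ()) _ _
  doubled 2 _ _ _ = positiveBounds-4
  doubled m@(suc (suc (suc _))) _ 2∣m ih = peel 2 m prime[2] (inj₁ 2∣m) (s≤s (s≤s (s≤s z≤n))) ih
  smooth : ∀ a b → (∀ {d} → d < 2 ^ a * 3 ^ b → 3 ≤ d → PositivelyBounded d) → 3 ≤ 2 ^ a * 3 ^ b → PositivelyBounded (2 ^ a * 3 ^ b)
  smooth (suc (suc a)) b ih 3≤n = subst PositivelyBounded (sym (ℕₚ.*-assoc 2 (2 ^ suc a) (3 ^ b)))
    (doubled m (ℕₚ.≤-trans (ℕₚ.≤-reflexive (sym (ℕₚ.*-identityʳ 2))) (ℕₚ.*-mono-≤ 2≤ (^-pos {3} b (s≤s z≤n))))
      (∣m⇒∣m*n (3 ^ b) (m∣m*n (2 ^ a)))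
      (λ {d} d<n → ih (subst (d <_) (sym (ℕₚ.*-assoc 2 (2 ^ suc a) (3 ^ b))) d<n)))
    where
    m : ℕ
    m = 2 ^ suc a * 3 ^ b
    2≤ : 2 ≤ 2 ^ suc a
    2≤ = ℕₚ.*-monoʳ-≤ 2 (^-pos {2} a (s≤s z≤n))
  smooth a (suc (suc b)) ih 3≤n = subst PositivelyBounded eq (peel 3 m prime[3] (inj₁ (∣n⇒∣m*n (2 ^ a) (m∣m*n (3 ^ b)))) 3≤m
      (λ {d} d<n → ih (subst (d <_) eq d<n)))
    where
    open +-*-Solver
    m : ℕ
    m = 2 ^ a * 3 ^ suc b
    eq : 3 * m ≡ 2 ^ a * 3 ^ suc (suc b)
    eq = solve 2 (λ x y → con 3 :* (x :* y) := x :* (con 3 :* y)) refl (2 ^ a) (3 ^ suc b)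
    3≤m : 3 ≤ m
    3≤m = ℕₚ.*-mono-≤ (^-pos {2} a (s≤s z≤n)) (ℕₚ.*-monoʳ-≤ 3 (^-pos {3} b (s≤s z≤n)))
  smooth 0 0 ih (s≤s ())
  smooth 1 0 ih (s≤s (s≤s ()))
  smooth 0 1 ih _ = positiveBounds-prime prime[3] ℕₚ.≤-refl
  smooth 1 1 ih _ = positiveBounds-2prime prime[3] ℕₚ.≤-refl
  step : ∀ n → (∀ {d} → d < n → 3 ≤ d → PositivelyBounded d) → 3 ≤ n → PositivelyBounded n
  step n ih 3≤n with large-prime-or-smooth n (ℕₚ.≤-trans (s≤s z≤n) 3≤n)
  ... | inj₂ ((a , b) , refl) = smooth a b ih 3≤n
  ... | inj₁ (p , pr , 5≤p , divides m refl) = subst PositivelyBounded (ℕₚ.*-comm p m)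
    (multiple p m pr 5≤p (subst (3 ≤_) (ℕₚ.*-comm m p) 3≤n) (λ {d} d<n → ih (subst (d <_) (ℕₚ.*-comm p m) d<n)))

-- Bounds when one argument dominates

-- At M = 2 with |x| ≠ |y| one argument is ±2 and the other at most 1 in absolute value. A ratio of
-- at least 2 survives the passage to (xᵖ, yᵖ), as the condition M = 2 would not.
Lopsided : ℤ → ℤ → Set
Lopsided x y = 2 * ∣ y ∣ ≤ ∣ x ∣ ⊎ 2 * ∣ x ∣ ≤ ∣ y ∣

2*-^-mono : ∀ {m n} p → 1 ≤ p → 2 * m ≤ n → 2 * m ^ p ≤ n ^ p
2*-^-mono {m} {n} (suc p) _ 2m≤n = begin
  2 * (m * m ^ p)   ≡⟨ ℕₚ.*-assoc 2 m (m ^ p) ⟨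
  2 * m * m ^ p     ≤⟨ ℕₚ.*-mono-≤ 2m≤n (ℕₚ.^-monoˡ-≤ p (ℕₚ.≤-trans (ℕₚ.m≤n*m m 2) 2m≤n)) ⟩
  n * n ^ p         ∎
  where open ℕₚ.≤-Reasoning

lopsided-^ : ∀ {x y} p → 1 ≤ p → Lopsided x y → Lopsided (x ℤ.^ p) (y ℤ.^ p)
lopsided-^ {x} {y} p 1≤p (inj₁ h) = inj₁ (subst₂ (λ a b → 2 * a ≤ b) (sym (abs-^ y p)) (sym (abs-^ x p)) (2*-^-mono p 1≤p h))
lopsided-^ {x} {y} p 1≤p (inj₂ h) = inj₂ (subst₂ (λ a b → 2 * a ≤ b) (sym (abs-^ x p)) (sym (abs-^ y p)) (2*-^-mono p 1≤p h))

-- In absolute values, because the induction starts from x - y, which has either sign.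
TwoSided : ℕ → ℕ → Set
TwoSided n k = ∀ x y → Lopsided x y → 1 ≤ maxAbs x y →
  maxAbs x y ^ totient n ≤ 2 ^ k * ∣ Φ n x y ∣ × ∣ Φ n x y ∣ ≤ 2 ^ k * maxAbs x y ^ totient n

lopsided-difference : ∀ x y → 2 * ∣ y ∣ ≤ ∣ x ∣ → ∣ x ∣ ≤ 2 * ∣ x ℤ.- y ∣
lopsided-difference x y 2y≤x = ℕₚ.+-cancelʳ-≤ ∣ x ∣ ∣ x ∣ (2 * ∣ x ℤ.- y ∣) (begin
  ∣ x ∣ + ∣ x ∣                       ≡⟨ cong (λ z → ∣ x ∣ + z) (ℕₚ.+-identityʳ ∣ x ∣) ⟨
  2 * ∣ x ∣                           ≡⟨ cong (λ z → 2 * ∣ z ∣) (solve 2 (λ x y → x := x :- y :+ y) refl x y) ⟩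
  2 * ∣ x ℤ.- y ℤ.+ y ∣               ≤⟨ ℕₚ.*-monoʳ-≤ 2 (ℤₚ.∣i+j∣≤∣i∣+∣j∣ (x ℤ.- y) y) ⟩
  2 * (∣ x ℤ.- y ∣ + ∣ y ∣)           ≡⟨ ℕₚ.*-distribˡ-+ 2 ∣ x ℤ.- y ∣ ∣ y ∣ ⟩
  2 * ∣ x ℤ.- y ∣ + 2 * ∣ y ∣         ≤⟨ ℕₚ.+-monoʳ-≤ (2 * ∣ x ℤ.- y ∣) 2y≤x ⟩
  2 * ∣ x ℤ.- y ∣ + ∣ x ∣             ∎)
  where
  open ℕₚ.≤-Reasoning
  open ℤSolver

lopsided-max : ∀ x y → Lopsided x y → maxAbs x y ≤ 2 * ∣ x ℤ.- y ∣
lopsided-max x y (inj₁ h) = ℕₚ.⊔-lub (lopsided-difference x y h)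
  (ℕₚ.≤-trans (ℕₚ.≤-trans (ℕₚ.m≤n*m ∣ y ∣ 2) h) (lopsided-difference x y h))
lopsided-max x y (inj₂ h) = subst (λ z → maxAbs x y ≤ 2 * z) (ℤₚ.∣i-j∣≡∣j-i∣ y x) (ℕₚ.⊔-lub
  (ℕₚ.≤-trans (ℕₚ.≤-trans (ℕₚ.m≤n*m ∣ x ∣ 2) h) (lopsided-difference y x h)) (lopsided-difference y x h))

twoSided-1 : TwoSided 1 1
twoSided-1 x y lop _ = subst (λ z → M ^ 1 ≤ 2 * ∣ z ∣ × ∣ z ∣ ≤ 2 * M ^ 1) (sym (Φ₁ x y))
  (subst (λ z → z ≤ 2 * ∣ x ℤ.- y ∣ × ∣ x ℤ.- y ∣ ≤ 2 * z) (sym (ℕₚ.*-identityʳ M)) (lopsided-max x y lop , (begin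
    ∣ x ℤ.- y ∣     ≤⟨ ℤₚ.∣i-j∣≤∣i∣+∣j∣ x y ⟩
    ∣ x ∣ + ∣ y ∣   ≤⟨ ℕₚ.+-mono-≤ (ℕₚ.m≤m⊔n ∣ x ∣ ∣ y ∣) (ℕₚ.m≤n⊔m ∣ x ∣ ∣ y ∣) ⟩
    M + M           ≡⟨ cong (λ z → M + z) (ℕₚ.+-identityʳ M) ⟨
    2 * M           ∎)))
  where
  open ℕₚ.≤-Reasoning
  M : ℕ
  M = maxAbs x y

twoSided-∣ : ∀ {p m k} → Prime p → 1 ≤ m → p ∣ m → TwoSided m k → TwoSided (p * m) k
twoSided-∣ {p} {m} {k} pr 1≤m p∣m two x y lop 1≤M =
  subst₂ (λ a z → a ≤ 2 ^ k * ∣ z ∣ × ∣ z ∣ ≤ 2 ^ k * a) M^ (sym (Φ-prime-∣ pr 1≤m p∣m x y))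
    (two (x ℤ.^ p) (y ℤ.^ p) (lopsided-^ {x} {y} p (ℕₚ.<⇒≤ (prime≥2 pr)) lop) (maxAbs-^-pos {x} {y} p 1≤M))
  where
  M^ : maxAbs (x ℤ.^ p) (y ℤ.^ p) ^ totient m ≡ maxAbs x y ^ totient (p * m)
  M^ = trans (cong (_^ totient m) (maxAbs-^ x y p)) (trans (ℕₚ.^-*-assoc (maxAbs x y) p (totient m))
    (cong (maxAbs x y ^_) (sym (totient-prime-∣ pr p∣m))))

-- `quotient-bounds` with u = 1 and v = w = 2ᵏ: dividing by Φ_m squares the loss, so k doubles at
-- each new prime.
twoSided-∤ : ∀ {p m k} → Prime p → 1 ≤ m → p ∤ m → TwoSided m k → TwoSided (p * m) (k + k)
twoSided-∤ {p} {m} {k} pr 1≤m p∤m two x y lop 1≤M =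
    subst₂ (λ a b → a ≤ c * A × b ≤ c * M ^ E) (ℕₚ.*-identityˡ (M ^ E)) (ℕₚ.*-identityˡ A)
      (subst (λ c → 1 * M ^ E ≤ c * A × 1 * A ≤ c * M ^ E) (sym (ℕₚ.^-distribˡ-+-* 2 k k)) quot)
  where
  e E M A B C c : ℕ
  e = totient m
  E = totient (p * m)
  M = maxAbs x y
  A = ∣ Φ (p * m) x y ∣
  B = ∣ Φ m x y ∣
  C = ∣ Φ m (x ℤ.^ p) (y ℤ.^ p) ∣
  c = 2 ^ (k + k)
  A*B : A * B ≡ C
  A*B = trans (sym (ℤₚ.abs-* (Φ (p * m) x y) (Φ m x y))) (cong ∣_∣ (Φ-prime-∤ pr 1≤m p∤m x y))
  M^ : maxAbs (x ℤ.^ p) (y ℤ.^ p) ^ e ≡ M ^ E * M ^ e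
  M^ = trans (cong (_^ e) (maxAbs-^ x y p)) (trans (ℕₚ.^-*-assoc M p e)
    (trans (cong (M ^_) (sym (totient-prime-∤ pr p∤m))) (ℕₚ.^-distribˡ-+-* M E e)))
  atB : M ^ e ≤ 2 ^ k * B × B ≤ 2 ^ k * M ^ e
  atB = two x y lop 1≤M
  atC : M ^ E * M ^ e ≤ 2 ^ k * C × C ≤ 2 ^ k * (M ^ E * M ^ e)
  atC = subst (λ a → a ≤ 2 ^ k * C × C ≤ 2 ^ k * a) M^
    (two (x ℤ.^ p) (y ℤ.^ p) (lopsided-^ {x} {y} p (ℕₚ.<⇒≤ (prime≥2 pr)) lop) (maxAbs-^-pos {x} {y} p 1≤M))
  quot : 1 * M ^ E ≤ 2 ^ k * 2 ^ k * A × 1 * A ≤ 2 ^ k * 2 ^ k * M ^ E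
  quot = quotient-bounds 1 (2 ^ k) (2 ^ k) (M ^ e) (M ^ E) A B {{>-nonZero (^-pos e 1≤M)}} A*B
    (subst (_≤ 2 ^ k * B) (sym (ℕₚ.*-identityˡ (M ^ e))) (proj₁ atB)) (proj₂ atB)
    (subst (_≤ 2 ^ k * C) (sym (ℕₚ.*-identityˡ (M ^ E * M ^ e))) (proj₁ atC)) (proj₂ atC)

-- The loss 2ᵏ, where k = 2^ω(n), is small: φ(n)⁴ / (n k⁴) is multiplicative, with local factor
-- below 1 only at the primes 2 and 3, where it is at least 1/32 and 1/3.
c₂ c₃ : ℕ → ℕ
c₂ n = [ 2 ∣? n ] 32 else-1
c₃ n = [ 3 ∣? n ] 3 else-1

else-1-mono : ∀ {A B : Set} (d : Dec A) (d′ : Dec B) {v} → 1 ≤ v → (A → B) → [ d ] v else-1 ≤ [ d′ ] v else-1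
else-1-mono (yes a) d′       1≤v f = ℕₚ.≤-reflexive (sym (else-1-yes d′ (f a)))
else-1-mono (no _)  (yes _)  1≤v f = 1≤v
else-1-mono (no _)  (no _)   1≤v f = ℕₚ.≤-refl

else-1-≤ : ∀ {A : Set} (d : Dec A) {v} → 1 ≤ v → [ d ] v else-1 ≤ v
else-1-≤ (yes _) _   = ℕₚ.≤-refl
else-1-≤ (no _)  1≤v = 1≤v

c₂-mono : ∀ p m → c₂ m ≤ c₂ (p * m)
c₂-mono p m = else-1-mono (2 ∣? m) (2 ∣? (p * m)) (s≤s z≤n) (∣n⇒∣m*n p)

c₃-mono : ∀ p m → c₃ m ≤ c₃ (p * m)
c₃-mono p m = else-1-mono (3 ∣? m) (3 ∣? (p * m)) (s≤s z≤n) (∣n⇒∣m*n p)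

-- With p = 4 + q, three of the factors 3 + q are bounded below by 3; the linear inequality left has
-- the slack 17 + 11 q.
16p≤[p-1]⁴ : ∀ q → 16 * (4 + q) ≤ (3 + q) ^ 4
16p≤[p-1]⁴ q = begin
  16 * (4 + q)              ≤⟨ ℕₚ.m≤m+n (16 * (4 + q)) (17 + 11 * q) ⟩
  16 * (4 + q) + (17 + 11 * q) ≡⟨ solve 1 (λ q → con 16 :* (con 4 :+ q) :+ (con 17 :+ con 11 :* q) := (con 3 :+ q) :* con 27) refl q ⟩
  (3 + q) * 27              ≤⟨ ℕₚ.*-monoʳ-≤ (3 + q) (ℕₚ.^-monoˡ-≤ 3 (ℕₚ.m≤m+n 3 q)) ⟩
  (3 + q) * (3 + q) ^ 3     ∎
  where
  open ℕₚ.≤-Reasoning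
  open +-*-Solver

-- A new prime p multiplies n by p, k⁴ by 16 and φ(n)⁴ by (p - 1)⁴. The constants 32 = 16 · 2 / 1⁴
-- and 3 = 16 · 3 / 2⁴ make up exactly the deficits at 2 and 3.
local-factor : ∀ {r m} → Prime (suc r) → suc r ∤ m → 16 * suc r * (c₂ m * c₃ m) ≤ c₂ (suc r * m) * c₃ (suc r * m) * r ^ 4
local-factor {0} {m} pr _ = contradiction pr ¬prime[1]
local-factor {1} {m} pr 2∤m = begin
  32 * (c₂ m * c₃ m)           ≡⟨ cong (λ z → 32 * (z * c₃ m)) (else-1-no (2 ∣? m) 2∤m) ⟩
  32 * (1 * c₃ m)              ≡⟨ cong (32 *_) (ℕₚ.*-identityˡ (c₃ m)) ⟩
  32 * c₃ m                    ≤⟨ ℕₚ.*-monoʳ-≤ 32 (c₃-mono 2 m) ⟩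
  32 * c₃ (2 * m)              ≡⟨ cong (_* c₃ (2 * m)) (else-1-yes (2 ∣? (2 * m)) (m∣m*n m)) ⟨
  c₂ (2 * m) * c₃ (2 * m)      ≡⟨ ℕₚ.*-identityʳ _ ⟨
  c₂ (2 * m) * c₃ (2 * m) * 1  ∎
  where open ℕₚ.≤-Reasoning
local-factor {2} {m} pr 3∤m = begin
  48 * (c₂ m * c₃ m)           ≡⟨ cong (λ z → 48 * (c₂ m * z)) (else-1-no (3 ∣? m) 3∤m) ⟩
  48 * (c₂ m * 1)              ≡⟨ solve 1 (λ c → con 48 :* (c :* con 1) := c :* con 3 :* con 16) refl (c₂ m) ⟩
  c₂ m * 3 * 16                ≤⟨ ℕₚ.*-monoˡ-≤ 16 (ℕₚ.*-monoˡ-≤ 3 (c₂-mono 3 m)) ⟩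
  c₂ (3 * m) * 3 * 16          ≡⟨ cong (λ z → c₂ (3 * m) * z * 16) (else-1-yes (3 ∣? (3 * m)) (m∣m*n m)) ⟨
  c₂ (3 * m) * c₃ (3 * m) * 16 ∎
  where
  open ℕₚ.≤-Reasoning
  open +-*-Solver
local-factor {suc (suc (suc q))} {m} pr _ = begin
  16 * p * (c₂ m * c₃ m)       ≡⟨ ℕₚ.*-comm (16 * p) (c₂ m * c₃ m) ⟩
  c₂ m * c₃ m * (16 * p)       ≤⟨ ℕₚ.*-mono-≤ (ℕₚ.*-mono-≤ (c₂-mono p m) (c₃-mono p m)) (16p≤[p-1]⁴ q) ⟩
  c₂ (p * m) * c₃ (p * m) * (3 + q) ^ 4 ∎
  where
  open ℕₚ.≤-Reasoning
  p : ℕ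
  p = 4 + q

record SmallLoss (n : ℕ) : Set where
  field
    k        : ℕ
    1≤k      : 1 ≤ k
    twoSided : TwoSided n k
    small    : n * k ^ 4 ≤ c₂ n * c₃ n * totient n ^ 4

smallLoss : ∀ n → 1 ≤ n → SmallLoss n
smallLoss = prime-induction SmallLoss
    (record { k = 1 ; 1≤k = s≤s z≤n ; twoSided = twoSided-1 ; small = s≤s z≤n }) step
  where
  open ℕₚ.≤-Reasoning
  open +-*-Solver
  step : ∀ p m → Prime p → 1 ≤ m → SmallLoss m → SmallLoss (p * m)
  step p@(suc r) m pr 1≤m record { k = k ; 1≤k = 1≤k ; twoSided = two ; small = sm } = cases (p ∣? m)
    where
    e : ℕ
    e = totient m
    cases : Dec (p ∣ m) → SmallLoss (p * m)
    cases (yes p∣m) = record { k = k ; 1≤k = 1≤k ; twoSided = twoSided-∣ {k = k} pr 1≤m p∣m two ; small = begin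
      p * m * k ^ 4                                ≡⟨ ℕₚ.*-assoc p m (k ^ 4) ⟩
      p * (m * k ^ 4)                              ≤⟨ ℕₚ.*-mono-≤ (ℕₚ.m≤m*n p (p ^ 3) {{ℕₚ.m^n≢0 p 3}}) sm ⟩
      p ^ 4 * (c₂ m * c₃ m * e ^ 4)                ≤⟨ ℕₚ.*-monoʳ-≤ (p ^ 4) (ℕₚ.*-monoˡ-≤ (e ^ 4) (ℕₚ.*-mono-≤ (c₂-mono p m) (c₃-mono p m))) ⟩
      p ^ 4 * (c * e ^ 4)                          ≡⟨ solve 3 (λ a b c → a :* (b :* c) := b :* (a :* c)) refl (p ^ 4) c (e ^ 4) ⟩
      c * (p ^ 4 * e ^ 4)                          ≡⟨ cong (c *_) (^-distribʳ-* 4 p e) ⟨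
      c * (p * e) ^ 4                              ≡⟨ cong (λ E → c * E ^ 4) (totient-prime-∣ pr p∣m) ⟨
      c * totient (p * m) ^ 4                      ∎ }
      where
      c : ℕ
      c = c₂ (p * m) * c₃ (p * m)
    cases (no p∤m) = record { k = k + k ; 1≤k = ℕₚ.≤-trans 1≤k (ℕₚ.m≤m+n k k) ; twoSided = twoSided-∤ {k = k} pr 1≤m p∤m two ; small = begin
      p * m * (k + k) ^ 4                          ≡⟨ cong (λ z → p * m * z ^ 4) (cong (λ z → k + z) (sym (ℕₚ.+-identityʳ k))) ⟩
      p * m * (2 * k) ^ 4                          ≡⟨ cong (p * m *_) (^-distribʳ-* 4 2 k) ⟩
      p * m * (16 * k ^ 4)                         ≡⟨ solve 3 (λ p m z → p :* m :* (con 16 :* z) := con 16 :* p :* (m :* z)) refl p m (k ^ 4) ⟩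
      16 * p * (m * k ^ 4)                         ≤⟨ ℕₚ.*-monoʳ-≤ (16 * p) sm ⟩
      16 * p * (c₂ m * c₃ m * e ^ 4)               ≡⟨ ℕₚ.*-assoc (16 * p) (c₂ m * c₃ m) (e ^ 4) ⟨
      16 * p * (c₂ m * c₃ m) * e ^ 4               ≤⟨ ℕₚ.*-monoˡ-≤ (e ^ 4) (local-factor pr p∤m) ⟩
      c * r ^ 4 * e ^ 4                            ≡⟨ ℕₚ.*-assoc c (r ^ 4) (e ^ 4) ⟩
      c * (r ^ 4 * e ^ 4)                          ≡⟨ cong (c *_) (^-distribʳ-* 4 r e) ⟨
      c * (r * e) ^ 4                              ≡⟨ cong (λ E → c * E ^ 4) E≡ ⟨
      c * totient (p * m) ^ 4                      ∎ }
      where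
      c : ℕ
      c = c₂ (p * m) * c₃ (p * m)
      E≡ : totient (p * m) ≡ r * e
      E≡ = ℕₚ.+-cancelʳ-≡ e _ _ (trans (totient-prime-∤ pr p∤m) (ℕₚ.+-comm e (r * e)))

-- Solutions of Φₙ(x,y) ≤ 2^{θφ(n)}

2^-cancel-≤ : ∀ {m n} → 2 ^ m ≤ 2 ^ n → m ≤ n
2^-cancel-≤ {m} {n} h = ℕₚ.≮⇒≥ λ n<m → ℕₚ.<-irrefl refl (ℕₚ.<-≤-trans (ℕₚ.^-monoʳ-< 2 ℕₚ.≤-refl n<m) h)

small : List ℤ
small = ℤ.-[1+ 1 ] ∷ ℤ.-[1+ 0 ] ∷ + 0 ∷ + 1 ∷ + 2 ∷ []

∈-small : ∀ x → ∣ x ∣ ≤ 2 → x ∈ small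
∈-small ℤ.-[1+ 1 ] _ = here refl
∈-small ℤ.-[1+ 0 ] _ = there (here refl)
∈-small (+ 0)      _ = there (there (here refl))
∈-small (+ 1)      _ = there (there (there (here refl)))
∈-small (+ 2)      _ = there (there (there (there (here refl))))
∈-small ℤ.-[1+ suc (suc _) ] (s≤s (s≤s ()))
∈-small (+ suc (suc (suc _))) (s≤s (s≤s ()))

abs≡2 : ∀ x → ∣ x ∣ ≡ 2 → Σ ℤ λ s → x ≡ + 2 ℤ.* s × ∣ s ∣ ≡ 1
abs≡2 (+ 2)      refl = + 1 , refl , refl
abs≡2 ℤ.-[1+ 1 ] refl = - + 1 , refl , refl

module _ (p q : ℕ) (p<q : p < q) where

  Solution : ℕ × ℤ × ℤ → Set
  Solution (n , x , y) = 3 ≤ n × 2 ≤ maxAbs x y × (≤2^[ p / q ]· totient n) (Φ n x y)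

  solution? : ∀ t → Dec (Solution t)
  solution? (n , x , y) = (3 ℕₚ.≤? n) ×-dec ((2 ℕₚ.≤? maxAbs x y)
    ×-dec ((Φ n x y ℤₚ.≤? + 0) ⊎-dec (Φ n x y ℤ.^ q ℤₚ.≤? + (2 ^ (p * totient n)))))

  module Analysis {n : ℕ} {x y : ℤ} (sol : Solution (n , x , y)) where
    open ℕₚ.≤-Reasoning

    3≤n : 3 ≤ n
    3≤n = proj₁ sol

    1≤n : 1 ≤ n
    1≤n = ℕₚ.≤-trans (s≤s z≤n) 3≤n

    2≤M : 2 ≤ maxAbs x y
    2≤M = proj₁ (proj₂ sol)

    e : ℕ
    e = totient n

    bounds : PositiveBounds n x y
    bounds = positiveBounds n 3≤n x y (ℕₚ.<⇒≤ 2≤M)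

    V : ℕ
    V = PositiveBounds.val bounds

    Φ≡V : Φ n x y ≡ + V
    Φ≡V = PositiveBounds.Φ≡val bounds

    V^q≤ : V ^ q ≤ 2 ^ (p * e)
    V^q≤ = [ (λ Φ≤0 → contradiction (ℤₚ.drop‿+≤+ (subst (ℤ._≤ + 0) Φ≡V Φ≤0)) (ℕₚ.<⇒≱ (PositiveBounds.val-pos bounds (ℕₚ.<⇒≤ 2≤M))))
           , (λ Φ^q≤ → ℤₚ.drop‿+≤+ (subst (ℤ._≤ + (2 ^ (p * e))) (trans (cong (ℤ._^ q) Φ≡V) (pos-^ V q)) Φ^q≤)) ]′ (proj₂ (proj₂ sol))

    -- Here θ < 1 enters: V ≥ 2ᵉ would give 2^(e q) ≤ V^q ≤ 2^(p e), against p e < q e.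
    V<2^e : V < 2 ^ e
    V<2^e = ℕₚ.≰⇒> λ 2^e≤V → ℕₚ.<-irrefl refl (begin-strict
      p * e   <⟨ ℕₚ.*-monoˡ-< e {{>-nonZero (totient-pos n 1≤n)}} p<q ⟩
      q * e   ≡⟨ ℕₚ.*-comm q e ⟩
      e * q   ≤⟨ 2^-cancel-≤ (begin
        2 ^ (e * q)  ≡⟨ ℕₚ.^-*-assoc 2 e q ⟨
        (2 ^ e) ^ q  ≤⟨ ℕₚ.^-monoˡ-≤ q 2^e≤V ⟩
        V ^ q        ≤⟨ V^q≤ ⟩
        2 ^ (p * e)  ∎) ⟩
      p * e   ∎)

    M≡2 : maxAbs x y ≡ 2
    -- For M ≥ 3 the lower bound (2M/3)ᵉ is already at least 2ᵉ.
    M≡2 = ℕₚ.≤-antisym (ℕₚ.≮⇒≥ λ 3≤M → ℕₚ.<⇒≱ V<2^e (ℕₚ.*-cancelˡ-≤ (3 ^ e) {{ℕₚ.m^n≢0 3 e}} (begin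
        3 ^ e * 2 ^ e                  ≡⟨ ℕₚ.*-comm (3 ^ e) (2 ^ e) ⟩
        2 ^ e * 3 ^ e                  ≤⟨ ℕₚ.*-monoʳ-≤ (2 ^ e) (ℕₚ.^-monoˡ-≤ e 3≤M) ⟩
        2 ^ e * maxAbs x y ^ e         ≤⟨ PositiveBounds.lower bounds ⟩
        3 ^ e * V                      ∎))) 2≤M

    ∣x∣≤2 : ∣ x ∣ ≤ 2
    ∣x∣≤2 = subst (∣ x ∣ ≤_) M≡2 (ℕₚ.m≤m⊔n ∣ x ∣ ∣ y ∣)

    ∣y∣≤2 : ∣ y ∣ ≤ 2
    ∣y∣≤2 = subst (∣ y ∣ ≤_) M≡2 (ℕₚ.m≤n⊔m ∣ x ∣ ∣ y ∣)

    -- (±2, ±2) is excluded: there Φₙ(x,y) = 2^φ(n) Φₙ(±1,±1) ≥ 2^φ(n).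
    not-both-2 : ∣ x ∣ ≡ 2 → ∣ y ∣ ≡ 2 → ⊥
    not-both-2 ∣x∣≡2 ∣y∣≡2 with abs≡2 x ∣x∣≡2 | abs≡2 y ∣y∣≡2
    ... | s , x≡ , ∣s∣≡1 | t , y≡ , ∣t∣≡1 = ℕₚ.<⇒≱ V<2^e (subst (2 ^ e ≤_) (sym V≡) (ℕₚ.m≤m*n (2 ^ e) W {{>-nonZero (PositiveBounds.val-pos unit 1≤m)}}))
      where
      1≤m : 1 ≤ maxAbs s t
      1≤m = ℕₚ.≤-reflexive (sym (cong₂ _⊔_ ∣s∣≡1 ∣t∣≡1))
      unit : PositiveBounds n s t
      unit = positiveBounds n 3≤n s t 1≤m
      W : ℕ
      W = PositiveBounds.val unit
      V≡ : V ≡ 2 ^ e * W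
      V≡ = ℤₚ.+-injective (trans (sym Φ≡V) (trans (cong₂ (Φ n) x≡ y≡) (trans (Form.homogeneous (Φ-form n 1≤n) (+ 2) s t)
        (trans (cong₂ ℤ._*_ (pos-^ 2 e) (PositiveBounds.Φ≡val unit)) (sym (ℤₚ.pos-* (2 ^ e) W))))))

    lopsided : Lopsided x y
    lopsided with ℕₚ.m≤n⇒m<n∨m≡n ∣x∣≤2 | ℕₚ.m≤n⇒m<n∨m≡n ∣y∣≤2
    ... | inj₂ x≡2 | inj₂ y≡2 = ⊥-elim (not-both-2 x≡2 y≡2)
    ... | inj₂ x≡2 | inj₁ (s≤s y≤1) = inj₁ (subst (2 * ∣ y ∣ ≤_) (sym x≡2) (ℕₚ.*-monoʳ-≤ 2 y≤1))
    ... | inj₁ (s≤s x≤1) | inj₂ y≡2 = inj₂ (subst (2 * ∣ x ∣ ≤_) (sym y≡2) (ℕₚ.*-monoʳ-≤ 2 x≤1))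
    ... | inj₁ (s≤s x≤1) | inj₁ (s≤s y≤1) = contradiction (subst (_≤ 1) M≡2 (ℕₚ.⊔-lub x≤1 y≤1)) (ℕₚ.<-irrefl refl)

    open SmallLoss (smallLoss n 1≤n) renaming (small to n*k⁴≤)

    -- Since M = 2, 2^(e q) ≤ (2ᵏ V)^q ≤ 2^(k q + p e), so q e ≤ k q + p e; integrality, p + 1 ≤ q,
    -- leaves one whole e.
    e≤kq : e ≤ k * q
    e≤kq = ℕₚ.+-cancelʳ-≤ (p * e) e (k * q) (begin
      suc p * e              ≤⟨ ℕₚ.*-monoˡ-≤ e p<q ⟩
      q * e                  ≡⟨ ℕₚ.*-comm q e ⟩
      e * q                  ≤⟨ 2^-cancel-≤ (begin
        2 ^ (e * q)                  ≡⟨ ℕₚ.^-*-assoc 2 e q ⟨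
        (2 ^ e) ^ q                  ≡⟨ cong (λ M → (M ^ e) ^ q) M≡2 ⟨
        (maxAbs x y ^ e) ^ q         ≤⟨ ℕₚ.^-monoˡ-≤ q (proj₁ (twoSided x y lopsided (ℕₚ.<⇒≤ 2≤M))) ⟩
        (2 ^ k * ∣ Φ n x y ∣) ^ q    ≡⟨ cong (λ z → (2 ^ k * ∣ z ∣) ^ q) Φ≡V ⟩
        (2 ^ k * V) ^ q              ≡⟨ ^-distribʳ-* q (2 ^ k) V ⟩
        (2 ^ k) ^ q * V ^ q          ≤⟨ ℕₚ.*-mono-≤ (ℕₚ.≤-reflexive (ℕₚ.^-*-assoc 2 k q)) V^q≤ ⟩
        2 ^ (k * q) * 2 ^ (p * e)    ≡⟨ ℕₚ.^-distribˡ-+-* 2 (k * q) (p * e) ⟨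
        2 ^ (k * q + p * e)          ∎) ⟩
      k * q + p * e          ∎)

    -- k and φ(n) occur to the same power in `n*k⁴≤`, so φ(n) ≤ k q lets k⁴ cancel; 96 = 32 · 3.
    n≤96q⁴ : n ≤ 96 * q ^ 4
    n≤96q⁴ = ℕₚ.*-cancelʳ-≤ n (96 * q ^ 4) (k ^ 4) {{ℕₚ.m^n≢0 k 4 {{>-nonZero 1≤k}}}} (begin
      n * k ^ 4                     ≤⟨ n*k⁴≤ ⟩
      c₂ n * c₃ n * e ^ 4           ≤⟨ ℕₚ.*-mono-≤ (ℕₚ.*-mono-≤ (else-1-≤ (2 ∣? n) (s≤s z≤n)) (else-1-≤ (3 ∣? n) (s≤s z≤n))) (ℕₚ.^-monoˡ-≤ 4 e≤kq) ⟩
      96 * (k * q) ^ 4              ≡⟨ cong (96 *_) (trans (cong (_^ 4) (ℕₚ.*-comm k q)) (^-distribʳ-* 4 q k)) ⟩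
      96 * (q ^ 4 * k ^ 4)          ≡⟨ ℕₚ.*-assoc 96 (q ^ 4) (k ^ 4) ⟨
      96 * q ^ 4 * k ^ 4            ∎)

  -- An explicit finite box, whose range of n depends on θ only through q; filtering it by
  -- `solution?` determines the solutions effectively.
  candidates : List (ℕ × ℤ × ℤ)
  candidates = cartesianProduct (upTo (suc (96 * q ^ 4))) (cartesianProduct small small)

  solution⇒candidate : ∀ {t} → Solution t → t ∈ candidates
  solution⇒candidate {n , x , y} sol = ∈-cartesianProduct⁺ (∈-upTo⁺ (s≤s n≤96q⁴)) (∈-cartesianProduct⁺ (∈-small x ∣x∣≤2) (∈-small y ∣y∣≤2))
    where open Analysis {n} {x} {y} sol

theorem1p2 : (p q : ℕ) → 0 < p → p < q →
    Σ (List (ℕ × ℤ × ℤ)) (λ L →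
    ((n : ℕ) (x y : ℤ) →
    ((n , x , y) ∈ L) ⇔ (3 ≤ n × 2 ≤ maxAbs x y × (≤2^[ p / q ]· totient n) (Φ n x y)))
    × ((n : ℕ) (x y : ℤ) → 3 ≤ n → 2 ≤ maxAbs x y →
    (≤2^[ p / q ]· totient n) (Φ n x y) → maxAbs x y ≡ 2))
theorem1p2 p q _ p<q = filter (solution? p q p<q) (candidates p q p<q)
  , (λ n x y → mk⇔
      (λ ∈L → proj₂ (∈-filter⁻ (solution? p q p<q) {xs = candidates p q p<q} ∈L))
      (λ sol → ∈-filter⁺ (solution? p q p<q) (solution⇒candidate p q p<q {n , x , y} sol) sol))
  , (λ n x y 3≤n 2≤M Φ≤ → Analysis.M≡2 p q p<q {n} {x} {y} (3≤n , 2≤M , Φ≤))
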